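{- Let $G$ be a finite simple graph of order $n$ having no component isomorphic to $K_{1,u}$ for any integer $u\geq 0$. Then $s_g(G)=n$ if $n\equiv 1 \pmod 2$; $s_g(G)=n+1$ if $n\equiv 2\pmod 4$; and $s_g(G)\leq n+1$ if $n\equiv 0\pmod 4$.
   Context: Here $K_{1,0}$ is a single (isolated) vertex, $K_{1,1}=K_2$, and $K_{1,u}$ is the star with $u$ leaves. For an Abelian group $\mathcal{G}$ and an edge labeling $f:E(G)\to\mathcal{G}$, the weighted degree of a vertex $v$ is $w(v)=\sum_{u\in N(v)} f(uv)$ (sum in $\mathcal{G}$); $f$ is $\mathcal{G}$-irregular if all weighted degrees are pairwise distinct. The group irregularity strength $s_g(G)$ is the smallest integer $s$ such that for every Abelian group $\mathcal{G}$ of order $s$ there exists a $\mathcal{G}$-irregular labeling of $G$. -}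

module Defs where

open import Level using (0ℓ)
open import Data.Nat using (ℕ; zero; suc; _≤_; _<_)
open import Data.Fin using (Fin; zero; suc)
open import Data.Bool using (Bool; true; false; if_then_else_)
open import Data.Product using (Σ; ∃; _×_; _,_)
open import Relation.Binary.PropositionalEquality using (_≡_)
open import Relation.Nullary using (¬_)
open import Algebra.Bundles using (AbelianGroup)

record Graph (n : ℕ) : Set where
  field
    adj    : Fin n → Fin n → Bool
    sym    : ∀ i j → adj i j ≡ adj j i
    irrefl : ∀ i → adj i i ≡ false
open Graph public

data Reach {n : ℕ} (G : Graph n) (i : Fin n) : Fin n → Set where
  here : Reach G i i
  step : ∀ {j k} → Reach G i j → adj G j k ≡ true → Reach G i k

-- The component of G containing v is isomorphic to a star K_{1,u}
-- for some u ≥ 0: it has a vertex c (the centre) adjacent to every other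
-- vertex of the component, and no two non-centre vertices of the
-- component are adjacent.  (u = 0: isolated vertex; u = 1: K_2.)
ComponentIsStar : {n : ℕ} → Graph n → Fin n → Set
ComponentIsStar {n} G v =
  Σ (Fin n) λ c → Reach G v c ×
    ((x : Fin n) → Reach G v x → ¬ (x ≡ c) → adj G c x ≡ true) ×
    ((x y : Fin n) → Reach G v x → Reach G v y →
       ¬ (x ≡ c) → ¬ (y ≡ c) → adj G x y ≡ false)

NoStarComponent : {n : ℕ} → Graph n → Set
NoStarComponent {n} G = (v : Fin n) → ¬ ComponentIsStar G v

HasOrder : AbelianGroup 0ℓ 0ℓ → ℕ → Set
HasOrder A s =
  Σ (Fin s → Carrier) λ e →
    ((x : Carrier) → ∃ λ i → e i ≈ x) ×
    ((i j : Fin s) → e i ≈ e j → i ≡ j)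
  where open AbelianGroup A

gsum : (A : AbelianGroup 0ℓ 0ℓ) → (m : ℕ) → (Fin m → AbelianGroup.Carrier A) →
       AbelianGroup.Carrier A
gsum A zero    f = AbelianGroup.ε A
gsum A (suc m) f = AbelianGroup._∙_ A (f zero) (gsum A m (λ i → f (suc i)))

-- An edge labeling with values in A: a symmetric function on vertex
-- pairs; only the values on edges are used (f(uv) = lab u v = lab v u).
record Labeling {n : ℕ} (G : Graph n) (A : AbelianGroup 0ℓ 0ℓ) : Set where
  open AbelianGroup A
  field
    lab  : Fin n → Fin n → Carrier
    lsym : ∀ i j → lab i j ≈ lab j i
open Labeling public

wdeg : {n : ℕ} (G : Graph n) (A : AbelianGroup 0ℓ 0ℓ) → Labeling G A →
       Fin n → AbelianGroup.Carrier A
wdeg {n} G A f v =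
  gsum A n (λ u → if adj G v u then lab f v u else AbelianGroup.ε A)

Irregular : {n : ℕ} (G : Graph n) (A : AbelianGroup 0ℓ 0ℓ) → Labeling G A → Set
Irregular {n} G A f =
  (i j : Fin n) → AbelianGroup._≈_ A (wdeg G A f i) (wdeg G A f j) → i ≡ j

GoodOrder : {n : ℕ} → Graph n → ℕ → Set₁
GoodOrder G s = (A : AbelianGroup 0ℓ 0ℓ) → HasOrder A s →
                Σ (Labeling G A) λ f → Irregular G A f

SgEq : {n : ℕ} → Graph n → ℕ → Set₁
SgEq G s = (1 ≤ s) × GoodOrder G s × ((t : ℕ) → 1 ≤ t → t < s → ¬ GoodOrder G t)

-- s_g(G) ≤ m : the minimum exists and is ≤ m, i.e. some positive good
-- order t ≤ m exists.
SgLe : {n : ℕ} → Graph n → ℕ → Set₁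
SgLe G m = Σ ℕ λ t → (1 ≤ t) × (t ≤ m) × GoodOrder G t

{-# OPTIONS --safe #-}
-- An irregular labelling over a group A of odd order s ∈ {n, n+1} is found as follows.  Write [x ↦ a] for the weight
-- function with value a at x and 0 elsewhere.  If x – c – y is a path, labelling its edges a, −a realises [x ↦ a] + [y ↦ −a].
-- Hence any weights summing to zero are realisable on a set of vertices connected through such steps, and since no component
-- is a star, the vertices can be partitioned into such sets ("blocks") of size at least two.  It remains to partition A
-- (or A ∖ {0}) into zero-sum sets of the sizes of the blocks, for which it suffices to partition A ∖ {0} into zero-sum
-- triples T, their negatives −T, and at most two pairs {p, −p}.  Such a packing is built along a chain of subgroups with
-- prime indices p.  For p = 1 mod 6 the quotient has a perfect packing (Peltesohn's difference triples), which lifts; p = 3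
-- is done directly.  For p = 5 mod 6 two consecutive indices p, p′ are treated at once: the quotient is (ℤ/p)², packed by the
-- orbits of the rotation of order six of the hexagonal lattice, or cyclic of order pp′, packed as before if pp′ = 1 mod 6.
module Submission where

-- Blocks of any sizes can be served because of two counts. A block of odd size takes one triple and
-- otherwise pairs; since s is odd, the number of odd blocks is even, so triples can be consumed as
-- T together with -T, while the remaining T dissolve with their -T into three pairs each. If j of
-- the τ triples have to be kept, then 3j ≤ 3τ + π, where π is the number of pairs of the packing,
-- and π ≤ 2 gives j ≤ τ. This is why at most two pairs are allowed, and why p = 5 mod 6 is the
-- obstacle: there the quotient has 4 mod 6 nonzero elements, so two pairs of cosets remain, and
-- each would lift to as many pairs as the subgroup has elements. Only a layer directly above the
-- trivial subgroup may keep its two pairs; higher up, such an index is joined with the next one or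
-- moved below it. Packings do not record disjointness: they are coverings with a bound on their
-- size, and a covering of an s-element set by s values has no repetitions.

-- Difference triples in cyclic groups

module CyclicDesigns where
  open import Data.Nat as ℕ using (ℕ; zero; suc; _+_; _*_; _∸_; _≤_; _<_; z≤n; s≤s)
  open import Data.Nat.Properties
  import Data.Nat.Tactic.RingSolver as NatSolver
  open import Data.List using (List; []; _∷_; _++_; map; length)
  open import Data.List.Properties using (length-map; length-++)
  open import Data.List.Relation.Unary.Any using (here; there)
  open import Data.List.Membership.Propositional using (_∈_)
  open import Data.List.Membership.Propositional.Properties using (∈-map⁺; ∈-++⁺ˡ; ∈-++⁺ʳ)
  open import Data.Product using (∃; ∃₂; _×_; _,_)
  open import Data.Sum using (_⊎_; inj₁; inj₂)
  open import Relation.Nullary using (yes; no)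
  open import Relation.Binary.PropositionalEquality using (_≡_; refl; sym; trans; cong; cong₂; subst)

  -- Membership of x in ±a, ±b, ±(a+b) modulo m, written with equations of naturals: x = y for the
  -- residue of y, and x + y = m for that of -y, so that neither subtraction nor reduction modulo m
  -- occurs.
  data Hits (m a b x : ℕ) : Set where
    hit-a : x ≡ a → Hits m a b x
    hit-b : x ≡ b → Hits m a b x
    hit-c : x ≡ a + b → Hits m a b x
    hit-−a : x + a ≡ m → Hits m a b x
    hit-−b : x + b ≡ m → Hits m a b x
    hit-−c : x + (a + b) ≡ m → Hits m a b x

  Covered : ℕ → List (ℕ × ℕ) → List ℕ → ℕ → Set
  Covered m ts ps x = (∃₂ λ a b → (a , b) ∈ ts × Hits m a b x) ⊎ (∃ λ p → p ∈ ps × (x ≡ p ⊎ x + p ≡ m))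

  -- (a , b) stands for the zero-sum triple (a, b, −(a+b)) of ℤ/m together with its negative, and p for the pair ±p.
  record Design (m : ℕ) : Set where
    field
      triples : List (ℕ × ℕ)
      pairs   : List ℕ
      few     : length pairs ≤ 2
      size    : 1 + 6 * length triples + 2 * length pairs ≡ m
      covers  : ∀ x → 0 < x → x < m → Covered m triples pairs x

  record PerfectDesign (m : ℕ) : Set where
    field
      design  : Design m
      perfect : Design.pairs design ≡ []

  Hits-flip : ∀ {m a b x y} → x + y ≡ m → Hits m a b x → Hits m a b y
  Hits-flip {x = x} {y} e (hit-a refl) = hit-−a (trans (+-comm y x) e)
  Hits-flip {x = x} {y} e (hit-b refl) = hit-−b (trans (+-comm y x) e)
  Hits-flip {x = x} {y} e (hit-c refl) = hit-−c (trans (+-comm y x) e)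
  Hits-flip {x = x} e (hit-−a f) = hit-a (+-cancelˡ-≡ x _ _ (trans e (sym f)))
  Hits-flip {x = x} e (hit-−b f) = hit-b (+-cancelˡ-≡ x _ _ (trans e (sym f)))
  Hits-flip {x = x} e (hit-−c f) = hit-c (+-cancelˡ-≡ x _ _ (trans e (sym f)))

  Covered-flip : ∀ {m ts ps x y} → x + y ≡ m → Covered m ts ps x → Covered m ts ps y
  Covered-flip e (inj₁ (a , b , i , h)) = inj₁ (a , b , i , Hits-flip e h)
  Covered-flip {x = x} {y} e (inj₂ (p , i , inj₁ refl)) = inj₂ (p , i , inj₂ (trans (+-comm y x) e))
  Covered-flip {x = x} e (inj₂ (p , i , inj₂ f)) = inj₂ (p , i , inj₁ (+-cancelˡ-≡ x _ _ (trans e (sym f))))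

  -- Triples come with their negatives and pairs are ±p, so coverage is invariant under x ↦ m - x;
  -- for m = 2h + 1 this reflection exchanges 1, ..., h with h + 1, ..., 2h.
  covers-half⇒covers : ∀ h {ts ps} → (∀ y → y < h → Covered (suc (h + h)) ts ps (suc y)) →
                       ∀ x → 0 < x → x < suc (h + h) → Covered (suc (h + h)) ts ps x
  covers-half⇒covers h half (suc y) _ (s≤s y<2h) with y ℕ.<? h
  ... | yes y<h = half y y<h
  ... | no y≮h = Covered-flip flipped (half z z<h)
    where
    z = h + h ∸ suc y
    z+1+y : z + suc y ≡ h + h
    z+1+y = m∸n+n≡m y<2h
    flipped : suc z + suc y ≡ suc (h + h)
    flipped = cong suc z+1+y
    z<h : z < h
    z<h = +-cancelʳ-< h z h (≤-trans (s≤s (+-monoʳ-≤ z (≮⇒≥ y≮h))) (≤-reflexive (trans (sym (+-suc z y)) z+1+y)))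

  -- All (r , r′) with r + r′ + 1 = t.  Families indexed by r < t use r′ for t − 1 − r, so that their descending members need
  -- no truncated subtraction.
  splits : ℕ → List (ℕ × ℕ)
  splits zero    = []
  splits (suc t) = (0 , t) ∷ map (λ (r , r′) → suc r , r′) (splits t)

  length-splits : ∀ t → length (splits t) ≡ t
  length-splits zero    = refl
  length-splits (suc t) = cong suc (trans (length-map _ (splits t)) (length-splits t))

  ∈-splits : ∀ r r′ {t} → suc (r + r′) ≡ t → (r , r′) ∈ splits t
  ∈-splits zero    r′ refl = here refl
  ∈-splits (suc r) r′ refl = there (∈-map⁺ _ (∈-splits r r′ refl))

  family : ℕ → (ℕ × ℕ → ℕ × ℕ) → List (ℕ × ℕ)
  family t f = map f (splits t)

  length-family : ∀ t f → length (family t f) ≡ t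
  length-family t f = trans (length-map f (splits t)) (length-splits t)

  ∈-family : ∀ {t} f r r′ → suc (r + r′) ≡ t → f (r , r′) ∈ family t f
  ∈-family f r r′ e = ∈-map⁺ f (∈-splits r r′ e)

  length-++₄ : ∀ {a b c d : List (ℕ × ℕ)} {i j k l} → length a ≡ i → length b ≡ j → length c ≡ k → length d ≡ l →
               length (a ++ b ++ c ++ d) ≡ i + (j + (k + l))
  length-++₄ {a} {b} {c} refl refl refl refl =
    trans (length-++ a) (cong (length a +_) (trans (length-++ b) (cong (length b +_) (length-++ c))))

  chop : ∀ n {k x} → x < n + k → x < n ⊎ ∃ λ y → x ≡ n + y × y < k
  chop zero    {x = x} x<k         = inj₂ (x , refl , x<k)
  chop (suc n) {x = zero}  _       = inj₁ (s≤s z≤n)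
  chop (suc n) {x = suc x} (s≤s l) with chop n l
  ... | inj₁ x<n           = inj₁ (s≤s x<n)
  ... | inj₂ (y , refl , b) = inj₂ (y , refl , b)

  complement : ∀ {t r} → r < t → ∃ λ r′ → suc (r + r′) ≡ t
  complement {suc t} {r} (s≤s r≤t) = t ∸ r , cong suc (m+[n∸m]≡n r≤t)

  complementʳ : ∀ {t r′} → r′ < t → ∃ λ r → suc (r + r′) ≡ t
  complementʳ {suc t} {r′} (s≤s r≤t) = t ∸ r′ , cong suc (m∸n+n≡m r≤t)

  data Mod2 (u v : ℕ) : ℕ → Set where
    2r   : ∀ r → r < u → Mod2 u v (r + r)
    2r+1 : ∀ r → r < v → Mod2 u v (suc (r + r))

  mod2 : ∀ u y → y < u + u → Mod2 u u y
  mod2 (suc u) zero y< = 2r 0 (s≤s z≤n)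
  mod2 (suc u) (suc zero) y< = 2r+1 0 (s≤s z≤n)
  mod2 (suc u) (suc (suc y)) (s≤s y<) with subst (suc y <_) (+-suc u u) y<
  ... | s≤s y<′ with mod2 u y y<′
  ... | 2r r r<u   = subst (Mod2 _ _) (cong suc (+-suc r r)) (2r (suc r) (s≤s r<u))
  ... | 2r+1 r r<u = subst (Mod2 _ _) (cong suc (cong suc (+-suc r r))) (2r+1 (suc r) (s≤s r<u))

  mod2′ : ∀ u y → y < u + suc u → Mod2 (suc u) u y
  mod2′ u y y< with chop (u + u) (subst (y <_) (trans (+-comm u (suc u)) (+-comm 1 (u + u))) y<)
  ... | inj₂ (zero , refl , _) = subst (Mod2 _ _) (sym (+-identityʳ (u + u))) (2r u ≤-refl)
  ... | inj₂ (suc _ , _ , s≤s ())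
  ... | inj₁ y<2u with mod2 u y y<2u
  ... | 2r r r<u = 2r r (m≤n⇒m≤1+n r<u)
  ... | 2r+1 r r<u = 2r+1 r r<u

  data Mod3 (u v w : ℕ) : ℕ → Set where
    3r   : ∀ r → r < u → Mod3 u v w (3 * r)
    3r+1 : ∀ r → r < v → Mod3 u v w (1 + 3 * r)
    3r+2 : ∀ r → r < w → Mod3 u v w (2 + 3 * r)

  mod3 : ∀ u y → y < 3 * u → Mod3 u u u y
  mod3 (suc u) 0 _ = 3r 0 (s≤s z≤n)
  mod3 (suc u) 1 _ = 3r+1 0 (s≤s z≤n)
  mod3 (suc u) 2 _ = 3r+2 0 (s≤s z≤n)
  mod3 (suc u) (suc (suc (suc y))) y< with subst (3 + y <_) (*-suc 3 u) y<
  ... | s≤s (s≤s (s≤s y<′)) with mod3 u y y<′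
  ... | 3r r r<u   = subst (Mod3 _ _ _) (*-suc 3 r) (3r (suc r) (s≤s r<u))
  ... | 3r+1 r r<u = subst (Mod3 _ _ _) (cong suc (*-suc 3 r)) (3r+1 (suc r) (s≤s r<u))
  ... | 3r+2 r r<u = subst (Mod3 _ _ _) (cong suc (cong suc (*-suc 3 r))) (3r+2 (suc r) (s≤s r<u))

  -- The common form of Peltesohn's systems for m = 18t + 1, 18t + 7 and 18t + 13: three arithmetic
  -- families, whose smallest members run through the three residue classes modulo 3, and one
  -- sporadic triple `s`.
  module ThreeFamilies (t₁ t₂ t₃ h : ℕ) (f₁ f₂ f₃ : ℕ × ℕ → ℕ × ℕ) (s : ℕ × ℕ) where
    ts : List (ℕ × ℕ)
    ts = family t₁ f₁ ++ family t₂ f₂ ++ family t₃ f₃ ++ s ∷ []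

    Cov : ℕ → Set
    Cov = Covered (suc (h + h)) ts []

    H : ℕ × ℕ → ℕ → Set
    H (a , b) = Hits (suc (h + h)) a b

    hit₁ : ∀ {x} r r′ → suc (r + r′) ≡ t₁ → H (f₁ (r , r′)) x → Cov x
    hit₁ r r′ e k = inj₁ (_ , _ , ∈-++⁺ˡ (∈-family f₁ r r′ e) , k)

    hit₂ : ∀ {x} r r′ → suc (r + r′) ≡ t₂ → H (f₂ (r , r′)) x → Cov x
    hit₂ r r′ e k = inj₁ (_ , _ , ∈-++⁺ʳ (family t₁ f₁) (∈-++⁺ˡ (∈-family f₂ r r′ e)) , k)

    hit₃ : ∀ {x} r r′ → suc (r + r′) ≡ t₃ → H (f₃ (r , r′)) x → Cov x
    hit₃ r r′ e k = inj₁ (_ , _ , ∈-++⁺ʳ (family t₁ f₁) (∈-++⁺ʳ (family t₂ f₂) (∈-++⁺ˡ (∈-family f₃ r r′ e))) , k)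

    hit₄ : ∀ {x} → H s x → Cov x
    hit₄ k = inj₁ (_ , _ , ∈-++⁺ʳ (family t₁ f₁) (∈-++⁺ʳ (family t₂ f₂) (∈-++⁺ʳ (family t₃ f₃) (here refl))) , k)

    design : (∀ y → y < h → Cov (suc y)) → 3 * (t₁ + (t₂ + (t₃ + 1))) ≡ h →
             PerfectDesign (1 + 6 * (t₁ + (t₂ + (t₃ + 1))))
    design half e = subst PerfectDesign (sym (lengths-agree e)) record { perfect = refl ; design = record
      { triples = ts
      ; pairs = []
      ; few = z≤n
      ; size = trans (cong (λ l → 1 + 6 * l + 0) lengths) (trans (+-identityʳ _) (lengths-agree e))
      ; covers = covers-half⇒covers h half
      } }
      where
      lengths : length ts ≡ t₁ + (t₂ + (t₃ + 1))
      lengths = length-++₄ {family t₁ f₁} {family t₂ f₂} {family t₃ f₃} {s ∷ []}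
                  (length-family t₁ f₁) (length-family t₂ f₂) (length-family t₃ f₃) refl
      arith : ∀ l → 1 + 6 * l ≡ suc (3 * l + 3 * l)
      arith = NatSolver.solve-∀
      lengths-agree : 3 * (t₁ + (t₂ + (t₃ + 1))) ≡ h → 1 + 6 * (t₁ + (t₂ + (t₃ + 1))) ≡ suc (h + h)
      lengths-agree e = trans (arith (t₁ + (t₂ + (t₃ + 1)))) (cong (λ k → suc (k + k)) e)

  -- Peltesohn's difference triples for m = 18t + 1.
  module Peltesohn₁ (u : ℕ) where
    t = suc u
    f₁ f₂ f₃ : ℕ × ℕ → ℕ × ℕ
    f₁ (r , r′) = 3 * r + 1 , 3 * t + r′ + 2
    f₂ (r , r′) = 3 * r + 2 , 7 * t + r′ + 1
    f₃ (r , r′) = 3 * r + 3 , 4 * t + 2 * r′ + 3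
    -- The summands are the lengths of consecutive intervals of 1, ..., h. The first holds the
    -- smallest members of all families, the single points are the two larger members 3t + 1 and 6t
    -- + 1 of the sporadic triple, and each other interval holds second members or sums of one
    -- family, or, in `u + t`, the sums of `f₁` alternating with the second members of `f₃`.
    h = 3 * t + (1 + (t + ((u + t) + (1 + (u + (t + t))))))
    open ThreeFamilies t t u h f₁ f₂ f₃ (3 * t , 3 * t + 1)

    low : ∀ {y} → Mod3 t t t y → Cov (suc y)
    low (3r r l) = let r′ , e = complement l in hit₁ r r′ e (hit-a (+-comm 1 (3 * r)))
    low (3r+1 r l) = let r′ , e = complement l in hit₂ r r′ e (hit-a (+-comm 2 (3 * r)))
    low (3r+2 r l) with chop u (subst (r <_) (+-comm 1 u) l)
    ... | inj₁ r<u = let r′ , e = complement r<u in hit₃ r r′ e (hit-a (+-comm 3 (3 * r)))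
    ... | inj₂ (0 , refl , _) = hit₄ (hit-a (arith u))
      where
      arith : ∀ u → suc (2 + 3 * (u + 0)) ≡ 3 * suc u
      arith = NatSolver.solve-∀
    ... | inj₂ (suc _ , _ , s≤s ())
    case1 : Cov (suc (3 * t + 0))
    case1 = hit₄ (hit-b (arith u))
      where
      arith : ∀ u → suc (3 * (suc u) + 0) ≡ 3 * (suc u) + 1
      arith = NatSolver.solve-∀
    case2 : ∀ r′ → r′ < t → Cov (suc (3 * t + (1 + r′)))
    case2 r′ l = let r , e = complementʳ l in hit₁ r r′ e (hit-b (arith r r′ u e))
      where
      arith : ∀ r r′ u → suc (r + r′) ≡ (suc u) → suc (3 * (suc u) + (1 + r′)) ≡ 3 * (suc u) + r′ + 2
      arith r r′ _ refl = NatSolver.solve (r ∷ r′ ∷ [])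
    case3 : ∀ z → z < u + t → Cov (suc (3 * t + (1 + (t + z))))
    case3 z l with mod2′ u z l
    ... | 2r r l′ = let r′ , e = complement l′ in hit₁ r r′ e (hit-c (arith r r′ u e))
      where
      arith : ∀ r r′ u → suc (r + r′) ≡ (suc u) → suc (3 * (suc u) + (1 + ((suc u) + (r + r)))) ≡ 3 * r + 1 + (3 * (suc u) + r′ + 2)
      arith r r′ _ refl = NatSolver.solve (r ∷ r′ ∷ [])
    ... | 2r+1 r′ l′ = let r , e = complementʳ l′ in hit₃ r r′ e (hit-b (arith r r′ u e))
      where
      arith : ∀ r r′ u → suc (r + r′) ≡ u → suc (3 * (suc u) + (1 + ((suc u) + (suc (r′ + r′))))) ≡ 4 * (suc u) + 2 * r′ + 3
      arith r r′ _ refl = NatSolver.solve (r ∷ r′ ∷ [])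
    case4 : Cov (suc (3 * t + (1 + (t + ((u + t) + 0)))))
    case4 = hit₄ (hit-c (arith u))
      where
      arith : ∀ u → suc (3 * (suc u) + (1 + ((suc u) + ((u + (suc u)) + 0)))) ≡ 3 * (suc u) + (3 * (suc u) + 1)
      arith = NatSolver.solve-∀
    case5 : ∀ r → r < u → Cov (suc (3 * t + (1 + (t + ((u + t) + (1 + r))))))
    case5 r l = let r′ , e = complement l in hit₃ r r′ e (hit-c (arith r r′ u e))
      where
      arith : ∀ r r′ u → suc (r + r′) ≡ u → suc (3 * (suc u) + (1 + ((suc u) + ((u + (suc u)) + (1 + r))))) ≡
          3 * r + 3 + (4 * (suc u) + 2 * r′ + 3)
      arith r r′ _ refl = NatSolver.solve (r ∷ r′ ∷ [])
    case6 : ∀ r′ → r′ < t → Cov (suc (3 * t + (1 + (t + ((u + t) + (1 + (u + r′)))))))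
    case6 r′ l = let r , e = complementʳ l in hit₂ r r′ e (hit-b (arith r r′ u e))
      where
      arith : ∀ r r′ u → suc (r + r′) ≡ (suc u) → suc (3 * (suc u) + (1 + ((suc u) + ((u + (suc u)) + (1 + (u + r′)))))) ≡
          7 * (suc u) + r′ + 1
      arith r r′ _ refl = NatSolver.solve (r ∷ r′ ∷ [])
    case7 : ∀ z → z < t → Cov (suc (3 * t + (1 + (t + ((u + t) + (1 + (u + (t + z))))))))
    -- The sums in `f₂` are 8t + 2r + 2 and pass h = 9t on the way. Those beyond h enter through m -
    -- (a + b), which is odd, and so fill the gaps between the even sums below h.
    case7 z l with mod2 t z (≤-trans l (m≤m+n t t))
    ... | 2r r′ l′ = let r , e = complementʳ l′ in hit₂ r r′ e (hit-−c (arith r r′ u e))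
      where
      arith : ∀ r r′ u → suc (r + r′) ≡
          (suc u) → suc (3 * (suc u) + (1 + ((suc u) + ((u + (suc u)) + (1 + (u + ((suc u) + (r′ + r′)))))))) +
          (3 * r + 2 + (7 * (suc u) + r′ + 1)) ≡
          suc (3 * (suc u) + (1 + ((suc u) + ((u + (suc u)) + (1 + (u + ((suc u) + (suc u))))))) +
          (3 * (suc u) + (1 + ((suc u) + ((u + (suc u)) + (1 + (u + ((suc u) + (suc u)))))))))
      arith r r′ _ refl = NatSolver.solve (r ∷ r′ ∷ [])
    ... | 2r+1 r l′ = let r′ , e = complement l′ in hit₂ r r′ e (hit-c (arith r r′ u e))
      where
      arith : ∀ r r′ u → suc (r + r′) ≡
          (suc u) → suc (3 * (suc u) + (1 + ((suc u) + ((u + (suc u)) + (1 + (u + ((suc u) + (suc (r + r))))))))) ≡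
          3 * r + 2 + (7 * (suc u) + r′ + 1)
      arith r r′ _ refl = NatSolver.solve (r ∷ r′ ∷ [])

    half : ∀ y → y < h → Cov (suc y)
    half y l with chop (3 * t) l
    ... | inj₁ l₀ = low (mod3 t y l₀)
    ... | inj₂ (y1 , refl , l1) with chop 1 l1
    ... | inj₁ (s≤s z≤n) = case1
    ... | inj₂ (y2 , refl , l2) with chop t l2
    ... | inj₁ m2 = case2 y2 m2
    ... | inj₂ (y3 , refl , l3) with chop (u + t) l3
    ... | inj₁ m3 = case3 y3 m3
    ... | inj₂ (y4 , refl , l4) with chop 1 l4
    ... | inj₁ (s≤s z≤n) = case4
    ... | inj₂ (y5 , refl , l5) with chop u l5
    ... | inj₁ m5 = case5 y5 m5
    ... | inj₂ (y6 , refl , l6) with chop t l6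
    ... | inj₁ m6 = case6 y6 m6
    ... | inj₂ (y7 , refl , l7) = case7 y7 l7

    peltesohn : PerfectDesign (1 + 6 * (t + (t + (u + 1))))
    peltesohn = design half (arith u)
      where
      arith : ∀ u → 3 * ((suc u) + ((suc u) + (u + 1))) ≡ 3 * (suc u) + (1 + ((suc u) + ((u + (suc u)) + (1 + (u + ((suc u) + (suc u)))))))
      arith = NatSolver.solve-∀

  -- Peltesohn's difference triples for m = 18t + 7.
  module Peltesohn₂ (t : ℕ) where
    f₁ f₂ f₃ : ℕ × ℕ → ℕ × ℕ
    f₁ (r , r′) = 3 * r + 1 , 7 * t + r′ + 4
    f₂ (r , r′) = 3 * r + 2 , 4 * t + 2 * r′ + 3
    f₃ (r , r′) = 3 * r + 3 , 3 * t + r′ + 2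
    h = 3 * t + (1 + (t + (1 + ((t + t) + (t + (1 + (t + t)))))))
    open ThreeFamilies t t t h f₁ f₂ f₃ (3 * t + 1 , 4 * t + 2)

    low : ∀ {y} → Mod3 t t t y → Cov (suc y)
    low (3r r l) = let r′ , e = complement l in hit₁ r r′ e (hit-a (+-comm 1 (3 * r)))
    low (3r+1 r l) = let r′ , e = complement l in hit₂ r r′ e (hit-a (+-comm 2 (3 * r)))
    low (3r+2 r l) = let r′ , e = complement l in hit₃ r r′ e (hit-a (+-comm 3 (3 * r)))
    case1 : Cov (suc (3 * t + 0))
    case1 = hit₄ (hit-a (arith t))
      where
      arith : ∀ t → suc (3 * t + 0) ≡ 3 * t + 1
      arith = NatSolver.solve-∀
    case2 : ∀ r′ → r′ < t → Cov (suc (3 * t + (1 + r′)))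
    case2 r′ l = let r , e = complementʳ l in hit₃ r r′ e (hit-b (arith r r′ t e))
      where
      arith : ∀ r r′ t → suc (r + r′) ≡ t → suc (3 * t + (1 + r′)) ≡ 3 * t + r′ + 2
      arith r r′ _ refl = NatSolver.solve (r ∷ r′ ∷ [])
    case3 : Cov (suc (3 * t + (1 + (t + 0))))
    case3 = hit₄ (hit-b (arith t))
      where
      arith : ∀ t → suc (3 * t + (1 + (t + 0))) ≡ 4 * t + 2
      arith = NatSolver.solve-∀
    case4 : ∀ z → z < t + t → Cov (suc (3 * t + (1 + (t + (1 + z)))))
    case4 z l with mod2 t z l
    ... | 2r r′ l′ = let r , e = complementʳ l′ in hit₂ r r′ e (hit-b (arith r r′ t e))
      where
      arith : ∀ r r′ t → suc (r + r′) ≡ t → suc (3 * t + (1 + (t + (1 + (r′ + r′))))) ≡ 4 * t + 2 * r′ + 3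
      arith r r′ _ refl = NatSolver.solve (r ∷ r′ ∷ [])
    ... | 2r+1 r l′ = let r′ , e = complement l′ in hit₃ r r′ e (hit-c (arith r r′ t e))
      where
      arith : ∀ r r′ t → suc (r + r′) ≡ t → suc (3 * t + (1 + (t + (1 + (suc (r + r)))))) ≡ 3 * r + 3 + (3 * t + r′ + 2)
      arith r r′ _ refl = NatSolver.solve (r ∷ r′ ∷ [])
    case5 : ∀ r → r < t → Cov (suc (3 * t + (1 + (t + (1 + ((t + t) + r))))))
    case5 r l = let r′ , e = complement l in hit₂ r r′ e (hit-c (arith r r′ t e))
      where
      arith : ∀ r r′ t → suc (r + r′) ≡ t → suc (3 * t + (1 + (t + (1 + ((t + t) + r))))) ≡ 3 * r + 2 + (4 * t + 2 * r′ + 3)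
      arith r r′ _ refl = NatSolver.solve (r ∷ r′ ∷ [])
    case6 : Cov (suc (3 * t + (1 + (t + (1 + ((t + t) + (t + 0)))))))
    case6 = hit₄ (hit-c (arith t))
      where
      arith : ∀ t → suc (3 * t + (1 + (t + (1 + ((t + t) + (t + 0)))))) ≡ 3 * t + 1 + (4 * t + 2)
      arith = NatSolver.solve-∀
    case7 : ∀ r′ → r′ < t → Cov (suc (3 * t + (1 + (t + (1 + ((t + t) + (t + (1 + r′))))))))
    case7 r′ l = let r , e = complementʳ l in hit₁ r r′ e (hit-b (arith r r′ t e))
      where
      arith : ∀ r r′ t → suc (r + r′) ≡ t → suc (3 * t + (1 + (t + (1 + ((t + t) + (t + (1 + r′))))))) ≡ 7 * t + r′ + 4
      arith r r′ _ refl = NatSolver.solve (r ∷ r′ ∷ [])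
    case8 : ∀ z → z < t → Cov (suc (3 * t + (1 + (t + (1 + ((t + t) + (t + (1 + (t + z)))))))))
    case8 z l with mod2 t z (≤-trans l (m≤m+n t t))
    ... | 2r r l′ = let r′ , e = complement l′ in hit₁ r r′ e (hit-c (arith r r′ t e))
      where
      arith : ∀ r r′ t → suc (r + r′) ≡ t → suc (3 * t + (1 + (t + (1 + ((t + t) + (t + (1 + (t + (r + r))))))))) ≡
          3 * r + 1 + (7 * t + r′ + 4)
      arith r r′ _ refl = NatSolver.solve (r ∷ r′ ∷ [])
    ... | 2r+1 r′ l′ = let r , e = complementʳ l′ in hit₁ r r′ e (hit-−c (arith r r′ t e))
      where
      arith : ∀ r r′ t → suc (r + r′) ≡ t → suc (3 * t + (1 + (t + (1 + ((t + t) + (t + (1 + (t + (suc (r′ + r′)))))))))) +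
          (3 * r + 1 + (7 * t + r′ + 4)) ≡
          suc (3 * t + (1 + (t + (1 + ((t + t) + (t + (1 + (t + t))))))) +
          (3 * t + (1 + (t + (1 + ((t + t) + (t + (1 + (t + t)))))))))
      arith r r′ _ refl = NatSolver.solve (r ∷ r′ ∷ [])

    half : ∀ y → y < h → Cov (suc y)
    half y l with chop (3 * t) l
    ... | inj₁ l₀ = low (mod3 t y l₀)
    ... | inj₂ (y1 , refl , l1) with chop 1 l1
    ... | inj₁ (s≤s z≤n) = case1
    ... | inj₂ (y2 , refl , l2) with chop t l2
    ... | inj₁ m2 = case2 y2 m2
    ... | inj₂ (y3 , refl , l3) with chop 1 l3
    ... | inj₁ (s≤s z≤n) = case3
    ... | inj₂ (y4 , refl , l4) with chop (t + t) l4
    ... | inj₁ m4 = case4 y4 m4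
    ... | inj₂ (y5 , refl , l5) with chop t l5
    ... | inj₁ m5 = case5 y5 m5
    ... | inj₂ (y6 , refl , l6) with chop 1 l6
    ... | inj₁ (s≤s z≤n) = case6
    ... | inj₂ (y7 , refl , l7) with chop t l7
    ... | inj₁ m7 = case7 y7 m7
    ... | inj₂ (y8 , refl , l8) = case8 y8 l8

    peltesohn : PerfectDesign (1 + 6 * (t + (t + (t + 1))))
    peltesohn = design half (arith t)
      where
      arith : ∀ t → 3 * (t + (t + (t + 1))) ≡ 3 * t + (1 + (t + (1 + ((t + t) + (t + (1 + (t + t)))))))
      arith = NatSolver.solve-∀

  -- Peltesohn's difference triples for m = 18t + 13.
  module Peltesohn₃ (t : ℕ) where
    f₁ f₂ f₃ : ℕ × ℕ → ℕ × ℕ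
    f₁ (r , r′) = 3 * r + 1 , 3 * t + r′ + 3
    f₂ (r , r′) = 3 * r + 2 , 4 * t + 2 * r′ + 5
    f₃ (r , r′) = 3 * r + 3 , 7 * t + r′ + 6
    h = 3 * t + (1 + (1 + ((suc t) + ((t + suc t) + (t + (1 + (t + (1 + t))))))))
    open ThreeFamilies (suc t) t t h f₁ f₂ f₃ (3 * t + 2 , 7 * t + 5)

    low : ∀ {y} → Mod3 t t t y → Cov (suc y)
    low (3r r l) = let r′ , e = complement (m≤n⇒m≤1+n l) in hit₁ r r′ e (hit-a (+-comm 1 (3 * r)))
    low (3r+1 r l) = let r′ , e = complement l in hit₂ r r′ e (hit-a (+-comm 2 (3 * r)))
    low (3r+2 r l) = let r′ , e = complement l in hit₃ r r′ e (hit-a (+-comm 3 (3 * r)))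
    case1 : Cov (suc (3 * t + 0))
    case1 = hit₁ t 0 (cong suc (+-identityʳ t)) (hit-a (arith t))
      where
      arith : ∀ t → suc (3 * t + 0) ≡ 3 * t + 1
      arith = NatSolver.solve-∀
    case2 : Cov (suc (3 * t + (1 + 0)))
    case2 = hit₄ (hit-a (arith t))
      where
      arith : ∀ t → suc (3 * t + (1 + 0)) ≡ 3 * t + 2
      arith = NatSolver.solve-∀
    case3 : ∀ r′ → r′ < (suc t) → Cov (suc (3 * t + (1 + (1 + r′))))
    case3 r′ l = let r , e = complementʳ l in hit₁ r r′ e (hit-b (arith r r′ t e))
      where
      arith : ∀ r r′ t → suc (r + r′) ≡ (suc t) → suc (3 * t + (1 + (1 + r′))) ≡ 3 * t + r′ + 3
      arith r r′ _ refl = NatSolver.solve (r ∷ r′ ∷ [])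
    case4 : ∀ z → z < t + suc t → Cov (suc (3 * t + (1 + (1 + ((suc t) + z)))))
    case4 z l with mod2′ t z l
    ... | 2r r l′ = let r′ , e = complement l′ in hit₁ r r′ e (hit-c (arith r r′ t e))
      where
      arith : ∀ r r′ t → suc (r + r′) ≡ (suc t) → suc (3 * t + (1 + (1 + ((suc t) + (r + r))))) ≡ 3 * r + 1 + (3 * t + r′ + 3)
      arith r r′ _ refl = NatSolver.solve (r ∷ r′ ∷ [])
    ... | 2r+1 r′ l′ = let r , e = complementʳ l′ in hit₂ r r′ e (hit-b (arith r r′ t e))
      where
      arith : ∀ r r′ t → suc (r + r′) ≡ t → suc (3 * t + (1 + (1 + ((suc t) + (suc (r′ + r′)))))) ≡ 4 * t + 2 * r′ + 5
      arith r r′ _ refl = NatSolver.solve (r ∷ r′ ∷ [])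
    case5 : ∀ r → r < t → Cov (suc (3 * t + (1 + (1 + ((suc t) + ((t + suc t) + r))))))
    case5 r l = let r′ , e = complement l in hit₂ r r′ e (hit-c (arith r r′ t e))
      where
      arith : ∀ r r′ t → suc (r + r′) ≡ t → suc (3 * t + (1 + (1 + ((suc t) + ((t + suc t) + r))))) ≡ 3 * r + 2 + (4 * t + 2 * r′ + 5)
      arith r r′ _ refl = NatSolver.solve (r ∷ r′ ∷ [])
    case6 : Cov (suc (3 * t + (1 + (1 + ((suc t) + ((t + suc t) + (t + 0)))))))
    case6 = hit₄ (hit-b (arith t))
      where
      arith : ∀ t → suc (3 * t + (1 + (1 + ((suc t) + ((t + suc t) + (t + 0)))))) ≡ 7 * t + 5
      arith = NatSolver.solve-∀
    case7 : ∀ r′ → r′ < t → Cov (suc (3 * t + (1 + (1 + ((suc t) + ((t + suc t) + (t + (1 + r′))))))))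
    case7 r′ l = let r , e = complementʳ l in hit₃ r r′ e (hit-b (arith r r′ t e))
      where
      arith : ∀ r r′ t → suc (r + r′) ≡ t → suc (3 * t + (1 + (1 + ((suc t) + ((t + suc t) + (t + (1 + r′))))))) ≡ 7 * t + r′ + 6
      arith r r′ _ refl = NatSolver.solve (r ∷ r′ ∷ [])
    case8 : Cov (suc (3 * t + (1 + (1 + ((suc t) + ((t + suc t) + (t + (1 + (t + 0)))))))))
    -- The sporadic sum 10t + 7 exceeds h = 9t + 6 and is met as m - (10t + 7) = 8t + 6.
    case8 = hit₄ (hit-−c (arith t))
      where
      arith : ∀ t → suc (3 * t + (1 + (1 + ((suc t) + ((t + suc t) + (t + (1 + (t + 0)))))))) + (3 * t + 2 + (7 * t + 5)) ≡
          suc (3 * t + (1 + (1 + ((suc t) + ((t + suc t) + (t + (1 + (t + (1 + t)))))))) +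
          (3 * t + (1 + (1 + ((suc t) + ((t + suc t) + (t + (1 + (t + (1 + t))))))))))
      arith = NatSolver.solve-∀
    case9 : ∀ z → z < t → Cov (suc (3 * t + (1 + (1 + ((suc t) + ((t + suc t) + (t + (1 + (t + (1 + z))))))))))
    case9 z l with mod2 t z (≤-trans l (m≤m+n t t))
    ... | 2r r′ l′ = let r , e = complementʳ l′ in hit₃ r r′ e (hit-−c (arith r r′ t e))
      where
      arith : ∀ r r′ t → suc (r + r′) ≡ t →
          suc (3 * t + (1 + (1 + ((suc t) + ((t + suc t) + (t + (1 + (t + (1 + (r′ + r′)))))))))) +
          (3 * r + 3 + (7 * t + r′ + 6)) ≡
          suc (3 * t + (1 + (1 + ((suc t) + ((t + suc t) + (t + (1 + (t + (1 + t)))))))) +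
          (3 * t + (1 + (1 + ((suc t) + ((t + suc t) + (t + (1 + (t + (1 + t))))))))))
      arith r r′ _ refl = NatSolver.solve (r ∷ r′ ∷ [])
    ... | 2r+1 r l′ = let r′ , e = complement l′ in hit₃ r r′ e (hit-c (arith r r′ t e))
      where
      arith : ∀ r r′ t → suc (r + r′) ≡ t →
          suc (3 * t + (1 + (1 + ((suc t) + ((t + suc t) + (t + (1 + (t + (1 + (suc (r + r))))))))))) ≡
          3 * r + 3 + (7 * t + r′ + 6)
      arith r r′ _ refl = NatSolver.solve (r ∷ r′ ∷ [])

    half : ∀ y → y < h → Cov (suc y)
    half y l with chop (3 * t) l
    ... | inj₁ l₀ = low (mod3 t y l₀)
    ... | inj₂ (y1 , refl , l1) with chop 1 l1
    ... | inj₁ (s≤s z≤n) = case1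
    ... | inj₂ (y2 , refl , l2) with chop 1 l2
    ... | inj₁ (s≤s z≤n) = case2
    ... | inj₂ (y3 , refl , l3) with chop (suc t) l3
    ... | inj₁ m3 = case3 y3 m3
    ... | inj₂ (y4 , refl , l4) with chop (t + suc t) l4
    ... | inj₁ m4 = case4 y4 m4
    ... | inj₂ (y5 , refl , l5) with chop t l5
    ... | inj₁ m5 = case5 y5 m5
    ... | inj₂ (y6 , refl , l6) with chop 1 l6
    ... | inj₁ (s≤s z≤n) = case6
    ... | inj₂ (y7 , refl , l7) with chop t l7
    ... | inj₁ m7 = case7 y7 m7
    ... | inj₂ (y8 , refl , l8) with chop 1 l8
    ... | inj₁ (s≤s z≤n) = case8
    ... | inj₂ (y9 , refl , l9) = case9 y9 l9

    peltesohn : PerfectDesign (1 + 6 * ((suc t) + (t + (t + 1))))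
    peltesohn = design half (arith t)
      where
      arith : ∀ t → 3 * ((suc t) + (t + (t + 1))) ≡ 3 * t + (1 + (1 + ((suc t) + ((t + suc t) + (t + (1 + (t + (1 + t))))))))
      arith = NatSolver.solve-∀

  -- Peltesohn's construction depends on τ modulo 3. The order m = 1 is set apart because the system
  -- for 18t + 1 has t - 1 triples in its third family and so starts at t = 1.
  cyclicDesign₁ : ∀ τ → PerfectDesign (1 + 6 * τ)
  cyclicDesign₁ τ with mod3 (suc τ) τ (≤-trans (n<1+n τ) (m≤n*m (suc τ) 3))
  ... | 3r zero _ =
      record { perfect = refl ; design =
      record { triples = [] ; pairs = [] ; few = z≤n ; size = refl ; covers = λ { (suc _) _ (s≤s ()) } } }
  ... | 3r (suc u) _ = subst (λ τ → PerfectDesign (1 + 6 * τ)) (arith u) (Peltesohn₁.peltesohn u)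
    where
    arith : ∀ u → suc u + (suc u + (u + 1)) ≡ 3 * suc u
    arith = NatSolver.solve-∀
  ... | 3r+1 t _ = subst (λ τ → PerfectDesign (1 + 6 * τ)) (arith t) (Peltesohn₂.peltesohn t)
    where
    arith : ∀ t → t + (t + (t + 1)) ≡ 1 + 3 * t
    arith = NatSolver.solve-∀
  ... | 3r+2 t _ = subst (λ τ → PerfectDesign (1 + 6 * τ)) (arith t) (Peltesohn₃.peltesohn t)
    where
    arith : ∀ t → suc t + (t + (t + 1)) ≡ 2 + 3 * t
    arith = NatSolver.solve-∀

  -- The differences 1, …, v+u are realised by pairs nested around two centres: the odd ones around the middle of an
  -- interval of length 2v, the even ones around an element (left over) of an interval of length 2u + 1.
  module Nested (v u : ℕ) (parity : ∀ y → y < v + u → Mod2 v u y) where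
    t = v + u
    f₁ f₂ : ℕ × ℕ → ℕ × ℕ
    f₁ (r , r′) = 2 * r + 1 , t + r′ + 1
    f₂ (r , r′) = 2 * r + 2 , t + 2 * v + r′ + 1
    centre = t + 2 * v + u + 1
    ts = family v f₁ ++ family u f₂
    -- Of the h = 3t + 2 classes ±x, the t triples use 3t; the centre of the interval of odd length
    -- and the last value h itself remain.
    ps = centre ∷ 3 * t + 2 ∷ []
    h = t + (v + (v + (u + (1 + (u + 1)))))

    Cov : ℕ → Set
    Cov = Covered (suc (h + h)) ts ps

    H : ℕ × ℕ → ℕ → Set
    H (a , b) = Hits (suc (h + h)) a b

    hit₁ : ∀ {x} r r′ → suc (r + r′) ≡ v → H (f₁ (r , r′)) x → Cov x
    hit₁ r r′ e k = inj₁ (_ , _ , ∈-++⁺ˡ (∈-family f₁ r r′ e) , k)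

    hit₂ : ∀ {x} r r′ → suc (r + r′) ≡ u → H (f₂ (r , r′)) x → Cov x
    hit₂ r r′ e k = inj₁ (_ , _ , ∈-++⁺ʳ (family v f₁) (∈-family f₂ r r′ e) , k)

    case0 : ∀ {y} → Mod2 v u y → Cov (suc y)
    case0 (2r r l) = let r′ , e = complement l in hit₁ r r′ e (hit-a (arith r))
      where
      arith : ∀ r → suc (r + r) ≡ 2 * r + 1
      arith = NatSolver.solve-∀
    case0 (2r+1 r l) = let r′ , e = complement l in hit₂ r r′ e (hit-a (arith r))
      where
      arith : ∀ r → suc (suc (r + r)) ≡ 2 * r + 2
      arith = NatSolver.solve-∀
    case1 : ∀ r′ → r′ < v → Cov (suc (t + r′))
    case1 r′ l = let r , e = complementʳ l in hit₁ r r′ e (hit-b (+-comm 1 (t + r′)))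
    case2 : ∀ r → r < v → Cov (suc (t + (v + r)))
    case2 r l = let r′ , e = complement l in hit₁ r r′ e (hit-c (arith r r′ v u e))
      where
      arith : ∀ r r′ v u → suc (r + r′) ≡ v → suc (v + u + (v + r)) ≡ 2 * r + 1 + (v + u + r′ + 1)
      arith r r′ _ u refl = NatSolver.solve (r ∷ r′ ∷ u ∷ [])
    case3 : ∀ r′ → r′ < u → Cov (suc (t + (v + (v + r′))))
    case3 r′ l = let r , e = complementʳ l in hit₂ r r′ e (hit-b (arith r′ v u))
      where
      arith : ∀ r′ v u → suc (v + u + (v + (v + r′))) ≡ v + u + 2 * v + r′ + 1
      arith = NatSolver.solve-∀
    case4 : Cov (suc (t + (v + (v + (u + 0)))))
    case4 = inj₂ (centre , here refl , inj₁ (arith v u))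
      where
      arith : ∀ v u → suc (v + u + (v + (v + (u + 0)))) ≡ v + u + 2 * v + u + 1
      arith = NatSolver.solve-∀
    case5 : ∀ r → r < u → Cov (suc (t + (v + (v + (u + (1 + r))))))
    case5 r l = let r′ , e = complement l in hit₂ r r′ e (hit-c (arith r r′ v u e))
      where
      arith : ∀ r r′ v u → suc (r + r′) ≡ u → suc (v + u + (v + (v + (u + (1 + r))))) ≡ 2 * r + 2 + (v + u + 2 * v + r′ + 1)
      arith r r′ v _ refl = NatSolver.solve (r ∷ r′ ∷ v ∷ [])
    case6 : Cov (suc (t + (v + (v + (u + (1 + (u + 0)))))))
    case6 = inj₂ (_ , there (here refl) , inj₁ (arith v u))
      where
      arith : ∀ v u → suc (v + u + (v + (v + (u + (1 + (u + 0)))))) ≡ 3 * (v + u) + 2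
      arith = NatSolver.solve-∀

    half : ∀ y → y < h → Cov (suc y)
    half y l with chop t l
    ... | inj₁ l₀ = case0 (parity y l₀)
    ... | inj₂ (y1 , refl , l1) with chop v l1
    ... | inj₁ m1 = case1 y1 m1
    ... | inj₂ (y2 , refl , l2) with chop v l2
    ... | inj₁ m2 = case2 y2 m2
    ... | inj₂ (y3 , refl , l3) with chop u l3
    ... | inj₁ m3 = case3 y3 m3
    ... | inj₂ (y4 , refl , l4) with chop 1 l4
    ... | inj₁ (s≤s z≤n) = case4
    ... | inj₂ (y5 , refl , l5) with chop u l5
    ... | inj₁ m5 = case5 y5 m5
    ... | inj₂ (.0 , refl , s≤s z≤n) = case6

    nested : Design (5 + 6 * (v + u))
    nested = subst Design (arith v u) (record
      { triples = ts
      ; pairs = ps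
      ; few = ≤-refl
      ; size = trans
          (cong (λ l → 1 + 6 * l + 4)
          (trans (length-++ (family v f₁)) (cong₂ _+_ (length-family v f₁) (length-family u f₂)))) (arith′ v u)
      ; covers = covers-half⇒covers h half
      })
      where
      arith : ∀ v u → suc (v + u + (v + (v + (u + (1 + (u + 1))))) + (v + u + (v + (v + (u + (1 + (u + 1))))))) ≡ 5 + 6 * (v + u)
      arith = NatSolver.solve-∀
      arith′ : ∀ v u → 1 + 6 * (v + u) + 4 ≡ suc (v + u + (v + (v + (u + (1 + (u + 1))))) + (v + u + (v + (v + (u + (1 + (u + 1)))))))
      arith′ = NatSolver.solve-∀

  -- Among the differences 1, ..., τ there are equally many odd and even ones, or one odd one more:
  -- v = u or v = u + 1.
  cyclicDesign₅ : ∀ τ → Design (5 + 6 * τ)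
  cyclicDesign₅ τ with mod2 (suc τ) τ (s≤s (m≤m+n τ (suc τ)))
  ... | 2r u _ = Nested.nested u u (mod2 u)
  ... | 2r+1 u _ = Nested.nested (suc u) u (λ y l → mod2′ u y (subst (y <_) (+-comm (suc u) u) l))

-- Counting lists over a finite set

module FiniteLists where
  open import Data.Nat as ℕ using (ℕ; zero; suc)
  import Data.Nat.Properties as ℕₚ
  open import Data.Fin using (Fin; zero; suc)
  open import Data.Fin.Properties using (injective⇒≤)
  open import Data.List using (List; []; _∷_; _++_; length; lookup)
  open import Data.List.Properties using (length-++)
  open import Data.List.Relation.Unary.All as All using (All)
  open import Data.List.Relation.Unary.Any using (here; there; index)
  open import Data.List.Relation.Unary.Any.Properties using (lookup-index)
  open import Data.List.Relation.Unary.AllPairs using ([]; _∷_)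
  open import Data.List.Relation.Unary.Unique.Propositional using (Unique)
  open import Data.List.Membership.Propositional using (_∈_)
  open import Data.List.Membership.Propositional.Properties using (∈-lookup; ∈-++⁺ˡ; ∈-++⁺ʳ)
  open import Data.Sum using (_⊎_; inj₁; inj₂)
  open import Data.Empty using (⊥-elim)
  open import Relation.Binary.PropositionalEquality

  lookup-injective : ∀ {A : Set} {xs : List A} → Unique xs → ∀ {i j} → lookup xs i ≡ lookup xs j → i ≡ j
  lookup-injective (_ ∷ _) {zero} {zero} _ = refl
  lookup-injective {xs = _ ∷ xs} (px ∷ _) {zero} {suc j} e = ⊥-elim (All.lookup px (∈-lookup j) e)
  lookup-injective {xs = _ ∷ xs} (px ∷ _) {suc i} {zero} e = ⊥-elim (All.lookup px (∈-lookup i) (sym e))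
  lookup-injective (_ ∷ u) {suc i} {suc j} e = cong suc (lookup-injective u e)

  unique⇒length≤ : ∀ {n} {xs : List (Fin n)} → Unique xs → length xs ℕ.≤ n
  unique⇒length≤ u = injective⇒≤ (lookup-injective u)

  covers⇒≤length : ∀ {n} (xs : List (Fin n)) → (∀ i → i ∈ xs) → n ℕ.≤ length xs
  covers⇒≤length xs c = injective⇒≤ {f = λ i → index (c i)}
    (λ {i} {j} e → trans (lookup-index (c i)) (trans (cong (lookup xs) e) (sym (lookup-index (c j)))))

  -- If an entry recurred, dropping it would leave a covering of `Fin n` by fewer than n entries.
  -- This turns coverings of bounded size into distinct weights at the end.
  covers⇒unique : ∀ {n} (xs : List (Fin n)) → (∀ i → i ∈ xs) → length xs ℕ.≤ n → Unique xs
  covers⇒unique {n} xs c = go [] xs (λ i → inj₂ (c i))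
    where
    go : ∀ seen xs → (∀ i → i ∈ seen ⊎ i ∈ xs) → length seen ℕ.+ length xs ℕ.≤ n → Unique xs
    go seen []       c l = []
    go seen (x ∷ xs) c l =
        All.tabulate fresh ∷ go (x ∷ seen) xs shift
        (ℕₚ.≤-trans (ℕₚ.≤-reflexive (sym (ℕₚ.+-suc (length seen) (length xs)))) l)
      where
      shift : ∀ i → i ∈ x ∷ seen ⊎ i ∈ xs
      shift i with c i
      ... | inj₁ m = inj₁ (there m)
      ... | inj₂ (here e) = inj₁ (here e)
      ... | inj₂ (there m) = inj₂ m
      fresh : ∀ {y} → y ∈ xs → x ≢ y
      fresh x∈xs refl = ℕₚ.<⇒≱ (ℕₚ.≤-trans (ℕₚ.≤-reflexive (sym (ℕₚ.+-suc (length seen) (length xs)))) l)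
        (ℕₚ.≤-trans (covers⇒≤length (seen ++ xs) c′) (ℕₚ.≤-reflexive (length-++ seen)))
        where
        c′ : ∀ i → i ∈ seen ++ xs
        c′ i with c i
        ... | inj₁ m = ∈-++⁺ˡ m
        ... | inj₂ (here refl) = ∈-++⁺ʳ seen x∈xs
        ... | inj₂ (there m) = ∈-++⁺ʳ seen m

-- Orbits of the hexagonal rotation modulo p

module HexagonalLattice where
  open FiniteLists
  open import Data.Nat as ℕ using (ℕ; suc)
  import Data.Nat.Properties as ℕₚ
  open import Data.Integer as ℤ using (ℤ; +_)
  import Data.Integer.Properties as ℤₚ
  import Data.Integer.DivMod as ℤ
  open import Data.Integer.Divisibility.Signed as ℤ using (_∣_; divides; _∣?_)
  import Data.Integer.Tactic.RingSolver as IntSolver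
  open import Data.Fin as Fin using (Fin; suc; fromℕ<)
  import Data.Fin.Properties as Finₚ
  open import Data.List using (List; []; _∷_; _++_; map; length; cartesianProductWith; upTo)
  open import Data.List.Properties using (length-map)
  open import Data.List.Relation.Unary.All as All using (All; []; _∷_)
  open import Data.List.Relation.Unary.Any as Any using (Any; here; there; any?)
  open import Data.List.Relation.Unary.AllPairs as AllPairs using (AllPairs; []; _∷_)
  import Data.List.Relation.Unary.AllPairs.Properties as AllPairs
  open import Data.List.Membership.Propositional using (_∈_)
  open import Data.List.Membership.Propositional.Properties using (∈-cartesianProductWith⁺; ∈-applyUpTo⁺)
  open import Data.Product using (∃; _×_; _,_; proj₁; proj₂)
  open import Relation.Binary.PropositionalEquality
  open import Relation.Nullary using (¬_; Dec; yes; no)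
  open import Relation.Nullary.Decidable using (_×-dec_; map′)

  -- The rotation ρ of order six of the lattice ℤ[ω]; without 2- and 3-torsion its orbits on (ℤ/p)² ∖ {0} all have six
  -- elements ±v, ±ρv, ±ρ²v, where v + ρ²v = ρv.
  module Hexagonal (p : ℕ) .{{_ : ℕ.NonZero p}}
                   (2-cancel : ∀ a → + p ∣ (+ 2) ℤ.* a → + p ∣ a)
                   (3-cancel : ∀ a → + p ∣ (+ 3) ℤ.* a → + p ∣ a) where

    V : Set
    V = ℤ × ℤ

    infix 4 _≈_
    record _≈_ (v w : V) : Set where
      constructor _,_
      field
        fst : + p ∣ proj₁ v ℤ.- proj₁ w
        snd : + p ∣ proj₂ v ℤ.- proj₂ w

    _≈?_ : ∀ v w → Dec (v ≈ w)
    (i , j) ≈? (k , l) = map′ (λ (a , b) → a , b) (λ (a , b) → a , b) ((+ p ∣? (i ℤ.- k)) ×-dec (+ p ∣? (j ℤ.- l)))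

    ∣-linear : ∀ {a b c} x y → c ≡ x ℤ.* a ℤ.+ y ℤ.* b → + p ∣ a → + p ∣ b → + p ∣ c
    ∣-linear x y refl a b = ℤ.∣m∣n⇒∣m+n (ℤ.∣n⇒∣m*n x a) (ℤ.∣n⇒∣m*n y b)

    ≈-refl : ∀ {v} → v ≈ v
    ≈-refl {i , j} = divides (+ 0) (ℤₚ.+-inverseʳ i) , divides (+ 0) (ℤₚ.+-inverseʳ j)

    ≈-reflexive : ∀ {v w} → v ≡ w → v ≈ w
    ≈-reflexive refl = ≈-refl

    ≈-sym : ∀ {v w} → v ≈ w → w ≈ v
    ≈-sym {i , j} {k , l} (a , b) = ∣-linear (ℤ.- + 1) (+ 0) (arith i k (j ℤ.- l)) a b , ∣-linear (+ 0) (ℤ.- + 1) (arith′ j l (i ℤ.- k)) a b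
      where
      arith : ∀ i k z → k ℤ.- i ≡ (ℤ.- + 1) ℤ.* (i ℤ.- k) ℤ.+ + 0 ℤ.* z
      arith = IntSolver.solve-∀
      arith′ : ∀ i k z → k ℤ.- i ≡ + 0 ℤ.* z ℤ.+ (ℤ.- + 1) ℤ.* (i ℤ.- k)
      arith′ = IntSolver.solve-∀

    ≈-trans : ∀ {u v w} → u ≈ v → v ≈ w → u ≈ w
    ≈-trans {i , j} {k , l} {m , n} (a , b) (c , d) = ∣-linear (+ 1) (+ 1) (arith i k m) a c , ∣-linear (+ 1) (+ 1) (arith j l n) b d
      where
      arith : ∀ i k m → i ℤ.- m ≡ + 1 ℤ.* (i ℤ.- k) ℤ.+ + 1 ℤ.* (k ℤ.- m)
      arith = IntSolver.solve-∀

    -- Multiplication by the sixth root of unity 1 + ω in the basis 1, ω. Its characteristic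
    -- polynomial is x² - x + 1, whence ρ³ = -1 and 1 + ρ² = ρ.
    ρ : V → V
    ρ (i , j) = i ℤ.- j , i

    ρ-cong : ∀ {v w} → v ≈ w → ρ v ≈ ρ w
    ρ-cong {i , j} {k , l} (a , b) = ∣-linear (+ 1) (ℤ.- + 1) (arith i j k l) a b , a
      where
      arith : ∀ i j k l → (i ℤ.- j) ℤ.- (k ℤ.- l) ≡ + 1 ℤ.* (i ℤ.- k) ℤ.+ (ℤ.- + 1) ℤ.* (j ℤ.- l)
      arith = IntSolver.solve-∀

    ρ³ : ∀ i j → ρ (ρ (ρ (i , j))) ≡ (ℤ.- i , ℤ.- j)
    ρ³ i j = cong₂ _,_ (arith i j) (arith′ i j)
      where
      arith : ∀ i j → i ℤ.- j ℤ.- i ℤ.- (i ℤ.- j) ≡ ℤ.- i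
      arith = IntSolver.solve-∀
      arith′ : ∀ i j → i ℤ.- j ℤ.- i ≡ ℤ.- j
      arith′ = IntSolver.solve-∀

    ρ⁶ : ∀ v → ρ (ρ (ρ (ρ (ρ (ρ v))))) ≡ v
    ρ⁶ (i , j) = trans (cong (λ w → ρ (ρ (ρ w))) (ρ³ i j))
      (trans (ρ³ (ℤ.- i) (ℤ.- j)) (cong₂ _,_ (ℤₚ.neg-involutive i) (ℤₚ.neg-involutive j)))

    orbit : V → List V
    orbit v = v ∷ ρ v ∷ ρ (ρ v) ∷ ρ (ρ (ρ v)) ∷ ρ (ρ (ρ (ρ v))) ∷ ρ (ρ (ρ (ρ (ρ v)))) ∷ []

    0ᵥ : V
    0ᵥ = + 0 , + 0

    -- A vector fixed by ρᵏ is killed by the determinant of ρᵏ - 1, which is 1, 3, 4 for k = 1, 2,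
    -- 3; this is where cancelling 2 and 3 enters. The powers 4 and 5 reduce to 2 and 1 through ρ⁶ =
    -- 1.
    ρv≈v⇒0 : ∀ v → ρ v ≈ v → v ≈ 0ᵥ
    ρv≈v⇒0 (i , j) (a , b) = ∣-linear (ℤ.- + 1) (+ 1) (arith i j) a b , ∣-linear (ℤ.- + 1) (+ 0) (arith′ i j) a b
      where
      arith : ∀ i j → i ℤ.- + 0 ≡ (ℤ.- + 1) ℤ.* (i ℤ.- j ℤ.- i) ℤ.+ + 1 ℤ.* (i ℤ.- j)
      arith = IntSolver.solve-∀
      arith′ : ∀ i j → j ℤ.- + 0 ≡ (ℤ.- + 1) ℤ.* (i ℤ.- j ℤ.- i) ℤ.+ + 0 ℤ.* (i ℤ.- j)
      arith′ = IntSolver.solve-∀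

    ρ²v≈v⇒0 : ∀ v → ρ (ρ v) ≈ v → v ≈ 0ᵥ
    ρ²v≈v⇒0 (i , j) (a , b) =
      3-cancel _ (∣-linear (ℤ.- + 2) (+ 1) (arith i j) a b) , 3-cancel _ (∣-linear (ℤ.- + 1) (ℤ.- + 1) (arith′ i j) a b)
      where
      arith : ∀ i j → + 3 ℤ.* (i ℤ.- + 0) ≡ (ℤ.- + 2) ℤ.* (i ℤ.- j ℤ.- i ℤ.- i) ℤ.+ + 1 ℤ.* (i ℤ.- j ℤ.- j)
      arith = IntSolver.solve-∀
      arith′ : ∀ i j → + 3 ℤ.* (j ℤ.- + 0) ≡ (ℤ.- + 1) ℤ.* (i ℤ.- j ℤ.- i ℤ.- i) ℤ.+ (ℤ.- + 1) ℤ.* (i ℤ.- j ℤ.- j)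
      arith′ = IntSolver.solve-∀

    ρ³v≈v⇒0 : ∀ v → ρ (ρ (ρ v)) ≈ v → v ≈ 0ᵥ
    ρ³v≈v⇒0 (i , j) e with ≈-trans (≈-reflexive (sym (ρ³ i j))) e
    ... | a , b = 2-cancel _ (∣-linear (ℤ.- + 1) (+ 0) (arith i (ℤ.- j ℤ.- j)) a b) ,
        2-cancel _ (∣-linear (+ 0) (ℤ.- + 1) (arith′ j (ℤ.- i ℤ.- i)) a b)
      where
      arith : ∀ i z → + 2 ℤ.* (i ℤ.- + 0) ≡ (ℤ.- + 1) ℤ.* (ℤ.- i ℤ.- i) ℤ.+ + 0 ℤ.* z
      arith = IntSolver.solve-∀
      arith′ : ∀ i z → + 2 ℤ.* (i ℤ.- + 0) ≡ + 0 ℤ.* z ℤ.+ (ℤ.- + 1) ℤ.* (ℤ.- i ℤ.- i)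
      arith′ = IntSolver.solve-∀

    ρ⁴v≈v⇒0 : ∀ v → ρ (ρ (ρ (ρ v))) ≈ v → v ≈ 0ᵥ
    ρ⁴v≈v⇒0 v e = ρ²v≈v⇒0 v (≈-trans (≈-sym (ρ-cong (ρ-cong e))) (≈-reflexive (ρ⁶ v)))

    ρ⁵v≈v⇒0 : ∀ v → ρ (ρ (ρ (ρ (ρ v)))) ≈ v → v ≈ 0ᵥ
    ρ⁵v≈v⇒0 v e = ρv≈v⇒0 v (≈-trans (≈-sym (ρ-cong e)) (≈-reflexive (ρ⁶ v)))

    ρv≈0⇒0 : ∀ {v} → ρ v ≈ 0ᵥ → v ≈ 0ᵥ
    ρv≈0⇒0 {v} e = ≈-trans (≈-sym (≈-reflexive (ρ⁶ v))) (ρ-cong (ρ-cong (ρ-cong (ρ-cong (ρ-cong e)))))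

    _≉_ : V → V → Set
    v ≉ w = ¬ v ≈ w

    orbit-distinct : ∀ v → v ≉ 0ᵥ → AllPairs _≉_ (orbit v)
    orbit-distinct v v≉0 =
      (s1 n ∷ s2 n ∷ s3 n ∷ s4 n ∷ s5 n ∷ []) ∷
      (s1 n₁ ∷ s2 n₁ ∷ s3 n₁ ∷ s4 n₁ ∷ []) ∷
      (s1 n₂ ∷ s2 n₂ ∷ s3 n₂ ∷ []) ∷
      (s1 n₃ ∷ s2 n₃ ∷ []) ∷
      (s1 n₄ ∷ []) ∷ [] ∷ []
      where
      n = v≉0
      next : ∀ {w} → w ≉ 0ᵥ → ρ w ≉ 0ᵥ
      next w≉0 e = w≉0 (ρv≈0⇒0 e)
      n₁ = next n
      n₂ = next n₁
      n₃ = next n₂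
      n₄ = next n₃
      s1 : ∀ {w} → w ≉ 0ᵥ → w ≉ ρ w
      s1 w≉0 e = w≉0 (ρv≈v⇒0 _ (≈-sym e))
      s2 : ∀ {w} → w ≉ 0ᵥ → w ≉ ρ (ρ w)
      s2 w≉0 e = w≉0 (ρ²v≈v⇒0 _ (≈-sym e))
      s3 : ∀ {w} → w ≉ 0ᵥ → w ≉ ρ (ρ (ρ w))
      s3 w≉0 e = w≉0 (ρ³v≈v⇒0 _ (≈-sym e))
      s4 : ∀ {w} → w ≉ 0ᵥ → w ≉ ρ (ρ (ρ (ρ w)))
      s4 w≉0 e = w≉0 (ρ⁴v≈v⇒0 _ (≈-sym e))
      s5 : ∀ {w} → w ≉ 0ᵥ → w ≉ ρ (ρ (ρ (ρ (ρ w))))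
      s5 w≉0 e = w≉0 (ρ⁵v≈v⇒0 _ (≈-sym e))

    -- The orbit of zero closes the list, so that its length 1 + 6|R| can be compared with p²
    -- directly.
    orbits : List V → List V
    orbits []      = 0ᵥ ∷ []
    orbits (v ∷ R) = orbit v ++ orbits R

    length-orbits : ∀ R → length (orbits R) ≡ 1 ℕ.+ 6 ℕ.* length R
    length-orbits []      = refl
    length-orbits (v ∷ R) = trans (cong (6 ℕ.+_) (length-orbits R)) (cong suc (sym (ℕₚ.*-suc 6 (length R))))

    _∈ₒ_ : V → List V → Set
    v ∈ₒ R = Any (v ≈_) (orbits R)

    0∈ : ∀ R → 0ᵥ ∈ₒ R
    0∈ []      = here ≈-refl
    0∈ (v ∷ R) = there (there (there (there (there (there (0∈ R))))))

    ρ-closed : ∀ {v} R → v ∈ₒ R → ρ v ∈ₒ R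
    ρ-closed [] (here e) = here (ρ-cong e)
    ρ-closed (w ∷ R) (here e) = there (here (ρ-cong e))
    ρ-closed (w ∷ R) (there (here e)) = there (there (here (ρ-cong e)))
    ρ-closed (w ∷ R) (there (there (here e))) = there (there (there (here (ρ-cong e))))
    ρ-closed (w ∷ R) (there (there (there (here e)))) = there (there (there (there (here (ρ-cong e)))))
    ρ-closed (w ∷ R) (there (there (there (there (here e))))) = there (there (there (there (there (here (ρ-cong e))))))
    ρ-closed (w ∷ R) (there (there (there (there (there (here e)))))) = here (≈-trans (ρ-cong e) (≈-reflexive (ρ⁶ w)))
    ρ-closed (w ∷ R) (there (there (there (there (there (there i)))))) = there (there (there (there (there (there (ρ-closed R i))))))

    ρ-closed⁻ : ∀ {v} R → ρ v ∈ₒ R → v ∈ₒ R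
    ρ-closed⁻ {v} R i = subst (_∈ₒ R) (ρ⁶ v) (ρ-closed R (ρ-closed R (ρ-closed R (ρ-closed R (ρ-closed R i)))))

    ¬Any⇒All : ∀ {v} R → ¬ v ∈ₒ R → All (v ≉_) (orbits R)
    ¬Any⇒All R n = All.tabulate λ i e → n (Any.map (λ { refl → e }) i)

    -- Greedy choice: what is covered so far is closed under ρ and its inverse ρ⁵, so the orbit of
    -- an uncovered vector is disjoint from it; and the vector is not zero, since zero is always
    -- covered.
    representatives : ∀ xs → ∃ λ R → AllPairs _≉_ (orbits R) × (∀ {x} → x ∈ xs → x ∈ₒ R)
    representatives [] = [] , [] ∷ [] , λ ()
    representatives (x ∷ xs) with representatives xs
    ... | R , distinct , covers with any? (x ≈?_) (orbits R)
    ...   | yes x∈R = R , distinct , λ { (here refl) → x∈R ; (there i) → covers i }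
    ...   | no x∉R = x ∷ R , AllPairs.++⁺ (orbit-distinct x x≉0) distinct disjoint ,
                     λ { (here refl) → here ≈-refl ; (there i) → there (there (there (there (there (there (covers i)))))) }
      where
      x≉0 : x ≉ 0ᵥ
      x≉0 e = x∉R (Any.map (≈-trans e) (0∈ R))
      next : ∀ {w} → ¬ w ∈ₒ R → ¬ ρ w ∈ₒ R
      next n i = n (ρ-closed⁻ R i)
      disjoint : All (λ w → All (w ≉_) (orbits R)) (orbit x)
      disjoint = ¬Any⇒All R x∉R ∷ ¬Any⇒All R n₁ ∷ ¬Any⇒All R n₂ ∷ ¬Any⇒All R n₃ ∷ ¬Any⇒All R n₄ ∷ ¬Any⇒All R (next n₄) ∷ []
        where
        n₁ = next x∉R
        n₂ = next n₁
        n₃ = next n₂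
        n₄ = next n₃

    residue : ℤ → Fin p
    residue i = fromℕ< (ℤ.n%ℕd<d i p)

    residue-≡⇒∣ : ∀ i j → residue i ≡ residue j → + p ∣ i ℤ.- j
    residue-≡⇒∣ i j e = divides (i ℤ./ℕ p ℤ.- j ℤ./ℕ p)
      (trans (cong₂ ℤ._-_ (ℤ.a≡a%ℕn+[a/ℕn]*n i p) (ℤ.a≡a%ℕn+[a/ℕn]*n j p))
        (trans (cong (λ r → + r ℤ.+ i ℤ./ℕ p ℤ.* + p ℤ.- (+ (j ℤ.%ℕ p) ℤ.+ j ℤ./ℕ p ℤ.* + p)) (Finₚ.fromℕ<-injective _ _ _ _ e))
          (arith (+ (j ℤ.%ℕ p)) (i ℤ./ℕ p) (j ℤ./ℕ p) (+ p))))
      where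
      arith : ∀ r a b p → r ℤ.+ a ℤ.* p ℤ.- (r ℤ.+ b ℤ.* p) ≡ (a ℤ.- b) ℤ.* p
      arith = IntSolver.solve-∀

    residues : V → Fin (p ℕ.* p)
    residues (i , j) = Fin.combine (residue i) (residue j)

    residues-≡⇒≈ : ∀ v w → residues v ≡ residues w → v ≈ w
    residues-≡⇒≈ (i , j) (k , l) e =
      let a , b = Finₚ.combine-injective _ _ _ _ e in residue-≡⇒∣ i k a , residue-≡⇒∣ j l b

    grid : List V
    grid = cartesianProductWith (λ a b → (+ a , + b)) (upTo p) (upTo p)

    ≈-grid : ∀ v → ∃ λ w → w ∈ grid × v ≈ w
    ≈-grid (i , j) = _ , ∈-cartesianProductWith⁺ (λ a b → (+ a , + b)) (∈-applyUpTo⁺ _ (ℤ.n%ℕd<d i p)) (∈-applyUpTo⁺ _ (ℤ.n%ℕd<d j p)) ,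
      (divides (i ℤ./ℕ p) (reduce i) , divides (j ℤ./ℕ p) (reduce j))
      where
      arith : ∀ r t → r ℤ.+ t ℤ.- r ≡ t
      arith = IntSolver.solve-∀
      reduce : ∀ i → i ℤ.- + (i ℤ.%ℕ p) ≡ i ℤ./ℕ p ℤ.* + p
      reduce i = trans (cong (ℤ._- + (i ℤ.%ℕ p)) (ℤ.a≡a%ℕn+[a/ℕn]*n i p)) (arith (+ (i ℤ.%ℕ p)) (i ℤ./ℕ p ℤ.* + p))

    -- The distinctness of the orbit members provides the count: `residues` sends them to distinct
    -- elements of `Fin (p * p)`.
    sixfold : ∃ λ R → 1 ℕ.+ 6 ℕ.* length R ℕ.≤ p ℕ.* p × (∀ v → v ∈ₒ R)
    sixfold with representatives grid
    ... | R , distinct , covers = R , bound , λ v → let w , i , e = ≈-grid v in Any.map (≈-trans e) (covers i)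
      where
      bound : 1 ℕ.+ 6 ℕ.* length R ℕ.≤ p ℕ.* p
      bound = subst (ℕ._≤ p ℕ.* p) (trans (length-map residues (orbits R)) (length-orbits R))
        (unique⇒length≤ {xs = map residues (orbits R)}
          (AllPairs.map⁺ (AllPairs.map (λ {v} {w} n e → n (residues-≡⇒≈ v w e)) distinct)))

-- Abelian groups as ℤ-modules, with linear identities by reflection

module IntegerModules where
  open import Data.Nat as ℕ using (ℕ; zero; suc)
  import Data.Nat.Properties as ℕₚ
  open import Data.Integer as ℤ using (ℤ; +_; -[1+_])
  import Data.Integer.Properties as ℤₚ
  open import Data.Fin using (Fin; zero; suc)
  open import Data.Vec as Vec using (Vec; []; _∷_; zipWith; replicate; lookup)
  open import Relation.Binary.PropositionalEquality
  open import Algebra.Structures using (IsAbelianGroup)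
  open import Algebra.Bundles using (AbelianGroup)
  open import Level using (0ℓ)
  import Algebra.Properties.AbelianGroup as AbelianGroupProperties
  import Algebra.Properties.CommutativeMonoid.Mult as CommutativeMonoidMult

  -- The laws hold up to `_≡_` because every group is transported to some `Fin s` before it is
  -- packed; rewriting by `subst` and `cong` is then available throughout.
  module IntegerModule {C : Set} {_⊕_ : C → C → C} {𝟘 : C} {⊖_ : C → C}
                       (isAbelianGroup : IsAbelianGroup _≡_ _⊕_ 𝟘 ⊖_) where

    open IsAbelianGroup isAbelianGroup using (assoc; identityˡ; identityʳ; inverseˡ; inverseʳ; comm)

    group : AbelianGroup 0ℓ 0ℓ
    group = record { isAbelianGroup = isAbelianGroup }

    open AbelianGroupProperties group
    open CommutativeMonoidMult (AbelianGroup.commutativeMonoid group)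
      using (×-homo-+) renaming (_×_ to _·_)

    infixr 25 _•_
    _•_ : ℤ → C → C
    (+ n)    • x = n · x
    -[1+ n ] • x = ⊖ (suc n · x)

    ⊕-interchange : ∀ a b c d → (a ⊕ b) ⊕ (c ⊕ d) ≡ (a ⊕ c) ⊕ (b ⊕ d)
    ⊕-interchange a b c d = begin
      (a ⊕ b) ⊕ (c ⊕ d) ≡⟨ assoc a b _ ⟩
      a ⊕ (b ⊕ (c ⊕ d)) ≡⟨ cong (a ⊕_) (trans (sym (assoc b c d)) (trans (cong (_⊕ d) (comm b c)) (assoc c b d))) ⟩
      a ⊕ (c ⊕ (b ⊕ d)) ≡⟨ assoc a c _ ⟨
      (a ⊕ c) ⊕ (b ⊕ d) ∎
      where open ≡-Reasoning

    ⊖-• : ∀ m n x → (m ℤ.⊖ n) • x ≡ (m · x) ⊕ (⊖ (n · x))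
    ⊖-• m zero x = trans (sym (identityʳ _)) (cong ((m · x) ⊕_) (sym ε⁻¹≈ε))
    ⊖-• zero (suc n) x = sym (identityˡ _)
    ⊖-• (suc m) (suc n) x = begin
      (suc m ℤ.⊖ suc n) • x                 ≡⟨ cong (_• x) (ℤₚ.[1+m]⊖[1+n]≡m⊖n m n) ⟩
      (m ℤ.⊖ n) • x                         ≡⟨ ⊖-• m n x ⟩
      (m · x) ⊕ (⊖ (n · x))                 ≡⟨ identityˡ _ ⟨
      𝟘 ⊕ ((m · x) ⊕ (⊖ (n · x)))           ≡⟨ cong (_⊕ ((m · x) ⊕ (⊖ (n · x)))) (sym (inverseʳ x)) ⟩
      (x ⊕ (⊖ x)) ⊕ ((m · x) ⊕ (⊖ (n · x))) ≡⟨ ⊕-interchange _ _ _ _ ⟩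
      (x ⊕ (m · x)) ⊕ ((⊖ x) ⊕ (⊖ (n · x))) ≡⟨ cong ((x ⊕ (m · x)) ⊕_) (⁻¹-∙-comm x (n · x)) ⟩
      (suc m · x) ⊕ (⊖ (suc n · x))         ∎
      where open ≡-Reasoning

    •-distrib-+ : ∀ i j x → (i ℤ.+ j) • x ≡ (i • x) ⊕ (j • x)
    •-distrib-+ (+ m) (+ n) x = ×-homo-+ x m n
    •-distrib-+ (+ m) -[1+ n ] x = ⊖-• m (suc n) x
    •-distrib-+ -[1+ m ] (+ n) x = trans (⊖-• n (suc m) x) (comm _ _)
    •-distrib-+ -[1+ m ] -[1+ n ] x = begin
      ⊖ (suc (suc (m ℕ.+ n)) · x)           ≡⟨ cong (λ k → ⊖ (suc k · x)) (sym (ℕₚ.+-suc m n)) ⟩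
      ⊖ ((suc m ℕ.+ suc n) · x)             ≡⟨ cong ⊖_ (×-homo-+ x (suc m) (suc n)) ⟩
      ⊖ ((suc m · x) ⊕ (suc n · x))         ≡⟨ ⁻¹-∙-comm _ _ ⟨
      (⊖ (suc m · x)) ⊕ (⊖ (suc n · x))     ∎
      where open ≡-Reasoning

    •-neg : ∀ i x → (ℤ.- i) • x ≡ ⊖ (i • x)
    •-neg (+ zero) x = sym ε⁻¹≈ε
    •-neg (+ suc n) x = refl
    •-neg -[1+ n ] x = sym (⁻¹-involutive _)

    •-identity : ∀ x → (+ 1) • x ≡ x
    •-identity = identityʳ

    ·-•-assoc : ∀ n j x → ((+ n) ℤ.* j) • x ≡ n · (j • x)
    ·-•-assoc zero j x = refl
    ·-•-assoc (suc n) j x = begin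
      ((+ suc n) ℤ.* j) • x               ≡⟨ cong (_• x) (ℤₚ.suc-* (+ n) j) ⟩
      (j ℤ.+ (+ n) ℤ.* j) • x             ≡⟨ •-distrib-+ j ((+ n) ℤ.* j) x ⟩
      (j • x) ⊕ (((+ n) ℤ.* j) • x)       ≡⟨ cong ((j • x) ⊕_) (·-•-assoc n j x) ⟩
      (j • x) ⊕ (n · (j • x))             ∎
      where open ≡-Reasoning

    •-assoc : ∀ i j x → (i ℤ.* j) • x ≡ i • (j • x)
    •-assoc (+ n) j x = ·-•-assoc n j x
    •-assoc -[1+ n ] j x = begin
      (-[1+ n ] ℤ.* j) • x                ≡⟨ cong (_• x) (sym (ℤₚ.neg-distribˡ-* (+ suc n) j)) ⟩
      (ℤ.- ((+ suc n) ℤ.* j)) • x         ≡⟨ •-neg ((+ suc n) ℤ.* j) x ⟩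
      ⊖ (((+ suc n) ℤ.* j) • x)           ≡⟨ cong ⊖_ (·-•-assoc (suc n) j x) ⟩
      ⊖ (suc n · (j • x))                 ∎
      where open ≡-Reasoning

    data Expr (n : ℕ) : Set where
      var  : Fin n → Expr n
      _:+_ : Expr n → Expr n → Expr n
      :-_  : Expr n → Expr n
      _:•_ : ℤ → Expr n → Expr n
      :0   : Expr n

    infixl 6 _:+_ _:-_
    infix  8 :-_
    infixr 7 _:•_

    _:-_ : ∀ {n} → Expr n → Expr n → Expr n
    a :- b = a :+ :- b

    ⟦_⟧ : ∀ {n} → Expr n → Vec C n → C
    ⟦ var i ⟧  ρ = lookup ρ i
    ⟦ a :+ b ⟧ ρ = ⟦ a ⟧ ρ ⊕ ⟦ b ⟧ ρ
    ⟦ :- a ⟧   ρ = ⊖ ⟦ a ⟧ ρ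
    ⟦ i :• a ⟧ ρ = i • ⟦ a ⟧ ρ
    ⟦ :0 ⟧     ρ = 𝟘

    unit : ∀ {n} → Fin n → Vec ℤ n
    unit zero    = + 1 ∷ replicate _ (+ 0)
    unit (suc i) = + 0 ∷ unit i

    coefficients : ∀ {n} → Expr n → Vec ℤ n
    coefficients (var i)  = unit i
    coefficients (a :+ b) = zipWith ℤ._+_ (coefficients a) (coefficients b)
    coefficients (:- a)   = Vec.map ℤ.-_ (coefficients a)
    coefficients (i :• a) = Vec.map (i ℤ.*_) (coefficients a)
    coefficients :0       = replicate _ (+ 0)

    combine : ∀ {n} → Vec ℤ n → Vec C n → C
    combine []       []      = 𝟘
    combine (c ∷ cs) (x ∷ ρ) = (c • x) ⊕ combine cs ρ

    combine-0 : ∀ {n} (ρ : Vec C n) → combine (replicate _ (+ 0)) ρ ≡ 𝟘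
    combine-0 []      = refl
    combine-0 (x ∷ ρ) = trans (identityˡ _) (combine-0 ρ)

    combine-unit : ∀ {n} (i : Fin n) ρ → combine (unit i) ρ ≡ lookup ρ i
    combine-unit zero    (x ∷ ρ) = trans (cong₂ _⊕_ (•-identity x) (combine-0 ρ)) (identityʳ x)
    combine-unit (suc i) (x ∷ ρ) = trans (identityˡ _) (combine-unit i ρ)

    combine-+ : ∀ {n} (c d : Vec ℤ n) ρ → combine (zipWith ℤ._+_ c d) ρ ≡ combine c ρ ⊕ combine d ρ
    combine-+ []       []       []      = sym (identityˡ 𝟘)
    combine-+ (c ∷ cs) (d ∷ ds) (x ∷ ρ) =
      trans (cong₂ _⊕_ (•-distrib-+ c d x) (combine-+ cs ds ρ)) (⊕-interchange _ _ _ _)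

    combine-neg : ∀ {n} (c : Vec ℤ n) ρ → combine (Vec.map ℤ.-_ c) ρ ≡ ⊖ combine c ρ
    combine-neg []       []      = sym ε⁻¹≈ε
    combine-neg (c ∷ cs) (x ∷ ρ) = trans (cong₂ _⊕_ (•-neg c x) (combine-neg cs ρ)) (⁻¹-∙-comm _ _)

    •-zeroʳ : ∀ i → i • 𝟘 ≡ 𝟘
    •-zeroʳ i = trans (sym (•-assoc i (+ 0) 𝟘)) (cong (_• 𝟘) (ℤₚ.*-zeroʳ i))

    ·-distrib-⊕ : ∀ n x y → n · (x ⊕ y) ≡ (n · x) ⊕ (n · y)
    ·-distrib-⊕ zero    x y = sym (identityˡ 𝟘)
    ·-distrib-⊕ (suc n) x y = trans (cong (_ ⊕_) (·-distrib-⊕ n x y)) (⊕-interchange _ _ _ _)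

    •-distrib-⊕ : ∀ i x y → i • (x ⊕ y) ≡ (i • x) ⊕ (i • y)
    •-distrib-⊕ (+ n)    x y = ·-distrib-⊕ n x y
    •-distrib-⊕ -[1+ n ] x y = trans (cong ⊖_ (·-distrib-⊕ (suc n) x y)) (sym (⁻¹-∙-comm _ _))

    combine-• : ∀ {n} i (c : Vec ℤ n) ρ → combine (Vec.map (i ℤ.*_) c) ρ ≡ i • combine c ρ
    combine-• i []       []      = sym (•-zeroʳ i)
    combine-• i (c ∷ cs) (x ∷ ρ) = trans (cong₂ _⊕_ (•-assoc i c x) (combine-• i cs ρ)) (sym (•-distrib-⊕ i _ _))

    sound : ∀ {n} (e : Expr n) ρ → combine (coefficients e) ρ ≡ ⟦ e ⟧ ρ
    sound (var i)  ρ = combine-unit i ρ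
    sound (a :+ b) ρ = trans (combine-+ (coefficients a) (coefficients b) ρ) (cong₂ _⊕_ (sound a ρ) (sound b ρ))
    sound (:- a)   ρ = trans (combine-neg (coefficients a) ρ) (cong ⊖_ (sound a ρ))
    sound (i :• a) ρ = trans (combine-• i (coefficients a) ρ) (cong (i •_) (sound a ρ))
    sound :0       ρ = combine-0 ρ

    -- An expression is determined by its vector of integer coefficients. If all scalars are
    -- numerals, the hypothesis is `refl`; if integer variables occur among them, it becomes one
    -- ring identity in ℤ for each group variable.
    linear : ∀ {n} (a b : Expr n) (ρ : Vec C n) → coefficients a ≡ coefficients b → ⟦ a ⟧ ρ ≡ ⟦ b ⟧ ρ
    linear a b ρ e = trans (sym (sound a ρ)) (trans (cong (λ c → combine c ρ) e) (sound b ρ))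

-- Packings, and lifting them from quotients

module ZeroSumPackings where
  open CyclicDesigns
  open IntegerModules
  open import Data.Nat as ℕ using (ℕ; zero; suc; z≤n; s≤s)
  import Data.Nat.Properties as ℕₚ
  import Data.Nat.Tactic.RingSolver as NatSolver
  open import Data.Integer as ℤ using (ℤ; +_; -[1+_])
  import Data.Integer.DivMod as ℤ
  import Data.Integer.Divisibility.Signed as ℤ
  import Data.Integer.Tactic.RingSolver as IntSolver
  open import Data.Fin using (zero; suc)
  open import Data.Vec using ([]; _∷_)
  open import Data.List using (List; []; _∷_; _++_; map; length; cartesianProductWith)
  open import Data.List.Properties using (length-map; length-++)
  open import Data.List.Relation.Unary.Any using (here; there)
  open import Data.List.Membership.Propositional using (_∈_)
  open import Data.List.Membership.Propositional.Properties using (∈-map⁺; ∈-++⁺ˡ; ∈-++⁺ʳ; ∈-cartesianProductWith⁺)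
  open import Data.Product using (∃; ∃₂; _×_; _,_; proj₁; proj₂)
  open import Data.Sum using (_⊎_; inj₁; inj₂)
  open import Relation.Binary.PropositionalEquality
  open import Relation.Unary using (Decidable)
  open import Algebra.Structures using (IsAbelianGroup)

  length-cartesianProductWith : ∀ {A B C : Set} (f : A → B → C) xs ys →
                                length (cartesianProductWith f xs ys) ≡ length xs ℕ.* length ys
  length-cartesianProductWith f []       ys = refl
  length-cartesianProductWith f (x ∷ xs) ys =
    trans (length-++ (map (f x) ys)) (cong₂ ℕ._+_ (length-map (f x) ys) (length-cartesianProductWith f xs ys))

  module Packings {C : Set} {_⊕_ : C → C → C} {𝟘 : C} {⊖_ : C → C}
                  (isAbelianGroup : IsAbelianGroup _≡_ _⊕_ 𝟘 ⊖_) where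

    open IntegerModule isAbelianGroup

    v₀ : ∀ {n} → Expr (suc n)
    v₀ = var zero
    v₁ : ∀ {n} → Expr (suc (suc n))
    v₁ = var (suc zero)
    v₂ : ∀ {n} → Expr (suc (suc (suc n)))
    v₂ = var (suc (suc zero))
    v₃ : ∀ {n} → Expr (suc (suc (suc (suc n))))
    v₃ = var (suc (suc (suc zero)))

    record Subgroup : Set₁ where
      field
        mem : C → Set
        dec : Decidable mem
        𝟘∈  : mem 𝟘
        ⊕∈  : ∀ {x y} → mem x → mem y → mem (x ⊕ y)
        ⊖∈  : ∀ {x} → mem x → mem (⊖ x)

      ·∈ : ∀ n {x} → mem x → mem ((+ n) • x)
      ·∈ zero    m = 𝟘∈
      ·∈ (suc n) m = ⊕∈ m (·∈ n m)

      •∈ : ∀ i {x} → mem x → mem (i • x)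
      •∈ (+ n)    m = ·∈ n m
      •∈ -[1+ n ] m = ⊖∈ (·∈ (suc n) m)

    open Subgroup

    infix 4 _≡_mod_
    _≡_mod_ : C → C → Subgroup → Set
    x ≡ y mod K = mem K (x ⊕ (⊖ y))

    ± : C → C → Set
    ± x y = x ≡ y ⊎ x ≡ ⊖ y

    data Hit (a b x : C) : Set where
      hit₁ : ± x a → Hit a b x
      hit₂ : ± x b → Hit a b x
      hit₃ : ± x (a ⊕ b) → Hit a b x

    -- In `size`, zero counts once, a triple with its negative six times and a pair twice. For J of
    -- order k, `size` and `covers` together make the covering a partition.
    record Packing (J : Subgroup) (k : ℕ) : Set where
      field
        triples : List (C × C)
        pairs   : List C
        few     : length pairs ℕ.≤ 2
        size    : 1 ℕ.+ 6 ℕ.* length triples ℕ.+ 2 ℕ.* length pairs ℕ.≤ k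
        covers  : ∀ x → mem J x →
                  x ≡ 𝟘 ⊎ (∃₂ λ a b → (a , b) ∈ triples × Hit a b x) ⊎ (∃ λ p → p ∈ pairs × ± x p)

    record QuotientPacking (J K : Subgroup) (q : ℕ) : Set where
      field
        triples : List (C × C)
        size    : 1 ℕ.+ 6 ℕ.* length triples ℕ.≤ q
        covers  : ∀ x → mem J x →
                  mem K x ⊎ (∃₂ λ a b → (a , b) ∈ triples × ∃ λ y → Hit a b y × x ≡ y mod K)

    -- Halving lets the third members -(a+b)-2κ of the lifted triples reach every element of their
    -- coset, and the elements 2h reach all of K in the case of index 3.
    record Finite (K : Subgroup) (k : ℕ) : Set where
      field
        elements : List C
        count    : length elements ≡ k
        complete : ∀ x → mem K x → x ∈ elements
        halve    : ∀ x → mem K x → ∃ λ y → mem K y × x ≡ y ⊕ y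

    -- A representative triple (a, b, −(a+b)) lifts to the triples (a+κ, b+κ, −(a+b)−2κ), κ ∈ K.
    extend-packing : ∀ {J K q k} → QuotientPacking J K q → Finite K k → Packing K k → Packing J (q ℕ.* k)
    extend-packing {J} {K} {q} {k} Q F P = record
      { triples = P.triples ++ lifted
      ; pairs = P.pairs
      ; few = P.few
      ; size = size′
      ; covers = covers′
      }
      where
      module Q = QuotientPacking Q
      module F = Finite F
      module P = Packing P

      translate : C × C → C → C × C
      translate (a , b) κ = a ⊕ κ , b ⊕ κ

      lifted : List (C × C)
      lifted = cartesianProductWith translate Q.triples F.elements

      size′ : 1 ℕ.+ 6 ℕ.* length (P.triples ++ lifted) ℕ.+ 2 ℕ.* length P.pairs ℕ.≤ q ℕ.* k
      size′ = begin
        1 ℕ.+ 6 ℕ.* length (P.triples ++ lifted) ℕ.+ 2 ℕ.* length P.pairs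
          ≡⟨ cong (λ l → 1 ℕ.+ 6 ℕ.* l ℕ.+ 2 ℕ.* length P.pairs)
               (trans (length-++ P.triples)
                 (cong (length P.triples ℕ.+_) (trans (length-cartesianProductWith translate Q.triples F.elements)
                   (cong (length Q.triples ℕ.*_) F.count)))) ⟩
        1 ℕ.+ 6 ℕ.* (length P.triples ℕ.+ length Q.triples ℕ.* k) ℕ.+ 2 ℕ.* length P.pairs
          ≡⟨ arith (length P.triples) (length Q.triples) (length P.pairs) k ⟩
        1 ℕ.+ 6 ℕ.* length P.triples ℕ.+ 2 ℕ.* length P.pairs ℕ.+ 6 ℕ.* length Q.triples ℕ.* k
          ≤⟨ ℕₚ.+-monoˡ-≤ _ P.size ⟩
        (1 ℕ.+ 6 ℕ.* length Q.triples) ℕ.* k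
          ≤⟨ ℕₚ.*-monoˡ-≤ k Q.size ⟩
        q ℕ.* k ∎
        where
        open ℕₚ.≤-Reasoning
        arith : ∀ a b c k → 1 ℕ.+ 6 ℕ.* (a ℕ.+ b ℕ.* k) ℕ.+ 2 ℕ.* c ≡ 1 ℕ.+ 6 ℕ.* a ℕ.+ 2 ℕ.* c ℕ.+ 6 ℕ.* b ℕ.* k
        arith = NatSolver.solve-∀

      lift : ∀ {a b x} κ → (a , b) ∈ Q.triples → mem K κ → Hit (a ⊕ κ) (b ⊕ κ) x →
             ∃₂ λ a b → (a , b) ∈ P.triples ++ lifted × Hit a b x
      lift κ i m h = _ , _ , ∈-++⁺ʳ P.triples (∈-cartesianProductWith⁺ translate i (F.complete κ m)) , h

      covers′ : ∀ x → mem J x →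
                x ≡ 𝟘 ⊎ (∃₂ λ a b → (a , b) ∈ P.triples ++ lifted × Hit a b x) ⊎ (∃ λ p → p ∈ P.pairs × ± x p)
      covers′ x x∈J with Q.covers x x∈J
      ... | inj₁ x∈K with P.covers x x∈K
      ...   | inj₁ x≡0 = inj₁ x≡0
      ...   | inj₂ (inj₁ (a , b , i , h)) = inj₂ (inj₁ (a , b , ∈-++⁺ˡ i , h))
      ...   | inj₂ (inj₂ p) = inj₂ (inj₂ p)
      covers′ x x∈J | inj₂ (a , b , i , y , h , κ∈K) = inj₂ (inj₁ (cases h))
        where
        κ = x ⊕ (⊖ y)
        x≡y+κ : x ≡ y ⊕ κ
        x≡y+κ = linear v₀ (v₁ :+ (v₀ :- v₁)) (x ∷ y ∷ []) refl
        ½κ = proj₁ (F.halve κ κ∈K)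
        ½κ∈K = proj₁ (proj₂ (F.halve κ κ∈K))
        κ≡ : κ ≡ ½κ ⊕ ½κ
        κ≡ = proj₂ (proj₂ (F.halve κ κ∈K))
        x≡y+2½κ : x ≡ y ⊕ (½κ ⊕ ½κ)
        x≡y+2½κ = trans x≡y+κ (cong (y ⊕_) κ≡)
        negated : ∀ {a} → y ≡ ⊖ a → x ≡ ⊖ (a ⊕ (⊖ κ))
        negated {a} refl = trans x≡y+κ (linear (:- v₀ :+ v₁) (:- (v₀ :- v₁)) (a ∷ κ ∷ []) refl)
        cases : Hit a b y → ∃₂ λ a b → (a , b) ∈ P.triples ++ lifted × Hit a b x
        cases (hit₁ (inj₁ refl)) = lift κ i κ∈K (hit₁ (inj₁ x≡y+κ))
        cases (hit₁ (inj₂ y≡-a)) = lift (⊖ κ) i (⊖∈ K κ∈K) (hit₁ (inj₂ (negated y≡-a)))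
        cases (hit₂ (inj₁ refl)) = lift κ i κ∈K (hit₂ (inj₁ x≡y+κ))
        cases (hit₂ (inj₂ y≡-b)) = lift (⊖ κ) i (⊖∈ K κ∈K) (hit₂ (inj₂ (negated y≡-b)))
        cases (hit₃ (inj₁ refl)) = lift ½κ i ½κ∈K (hit₃ (inj₁ (trans x≡y+2½κ
          (linear (v₀ :+ v₁ :+ (v₂ :+ v₂)) (v₀ :+ v₂ :+ (v₁ :+ v₂)) (a ∷ b ∷ ½κ ∷ []) refl))))
        cases (hit₃ (inj₂ refl)) = lift (⊖ ½κ) i (⊖∈ K ½κ∈K) (hit₃ (inj₂ (trans x≡y+2½κ
          (linear (:- (v₀ :+ v₁) :+ (v₂ :+ v₂)) (:- (v₀ :- v₂ :+ (v₁ :- v₂))) (a ∷ b ∷ ½κ ∷ []) refl))))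

    remainder-mod : ∀ K {x g} m .{{_ : ℕ.NonZero m}} → mem K ((+ m) • g) → ∀ i → x ≡ i • g mod K →
                    ∃ λ r → r ℕ.< m × x ≡ (+ r) • g mod K
    remainder-mod K {x} {g} m multiple∈ i e = i ℤ.%ℕ m , ℤ.n%ℕd<d i m ,
      subst (mem K) (trans (linear (v₀ :- i :• v₁ :+ q :• (+ m) :• v₁) (v₀ :- (i ℤ.- q ℤ.* (+ m)) :• v₁) (x ∷ g ∷ [])
                              (cong₂ _∷_ (arith₀ i q (+ m)) (cong (_∷ []) (arith₁ i q (+ m)))))
                      (cong (λ z → x ⊕ (⊖ (z • g))) division))
                    (⊕∈ K e (•∈ K q multiple∈))
      where
      q = i ℤ./ℕ m
      arith₀ : ∀ i q m → + 1 ℤ.+ (ℤ.- (i ℤ.* + 0)) ℤ.+ q ℤ.* (m ℤ.* + 0) ≡ + 1 ℤ.+ (ℤ.- ((i ℤ.- q ℤ.* m) ℤ.* + 0))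
      arith₀ = IntSolver.solve-∀
      arith₁ : ∀ i q m → + 0 ℤ.+ (ℤ.- (i ℤ.* + 1)) ℤ.+ q ℤ.* (m ℤ.* + 1) ≡ + 0 ℤ.+ (ℤ.- ((i ℤ.- q ℤ.* m) ℤ.* + 1))
      arith₁ = IntSolver.solve-∀
      arith : ∀ r t → r ℤ.+ t ℤ.- t ≡ r
      arith = IntSolver.solve-∀
      division : i ℤ.- q ℤ.* (+ m) ≡ + (i ℤ.%ℕ m)
      division = trans (cong (ℤ._- q ℤ.* (+ m)) (ℤ.a≡a%ℕn+[a/ℕn]*n i m)) (arith (+ (i ℤ.%ℕ m)) (q ℤ.* (+ m)))

    -- g generates J modulo K, and mg lies in K; that m is the exact order of g modulo K is added in
    -- `Layer`.
    record Cyclic (J K : Subgroup) (g : C) (m : ℕ) : Set where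
      field
        multiple∈ : mem K ((+ m) • g)
        span      : ∀ x → mem J x → ∃ λ (i : ℤ) → x ≡ i • g mod K

      remainder : .{{ℕ.NonZero m}} → ∀ x → mem J x → ∃ λ r → r ℕ.< m × x ≡ (+ r) • g mod K
      remainder x x∈J = let i , e = span x x∈J in remainder-mod K m multiple∈ i e

    -- The elements of the triples and pairs of K form a half-system of K.
    record HalfSystem (K : Subgroup) (k : ℕ) : Set where
      field
        half   : List C
        size   : 1 ℕ.+ 2 ℕ.* length half ℕ.≤ k
        covers : ∀ x → mem K x → x ≡ 𝟘 ⊎ ∃ λ h → h ∈ half × ± x h

    half-system : ∀ {K k} → Packing K k → HalfSystem K k
    half-system {K} {k} P = record
      { half = flatten triples ++ pairs
      ; size = ℕₚ.≤-trans (ℕₚ.≤-reflexive size′) size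
      ; covers = covers′
      }
      where
      open Packing P
      flatten : List (C × C) → List C
      flatten []             = []
      flatten ((a , b) ∷ ts) = a ∷ b ∷ a ⊕ b ∷ flatten ts
      length-flatten : ∀ ts → length (flatten ts) ≡ 3 ℕ.* length ts
      length-flatten []       = refl
      length-flatten (_ ∷ ts) = trans (cong (3 ℕ.+_) (length-flatten ts)) (sym (ℕₚ.*-suc 3 (length ts)))
      arith : ∀ t p → 1 ℕ.+ 2 ℕ.* (3 ℕ.* t ℕ.+ p) ≡ 1 ℕ.+ 6 ℕ.* t ℕ.+ 2 ℕ.* p
      arith = NatSolver.solve-∀
      size′ : 1 ℕ.+ 2 ℕ.* length (flatten triples ++ pairs) ≡ 1 ℕ.+ 6 ℕ.* length triples ℕ.+ 2 ℕ.* length pairs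
      size′ = trans (cong (λ l → 1 ℕ.+ 2 ℕ.* l) (trans (length-++ (flatten triples)) (cong (ℕ._+ length pairs) (length-flatten triples))))
                    (arith (length triples) (length pairs))
      in-flatten : ∀ {a b x} ts → (a , b) ∈ ts → Hit a b x → ∃ λ h → h ∈ flatten ts × ± x h
      in-flatten (_ ∷ _) (here refl) (hit₁ s) = _ , here refl , s
      in-flatten (_ ∷ _) (here refl) (hit₂ s) = _ , there (here refl) , s
      in-flatten (_ ∷ _) (here refl) (hit₃ s) = _ , there (there (here refl)) , s
      in-flatten (_ ∷ ts) (there i) s = let h , j , s′ = in-flatten ts i s in h , there (there (there j)) , s′
      covers′ : ∀ x → mem K x → x ≡ 𝟘 ⊎ ∃ λ h → h ∈ flatten triples ++ pairs × ± x h
      covers′ x x∈K with covers x x∈K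
      ... | inj₁ x≡0 = inj₁ x≡0
      ... | inj₂ (inj₁ (a , b , i , s)) = let h , j , s′ = in-flatten triples i s in inj₂ (h , ∈-++⁺ˡ j , s′)
      ... | inj₂ (inj₂ (p , i , s)) = inj₂ (p , ∈-++⁺ʳ (flatten triples) i , s)

    -- With h running through a half-system of K, the triples (g+h, −g+h, −2h) leave over only the pair ±g.
    triple-packing : ∀ {J K g k} → Cyclic J K g 3 → Finite K k → Packing K k → Packing J (3 ℕ.* k)
    triple-packing {J} {K} {g} {k} cyclic F P = record
      { triples = map triple half
      ; pairs = g ∷ []
      ; few = s≤s z≤n
      ; size = size′
      ; covers = covers′
      }
      where
      open HalfSystem (half-system P)
      open Cyclic cyclic
      triple : C → C × C
      triple h = g ⊕ h , (⊖ g) ⊕ h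
      size′ : 1 ℕ.+ 6 ℕ.* length (map triple half) ℕ.+ 2 ℕ.≤ 3 ℕ.* k
      size′ = ℕₚ.≤-trans (ℕₚ.≤-reflexive (trans (cong (λ l → 1 ℕ.+ 6 ℕ.* l ℕ.+ 2) (length-map triple half)) (arith (length half))))
                         (ℕₚ.*-monoʳ-≤ 3 size)
        where
        arith : ∀ l → 1 ℕ.+ 6 ℕ.* l ℕ.+ 2 ≡ 3 ℕ.* (1 ℕ.+ 2 ℕ.* l)
        arith = NatSolver.solve-∀
      Result : C → Set
      Result x = x ≡ 𝟘 ⊎ (∃₂ λ a b → (a , b) ∈ map triple half × Hit a b x) ⊎ (∃ λ p → p ∈ g ∷ [] × ± x p)
      triple∋ : ∀ {x h} → h ∈ half → Hit (g ⊕ h) ((⊖ g) ⊕ h) x → Result x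
      triple∋ i s = inj₂ (inj₁ (_ , _ , ∈-map⁺ triple i , s))
      covers′ : ∀ x → mem J x → Result x
      covers′ x x∈J with remainder x x∈J
      -- The elements of K are reached by the third members: x = 2y with y = ±h or y = 0, and (g +
      -- h) + (-g + h) = 2h.
      covers′ x x∈J | 0 , _ , e with Finite.halve F x (subst (mem K) (linear (v₀ :- (+ 0) :• v₁) v₀ (x ∷ g ∷ []) refl) e)
      ... | y , y∈K , refl with covers y y∈K
      ...   | inj₁ refl = inj₁ (linear {0} (:0 :+ :0) :0 [] refl)
      ...   | inj₂ (h , i , inj₁ refl) = triple∋ i (hit₃ (inj₁ (linear (v₀ :+ v₀) (v₁ :+ v₀ :+ (:- v₁ :+ v₀)) (h ∷ g ∷ []) refl)))
      ...   | inj₂ (h , i , inj₂ refl) = triple∋ i (hit₃ (inj₂ (linear (:- v₀ :- v₀) (:- (v₁ :+ v₀ :+ (:- v₁ :+ v₀))) (h ∷ g ∷ []) refl)))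
      covers′ x x∈J | 1 , _ , e with covers _ e
      ... | inj₁ z =
          inj₂ (inj₂ (g , here refl ,
          inj₁ (trans (linear v₀ (v₀ :- (+ 1) :• v₁ :+ v₁) (x ∷ g ∷ []) refl)
          (trans (cong (_⊕ g) z) (linear (:0 :+ v₀) v₀ (g ∷ []) refl)))))
      ... | inj₂ (h , i , inj₁ z) =
          triple∋ i (hit₁ (inj₁ (trans (linear v₀ (v₁ :+ (v₀ :- (+ 1) :• v₁)) (x ∷ g ∷ []) refl) (cong (g ⊕_) z))))
      ... | inj₂ (h , i , inj₂ z) = triple∋ i (hit₂ (inj₂ (trans (linear v₀ (v₁ :+ (v₀ :- (+ 1) :• v₁)) (x ∷ g ∷ []) refl)
              (trans (cong (g ⊕_) z) (linear (v₀ :- v₁) (:- (:- v₀ :+ v₁)) (g ∷ h ∷ []) refl)))))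
      -- As 3g ∈ K, the coset of 2g is that of -g. So x + g lies in K, and its sign relative to the
      -- half-system decides between -g + h and the negative of g + h.
      covers′ x x∈J | 2 , _ ,
          e with covers (x ⊕ g)
          (subst (mem K) (linear (v₀ :- (+ 2) :• v₁ :+ (+ 3) :• v₁) (v₀ :+ v₁) (x ∷ g ∷ []) refl) (⊕∈ K e multiple∈))
      ... | inj₁ z =
          inj₂ (inj₂ (g , here refl ,
          inj₂ (trans (linear v₀ (v₀ :+ v₁ :- v₁) (x ∷ g ∷ []) refl)
          (trans (cong (_⊕ (⊖ g)) z) (linear (:0 :- v₀) (:- v₀) (g ∷ []) refl)))))
      ... | inj₂ (h , i , inj₁ z) = triple∋ i (hit₂ (inj₁ (trans (linear v₀ (:- v₁ :+ (v₀ :+ v₁)) (x ∷ g ∷ []) refl) (cong ((⊖ g) ⊕_) z))))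
      ... | inj₂ (h , i , inj₂ z) = triple∋ i (hit₁ (inj₂ (trans (linear v₀ (:- v₁ :+ (v₀ :+ v₁)) (x ∷ g ∷ []) refl)
              (trans (cong ((⊖ g) ⊕_) z) (linear (:- v₀ :- v₁) (:- (v₀ :+ v₁)) (g ∷ h ∷ []) refl)))))
      covers′ x x∈J | suc (suc (suc _)) , s≤s (s≤s (s≤s ())) , e

    module FromDesign {J K : Subgroup} {g : C} {m : ℕ} (cyclic : Cyclic J K g m) (D : Design m) where
      open Cyclic cyclic

      multiple : ℕ → C
      multiple i = (+ i) • g

      triple : ℕ × ℕ → C × C
      triple (a , b) = multiple a , multiple b

      opposite : ∀ x r a → x ≡ multiple r mod K → r ℕ.+ a ≡ m → x ≡ ⊖ multiple a mod K
      opposite x r a e refl = subst (mem K)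
        (linear (v₀ :- (+ r) :• v₁ :+ ((+ r) ℤ.+ (+ a)) :• v₁) (v₀ :- (:- ((+ a) :• v₁))) (x ∷ g ∷ [])
          (cong₂ _∷_ (arith₀ (+ r) (+ a)) (cong (_∷ []) (arith₁ (+ r) (+ a)))))
        (⊕∈ K e multiple∈)
        where
        arith₀ : ∀ r a → + 1 ℤ.+ (ℤ.- (r ℤ.* + 0)) ℤ.+ (r ℤ.+ a) ℤ.* + 0 ≡ + 1 ℤ.+ (ℤ.- (ℤ.- (a ℤ.* + 0)))
        arith₀ = IntSolver.solve-∀
        arith₁ : ∀ r a → + 0 ℤ.+ (ℤ.- (r ℤ.* + 1)) ℤ.+ (r ℤ.+ a) ℤ.* + 1 ≡ + 0 ℤ.+ (ℤ.- (ℤ.- (a ℤ.* + 1)))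
        arith₁ = IntSolver.solve-∀

      hits : ∀ {a b r} x → Hits m a b r → x ≡ multiple r mod K →
             ∃ λ y → Hit (multiple a) (multiple b) y × x ≡ y mod K
      hits x (hit-a refl) e = _ , hit₁ (inj₁ refl) , e
      hits x (hit-b refl) e = _ , hit₂ (inj₁ refl) , e
      hits {a} {b} x (hit-c refl) e = _ , hit₃ (inj₁ (•-distrib-+ (+ a) (+ b) g)) , e
      hits {a} {r = r} x (hit-−a f) e = _ , hit₁ (inj₂ refl) , opposite x r a e f
      hits {b = b} {r} x (hit-−b f) e = _ , hit₂ (inj₂ refl) , opposite x r b e f
      hits {a} {b} {r} x (hit-−c f) e = _ , hit₃ (inj₂ (cong ⊖_ (•-distrib-+ (+ a) (+ b) g))) , opposite x r (a ℕ.+ b) e f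

      design-covers : .{{ℕ.NonZero m}} → ∀ x → mem J x → mem K x
        ⊎ (∃₂ λ a b → (a , b) ∈ map triple (Design.triples D) × ∃ λ y → Hit a b y × x ≡ y mod K)
        ⊎ (∃ λ p → p ∈ map multiple (Design.pairs D) × ∃ λ y → ± y p × x ≡ y mod K)
      design-covers x x∈J with remainder x x∈J
      ... | zero , _ , e = inj₁ (subst (mem K) (linear (v₀ :- (+ 0) :• v₁) v₀ (x ∷ g ∷ []) refl) e)
      ... | suc r , r< , e with Design.covers D (suc r) (s≤s z≤n) r<
      ...   | inj₁ (a , b , i , h) = inj₂ (inj₁ (_ , _ , ∈-map⁺ triple i , hits x h e))
      ...   | inj₂ (p , i , inj₁ refl) = inj₂ (inj₂ (_ , ∈-map⁺ multiple i , _ , inj₁ refl , e))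
      ...   | inj₂ (p , i , inj₂ f) = inj₂ (inj₂ (_ , ∈-map⁺ multiple i , _ , inj₂ refl , opposite x (suc r) p e f))

      quotient-packing : .{{ℕ.NonZero m}} → Design.pairs D ≡ [] → QuotientPacking J K m
      quotient-packing none = record
        { triples = map triple (Design.triples D)
        ; size = ℕₚ.≤-trans (ℕₚ.≤-reflexive (cong (λ l → 1 ℕ.+ 6 ℕ.* l) (length-map triple (Design.triples D))))
                   (ℕₚ.≤-trans (ℕₚ.m≤m+n _ _) (ℕₚ.≤-reflexive (Design.size D)))
        ; covers = covers′
        }
        where
        covers′ : ∀ x → mem J x → mem K x
          ⊎ (∃₂ λ a b → (a , b) ∈ map triple (Design.triples D) × ∃ λ y → Hit a b y × x ≡ y mod K)
        covers′ x x∈J with design-covers x x∈J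
        ... | inj₁ x∈K = inj₁ x∈K
        ... | inj₂ (inj₁ h) = inj₂ h
        ... | inj₂ (inj₂ (p , i , _)) with subst (λ ps → p ∈ map multiple ps) none i
        ... | ()

      -- Above the trivial subgroup congruence is equality, so nothing has to be lifted and the
      -- design may keep its pairs. This serves a lowest layer of order 5 mod 6.
      packing : .{{ℕ.NonZero m}} → (∀ x → mem K x → x ≡ 𝟘) → Packing J m
      packing trivial = record
        { triples = map triple (Design.triples D)
        ; pairs = map multiple (Design.pairs D)
        ; few = subst (ℕ._≤ 2) (sym (length-map multiple (Design.pairs D))) (Design.few D)
        ; size = ℕₚ.≤-reflexive
            (trans (cong₂ (λ l l′ → 1 ℕ.+ 6 ℕ.* l ℕ.+ 2 ℕ.* l′) (length-map triple (Design.triples D))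
            (length-map multiple (Design.pairs D))) (Design.size D))
        ; covers = covers′
        }
        where
        equal : ∀ {x y} → x ≡ y mod K → x ≡ y
        equal {x} {y} e = trans (linear v₀ (v₀ :- v₁ :+ v₁) (x ∷ y ∷ []) refl)
          (trans (cong (_⊕ y) (trivial _ e)) (linear (:0 :+ v₀) v₀ (y ∷ []) refl))
        covers′ : ∀ x → mem J x → x ≡ 𝟘
          ⊎ (∃₂ λ a b → (a , b) ∈ map triple (Design.triples D) × Hit a b x)
          ⊎ (∃ λ p → p ∈ map multiple (Design.pairs D) × ± x p)
        covers′ x x∈J with design-covers x x∈J
        ... | inj₁ x∈K = inj₁ (trivial x x∈K)
        ... | inj₂ (inj₁ (a , b , i , y , h , e)) = inj₂ (inj₁ (a , b , i , subst (Hit a b) (sym (equal e)) h))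
        ... | inj₂ (inj₂ (p , i , y , s , e)) = inj₂ (inj₂ (p , i , subst (λ z → ± z p) (sym (equal e)) s))

-- Two consecutive prime layers: elementary or cyclic

module SubgroupLayers where
  open IntegerModules
  open ZeroSumPackings
  open FiniteLists
  open HexagonalLattice
  open import Data.Nat as ℕ using (ℕ; zero; suc)
  open import Data.Nat.Primality using (Prime; ¬prime[1]; prime⇒nonZero; prime⇒irreducible)
  open import Data.Nat.Coprimality using (prime⇒coprime; coprime-Bézout)
  open import Data.Nat.GCD using (module Bézout)
  open import Data.Integer as ℤ using (ℤ; +_)
  import Data.Integer.Properties as ℤₚ
  import Data.Integer.DivMod as ℤ
  open import Data.Integer.Divisibility.Signed as ℤ using (_∣_; divides)
  import Data.Integer.Tactic.RingSolver as IntSolver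
  open import Data.Fin using (zero; suc)
  open import Data.Vec using ([]; _∷_)
  open import Data.List using ([]; _∷_; map)
  open import Data.List.Properties using (length-map)
  open import Data.List.Relation.Unary.Any using (Any; here; there)
  open import Data.List.Relation.Unary.Any.Properties using (++⁻)
  open import Data.List.Membership.Propositional using (_∈_)
  open import Data.Product using (∃; ∃₂; _×_; _,_)
  open import Data.Sum using (_⊎_; inj₁; inj₂)
  open import Data.Empty using (⊥-elim)
  open import Relation.Binary.PropositionalEquality
  open import Relation.Nullary using (¬_; yes; no)
  open import Algebra.Structures using (IsAbelianGroup)

  module Towers {C : Set} {_⊕_ : C → C → C} {𝟘 : C} {⊖_ : C → C}
                (isAbelianGroup : IsAbelianGroup _≡_ _⊕_ 𝟘 ⊖_) where

    open IntegerModule isAbelianGroup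
    open Packings isAbelianGroup
    open Subgroup

    -- `ord` makes m the exact order of g modulo K. It is what makes digits along a tower unique,
    -- and what gives the order of the new generator when layers are merged or swapped.
    record Layer (J K : Subgroup) (g : C) (m : ℕ) : Set where
      field
        ⊆   : ∀ {x} → mem K x → mem J x
        g∈  : mem J g
        cyc : Cyclic J K g m
        ord : ∀ i → mem K (i • g) → + m ∣ i
      open Cyclic cyc public

    multiple-≡0 : ∀ K {g m i} → mem K ((+ m) • g) → + m ∣ i → mem K (i • g)
    multiple-≡0 K {g} {m} mg∈ (divides q refl) = subst (mem K) (sym (•-assoc q (+ m) g)) (•∈ K q mg∈)

    ≡-mod-trans : ∀ K {x y z} → x ≡ y mod K → y ≡ z mod K → x ≡ z mod K
    ≡-mod-trans K {x} {y} {z} a b = subst (mem K) (linear (v₀ :- v₁ :+ (v₁ :- v₂)) (v₀ :- v₂) (x ∷ y ∷ z ∷ []) refl) (⊕∈ K a b)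

    ≡-mod-mem : ∀ K {x y} → x ≡ y mod K → mem K y → mem K x
    ≡-mod-mem K {x} {y} a b = subst (mem K) (linear (v₀ :- v₁ :+ v₁) v₀ (x ∷ y ∷ []) refl) (⊕∈ K a b)

    ≡-mod-sym : ∀ K {x y} → x ≡ y mod K → y ≡ x mod K
    ≡-mod-sym K {x} {y} a = subst (mem K) (linear (:- (v₀ :- v₁)) (v₁ :- v₀) (x ∷ y ∷ []) refl) (⊖∈ K a)

    ≡-mod-• : ∀ K i {x y} → x ≡ y mod K → i • x ≡ i • y mod K
    ≡-mod-• K i {x} {y} a =
        subst (mem K)
        (linear (i :• (v₀ :- v₁)) (i :• v₀ :- i :• v₁) (x ∷ y ∷ []) (cong₂ _∷_ (arith₀ i) (cong (_∷ []) (arith₁ i))))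
        (•∈ K i a)
      where
      arith₀ : ∀ i → i ℤ.* (+ 1 ℤ.+ ℤ.- + 0) ≡ i ℤ.* + 1 ℤ.+ ℤ.- (i ℤ.* + 0)
      arith₀ = IntSolver.solve-∀
      arith₁ : ∀ i → i ℤ.* (+ 0 ℤ.+ ℤ.- + 1) ≡ i ℤ.* + 0 ℤ.+ ℤ.- (i ℤ.* + 1)
      arith₁ = IntSolver.solve-∀

    -- Since pg and pg′ lie in L, the map `q` (i, j) = ig + jg′ is well defined on (ℤ/p)² modulo L,
    -- and it reaches all of J modulo L. By ρ² + 1 = ρ and ρ³ = -1, the orbit of v is the triple (v,
    -- ρ²v, -ρv) together with its negative.
    hexagonal : ∀ {J K L g g′ p} .{{_ : ℕ.NonZero p}} →
                (∀ a → + p ∣ (+ 2) ℤ.* a → + p ∣ a) → (∀ a → + p ∣ (+ 3) ℤ.* a → + p ∣ a) →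
                Layer J K g p → Layer K L g′ p → mem L ((+ p) • g) → QuotientPacking J L (p ℕ.* p)
    hexagonal {J} {K} {L} {g} {g′} {p} 2-cancel 3-cancel top bottom pg∈L with Hexagonal.sixfold p 2-cancel 3-cancel
    ... | R , size , covers = record
      { triples = map triple R
      ; size = subst (λ l → 1 ℕ.+ 6 ℕ.* l ℕ.≤ p ℕ.* p) (sym (length-map triple R)) size
      ; covers = covers′
      }
      where
      open Hexagonal p 2-cancel 3-cancel hiding (_≈?_)
      q : V → C
      q (i , j) = i • g ⊕ j • g′
      triple : V → C × C
      triple v = q v , q (ρ (ρ v))

      q-+ : ∀ i j k l → q (i , j) ⊕ q (k , l) ≡ q (i ℤ.+ k , j ℤ.+ l)
      q-+ i j k l = trans (⊕-interchange _ _ _ _) (cong₂ _⊕_ (sym (•-distrib-+ i k g)) (sym (•-distrib-+ j l g′)))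

      q-neg : ∀ i j → q (ℤ.- i , ℤ.- j) ≡ ⊖ q (i , j)
      q-neg i j = trans (cong₂ _⊕_ (•-neg i g) (•-neg j g′)) (linear (:- v₀ :- v₁) (:- (v₀ :+ v₁)) (i • g ∷ j • g′ ∷ []) refl)

      q-cong : ∀ v w → v ≈ w → q v ≡ q w mod L
      q-cong (i , j) (k , l) (a , b) = subst (mem L)
        (trans (sym (q-+ i j (ℤ.- k) (ℤ.- l))) (cong (q (i , j) ⊕_) (q-neg k l)))
        (⊕∈ L (multiple-≡0 L pg∈L a) (multiple-≡0 L (Layer.multiple∈ bottom) b))

      q-ρ : ∀ v → q v ⊕ q (ρ (ρ v)) ≡ q (ρ v)
      q-ρ (i , j) = trans (q-+ i j _ _) (cong q (cong₂ _,_ (arith i j) (arith′ i j)))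
        where
        arith : ∀ i j → i ℤ.+ (i ℤ.- j ℤ.- i) ≡ i ℤ.- j
        arith = IntSolver.solve-∀
        arith′ : ∀ i j → j ℤ.+ (i ℤ.- j) ≡ i
        arith′ = IntSolver.solve-∀

      q-ρ³ : ∀ v → q (ρ (ρ (ρ v))) ≡ ⊖ q v
      q-ρ³ (i , j) = trans (cong q (ρ³ i j)) (q-neg i j)

      orbit-hit : ∀ v {w} → Any (w ≈_) (orbit v) → ∃ λ u → Hit (q v) (q (ρ (ρ v))) (q u) × w ≈ u
      orbit-hit v (here e) = _ , hit₁ (inj₁ refl) , e
      orbit-hit v (there (here e)) = _ , hit₃ (inj₁ (sym (q-ρ v))) , e
      orbit-hit v (there (there (here e))) = _ , hit₂ (inj₁ refl) , e
      orbit-hit v (there (there (there (here e)))) = _ , hit₁ (inj₂ (q-ρ³ v)) , e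
      orbit-hit v (there (there (there (there (here e))))) = _ , hit₃ (inj₂ (trans (q-ρ³ (ρ v)) (cong ⊖_ (sym (q-ρ v))))) , e
      orbit-hit v (there (there (there (there (there (here e)))))) = _ , hit₂ (inj₂ (q-ρ³ (ρ (ρ v)))) , e

      orbits-hit : ∀ R {w} → w ∈ₒ R → w ≈ 0ᵥ ⊎ ∃₂ λ a b → (a , b) ∈ map triple R × ∃ λ u → Hit a b (q u) × w ≈ u
      orbits-hit [] (here e) = inj₁ e
      orbits-hit (v ∷ R) i with ++⁻ (orbit v) i
      ... | inj₁ j = let u , h , e = orbit-hit v j in inj₂ (_ , _ , here refl , u , h , e)
      ... | inj₂ j with orbits-hit R j
      ...   | inj₁ e = inj₁ e
      ...   | inj₂ (a , b , k , r) = inj₂ (a , b , there k , r)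

      covers′ : ∀ x → mem J x → mem L x ⊎ (∃₂ λ a b → (a , b) ∈ map triple R × ∃ λ y → Hit a b y × x ≡ y mod L)
      covers′ x x∈J with Layer.span top x x∈J
      ... | i , e with Layer.span bottom _ e
      ...   | j , e′ with orbits-hit R (covers (i , j))
      ...     | inj₁ z = inj₁ (≡-mod-mem L x≡q (≡-mod-mem L (q-cong _ _ z) (⊕∈ L (𝟘∈ L) (𝟘∈ L))))
        where
        x≡q : x ≡ q (i , j) mod L
        x≡q = subst (mem L) (linear (v₀ :- v₁ :- v₂) (v₀ :- (v₁ :+ v₂)) (x ∷ i • g ∷ j • g′ ∷ []) refl) e′
      ...     | inj₂ (a , b , k , u , h , z) = inj₂ (a , b , k , q u , h , ≡-mod-trans L x≡q (q-cong _ _ z))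
        where
        x≡q : x ≡ q (i , j) mod L
        x≡q = subst (mem L) (linear (v₀ :- v₁ :- v₂) (v₀ :- (v₁ :+ v₂)) (x ∷ i • g ∷ j • g′ ∷ []) refl) e′

    prime-inverse : ∀ {p} → Prime p → ∀ j → ¬ (+ p ∣ j) → ∃₂ λ c d → c ℤ.* j ≡ + 1 ℤ.+ d ℤ.* + p
    prime-inverse {p} pp j p∤j = from-remainder (j ℤ.%ℕ p) (j ℤ./ℕ p) (ℤ.a≡a%ℕn+[a/ℕn]*n j p) (ℤ.n%ℕd<d j p)
      where
      instance p≢0 = prime⇒nonZero pp
      cast : ∀ a b c d → 1 ℕ.+ a ℕ.* b ≡ c ℕ.* d → + 1 ℤ.+ + a ℤ.* + b ≡ + c ℤ.* + d
      cast a b c d e = trans (cong (λ z → + 1 ℤ.+ z) (sym (ℤₚ.pos-* a b)))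
        (trans (sym (ℤₚ.pos-+ 1 (a ℕ.* b))) (trans (cong +_ e) (ℤₚ.pos-* c d)))
      from-remainder : ∀ r q → j ≡ + r ℤ.+ q ℤ.* + p → r ℕ.< p → ∃₂ λ c d → c ℤ.* j ≡ + 1 ℤ.+ d ℤ.* + p
      from-remainder zero q e r<p = ⊥-elim (p∤j (divides q (trans e (ℤₚ.+-identityˡ _))))
      from-remainder (suc r) q e r<p with coprime-Bézout (prime⇒coprime pp r<p)
      ... | Bézout.+- x y b = ℤ.- + y , ℤ.- + x ℤ.- + y ℤ.* q ,
            trans (cong (ℤ.- + y ℤ.*_) e) (arith (+ suc r) q (+ p) (+ x) (+ y) (cast y (suc r) x p b))
        where
        arith : ∀ r q p x y → + 1 ℤ.+ y ℤ.* r ≡ x ℤ.* p → ℤ.- y ℤ.* (r ℤ.+ q ℤ.* p) ≡ + 1 ℤ.+ (ℤ.- x ℤ.- y ℤ.* q) ℤ.* p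
        arith r q p x y e = trans (lhs r q p y) (trans (cong (λ z → + 1 ℤ.- z ℤ.- y ℤ.* q ℤ.* p) e) (rhs q p x y))
          where
          lhs : ∀ r q p y → ℤ.- y ℤ.* (r ℤ.+ q ℤ.* p) ≡ + 1 ℤ.- (+ 1 ℤ.+ y ℤ.* r) ℤ.- y ℤ.* q ℤ.* p
          lhs = IntSolver.solve-∀
          rhs : ∀ q p x y → + 1 ℤ.- x ℤ.* p ℤ.- y ℤ.* q ℤ.* p ≡ + 1 ℤ.+ (ℤ.- x ℤ.- y ℤ.* q) ℤ.* p
          rhs = IntSolver.solve-∀
      ... | Bézout.-+ x y b = + y , + x ℤ.+ + y ℤ.* q ,
            trans (cong (+ y ℤ.*_) e) (arith (+ suc r) q (+ p) (+ x) (+ y) (cast x p y (suc r) b))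
        where
        arith : ∀ r q p x y → + 1 ℤ.+ x ℤ.* p ≡ y ℤ.* r → y ℤ.* (r ℤ.+ q ℤ.* p) ≡ + 1 ℤ.+ (x ℤ.+ y ℤ.* q) ℤ.* p
        arith r q p x y e = trans (lhs r q p y) (trans (cong (λ z → z ℤ.+ y ℤ.* q ℤ.* p) (sym e)) (rhs q p x y))
          where
          lhs : ∀ r q p y → y ℤ.* (r ℤ.+ q ℤ.* p) ≡ y ℤ.* r ℤ.+ y ℤ.* q ℤ.* p
          lhs = IntSolver.solve-∀
          rhs : ∀ q p x y → + 1 ℤ.+ x ℤ.* p ℤ.+ y ℤ.* q ℤ.* p ≡ + 1 ℤ.+ (x ℤ.+ y ℤ.* q) ℤ.* p
          rhs = IntSolver.solve-∀

    module TwoLayers {J K L g g′ p p′} (pp : Prime p) (pp′ : Prime p′) (top : Layer J K g p) (bottom : Layer K L g′ p′) where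
      private
        module T = Layer top
        module B = Layer bottom

      -- Here c inverts j modulo p′, so c(pu) ≡ g′ modulo L: the multiples of pu already generate K
      -- over L. Thus u alone generates J over L, and its order there is the product of the two
      -- orders.
      merge-with : ∀ {u} → Layer J K u p → ∀ j c d → (+ p) • u ≡ j • g′ mod L → c ℤ.* j ≡ + 1 ℤ.+ d ℤ.* + p′ →
                   Layer J L u (p ℕ.* p′)
      merge-with {u} step j c d w≡jg′ cj≡1+dp′ = record
        { ⊆ = λ m → T.⊆ (B.⊆ m)
        ; g∈ = Layer.g∈ step
        ; cyc = record { multiple∈ = multiple∈′ ; span = span′ }
        ; ord = ord′
        }
        where
        w = (+ p) • u
        cw≡g′ : ∀ b → (b ℤ.* c) • w ≡ b • g′ mod L
        cw≡g′ b = ≡-mod-trans L (≡-mod-• L (b ℤ.* c) w≡jg′) (subst (mem L)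
          (begin
            (b ℤ.* d ℤ.* + p′) • g′ ≡⟨ cong (_• g′) (trans (arith₁ b d (+ p′)) (cong (λ z → b ℤ.* z ℤ.+ ℤ.- b) (sym cj≡1+dp′))) ⟩
            (b ℤ.* (c ℤ.* j) ℤ.+ ℤ.- b) • g′ ≡⟨ cong (_• g′) (arith₂ b c j) ⟩
            ((b ℤ.* c) ℤ.* j ℤ.+ ℤ.- b) • g′ ≡⟨ •-distrib-+ ((b ℤ.* c) ℤ.* j) (ℤ.- b) g′ ⟩
            ((b ℤ.* c) ℤ.* j) • g′ ⊕ (ℤ.- b) • g′ ≡⟨ cong₂ _⊕_ (•-assoc (b ℤ.* c) j g′) (•-neg b g′) ⟩
            (b ℤ.* c) • (j • g′) ⊕ (⊖ (b • g′)) ∎)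
          (multiple-≡0 L B.multiple∈ (divides (b ℤ.* d) refl)))
          where
          open ≡-Reasoning
          arith₁ : ∀ b d p → b ℤ.* d ℤ.* p ≡ b ℤ.* (+ 1 ℤ.+ d ℤ.* p) ℤ.+ ℤ.- b
          arith₁ = IntSolver.solve-∀
          arith₂ : ∀ b c j → b ℤ.* (c ℤ.* j) ℤ.+ ℤ.- b ≡ (b ℤ.* c) ℤ.* j ℤ.+ ℤ.- b
          arith₂ = IntSolver.solve-∀
        multiple∈′ : mem L ((+ (p ℕ.* p′)) • u)
        multiple∈′ =
            subst (mem L)
            (trans (sym (•-assoc (+ p′) (+ p) u)) (cong (_• u) (trans (ℤₚ.*-comm (+ p′) (+ p)) (sym (ℤₚ.pos-* p p′)))))
          (≡-mod-mem L (≡-mod-• L (+ p′) w≡jg′)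
            (subst (mem L)
                (trans (sym (•-assoc j (+ p′) g′)) (trans (cong (_• g′) (ℤₚ.*-comm j (+ p′))) (•-assoc (+ p′) j g′)))
                (•∈ L j B.multiple∈)))
        ord′ : ∀ i → mem L (i • u) → + (p ℕ.* p′) ∣ i
        ord′ i iu∈L with Layer.ord step i (B.⊆ iu∈L)
        ... | divides t refl with B.ord t tg′∈L
          where
          tw∈L : mem L (t • w)
          tw∈L = subst (mem L) (•-assoc t (+ p) u) iu∈L
          tg′∈L : mem L (t • g′)
          tg′∈L = ≡-mod-mem L (≡-mod-sym L (cw≡g′ t))
              (subst (mem L) (trans (sym (•-assoc c t w)) (cong (_• w) (ℤₚ.*-comm c t))) (•∈ L c tw∈L))
        ... | divides s refl = divides s (trans (arith s (+ p′) (+ p)) (cong (s ℤ.*_) (sym (ℤₚ.pos-* p p′))))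
          where
          arith : ∀ s p′ p → s ℤ.* p′ ℤ.* p ≡ s ℤ.* (p ℤ.* p′)
          arith = IntSolver.solve-∀
        span′ : ∀ x → mem J x → ∃ λ i → x ≡ i • u mod L
        span′ x x∈J with Layer.span step x x∈J
        ... | a , e with B.span _ e
        ...   | b , e′ = a ℤ.+ (b ℤ.* c) ℤ.* + p , subst (mem L)
          (begin
            ((x ⊕ (⊖ (a • u))) ⊕ (⊖ (b • g′))) ⊕ (⊖ ((b ℤ.* c) • w ⊕ (⊖ (b • g′))))
              ≡⟨ linear (v₀ :- v₁ :- v₂ :- (v₃ :- v₂)) (v₀ :- (v₁ :+ v₃)) (x ∷ a • u ∷ b • g′ ∷ (b ℤ.* c) • w ∷ []) refl ⟩
            x ⊕ (⊖ (a • u ⊕ (b ℤ.* c) • w))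
              ≡⟨ cong (λ z → x ⊕ (⊖ (a • u ⊕ z))) (sym (•-assoc (b ℤ.* c) (+ p) u)) ⟩
            x ⊕ (⊖ (a • u ⊕ ((b ℤ.* c) ℤ.* + p) • u))
              ≡⟨ cong (λ z → x ⊕ (⊖ z)) (sym (•-distrib-+ a _ u)) ⟩
            x ⊕ (⊖ ((a ℤ.+ (b ℤ.* c) ℤ.* + p) • u)) ∎)
          (⊕∈ L e′ (⊖∈ L (cw≡g′ b)))
          where open ≡-Reasoning

      merge : ∀ {u} → Layer J K u p → ¬ mem L ((+ p) • u) → Layer J L u (p ℕ.* p′)
      merge {u} step pu∉L with B.span ((+ p) • u) (Layer.multiple∈ step)
      ... | j , e with prime-inverse pp′ j (λ d → pu∉L (≡-mod-mem L e (multiple-≡0 L B.multiple∈ d)))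
      ...   | c , d , cj≡1+dp′ = merge-with step j c d e cj≡1+dp′

      -- Meant for pg ∈ L and pg′ ∉ L: modulo K the generator is unchanged, but p(g + g′) ≡ pg′
      -- modulo L no longer lies in L.
      shift-generator : Layer J K (g ⊕ g′) p
      shift-generator = record
        { ⊆ = T.⊆
        ; g∈ = ⊕∈ J T.g∈ (T.⊆ B.g∈)
        ; cyc = record
          { multiple∈ = ≡-mod-mem K (shifted (+ p)) T.multiple∈
          ; span = λ x x∈J → let i , e = T.span x x∈J in i , ≡-mod-trans K e (≡-mod-sym K (shifted i)) }
        ; ord = λ i m → T.ord i (≡-mod-mem K (≡-mod-sym K (shifted i)) m)
        }
        where
        shifted : ∀ i → i • (g ⊕ g′) ≡ i • g mod K
        shifted i = subst (mem K)
            (trans (linear v₁ (v₀ :+ v₁ :- v₀) (i • g ∷ i • g′ ∷ []) refl)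
            (cong (_⊕ (⊖ (i • g))) (sym (•-distrib-⊕ i g g′)))) (•∈ K i B.g∈)

      -- If pg or pg′ lies outside L, then g or g + g′ generates J over L. Otherwise p kills g′
      -- modulo L, so p′ divides p, and the two primes agree.
      elementary-or-cyclic : (p ≡ p′ × mem L ((+ p) • g)) ⊎ ∃ λ u → Layer J L u (p ℕ.* p′)
      elementary-or-cyclic with dec L ((+ p) • g)
      ... | no pg∉L = inj₂ (g , merge top pg∉L)
      ... | yes pg∈L with dec L ((+ p) • g′)
      ...   | no pg′∉L = inj₂ (g ⊕ g′ , merge shift-generator λ m → pg′∉L
                (subst (mem L)
                    (trans (cong (_⊕ (⊖ ((+ p) • g))) (•-distrib-⊕ (+ p) g g′))
                    (linear (v₀ :+ v₁ :- v₀) v₁ ((+ p) • g ∷ (+ p) • g′ ∷ []) refl))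
                  (⊕∈ L m (⊖∈ L pg∈L))))
      ...   | yes pg′∈L with prime⇒irreducible pp (ℤ.∣⇒∣ᵤ (B.ord (+ p) pg′∈L))
      ...     | inj₂ p′≡p = inj₁ (sym p′≡p , pg∈L)
      ...     | inj₁ refl = ⊥-elim (¬prime[1] pp′)

-- Packings along towers of odd order

module PackingsOfOddTowers where
  open CyclicDesigns
  open IntegerModules
  open ZeroSumPackings
  open SubgroupLayers
  open import Data.Nat as ℕ using (ℕ; zero; suc; z≤n; s≤s)
  import Data.Nat.Properties as ℕₚ
  import Data.Nat.Tactic.RingSolver as NatSolver
  import Data.Nat.Divisibility as ℕᵈ
  open import Data.Nat.DivMod using (_divMod_; result)
  open import Data.Nat.Primality using (Prime; prime⇒nonZero; prime⇒irreducible)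
  open import Data.Integer as ℤ using (ℤ; +_)
  import Data.Integer.Properties as ℤₚ
  open import Data.Integer.Divisibility.Signed as ℤ using (_∣_; divides)
  import Data.Integer.Tactic.RingSolver as IntSolver
  open import Data.Fin using (zero; suc)
  open import Data.Vec using ([]; _∷_)
  open import Data.List using (List; []; _∷_; length; cartesianProductWith; upTo)
  open import Data.List.Properties using (length-upTo)
  open import Data.List.Relation.Unary.All using ([]; _∷_)
  open import Data.List.Relation.Unary.AllPairs using ([]; _∷_)
  open import Data.List.Relation.Unary.Any using (here)
  open import Data.List.Membership.Propositional using (_∈_)
  open import Data.List.Membership.Propositional.Properties using (∈-cartesianProductWith⁺; ∈-applyUpTo⁺)
  open import Data.Product using (∃; _×_; _,_)
  open import Data.Sum using (_⊎_; inj₁; inj₂)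
  open import Data.Empty using (⊥-elim)
  open import Relation.Binary.PropositionalEquality
  open import Relation.Nullary using (¬_; Dec; yes; no)
  open import Algebra.Structures using (IsAbelianGroup)

  even-or-odd : ∀ k → ∃ λ h → k ≡ h ℕ.+ h ⊎ k ≡ suc (h ℕ.+ h)
  even-or-odd zero = 0 , inj₁ refl
  even-or-odd (suc k) with even-or-odd k
  ... | h , inj₁ refl = h , inj₂ refl
  ... | h , inj₂ refl = suc h , inj₁ (cong suc (sym (ℕₚ.+-suc h h)))

  odd-half : ∀ {k} → ¬ (2 ℕᵈ.∣ k) → ∃ λ h → k ≡ suc (h ℕ.+ h)
  odd-half {k} odd with even-or-odd k
  ... | h , inj₁ refl = ⊥-elim (odd (ℕᵈ.divides h (trans (cong (h ℕ.+_) (sym (ℕₚ.+-identityʳ h))) (ℕₚ.*-comm 2 h))))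
  ... | h , inj₂ e = h , e

  module OddTowers {C : Set} {_⊕_ : C → C → C} {𝟘 : C} {⊖_ : C → C}
                (isAbelianGroup : IsAbelianGroup _≡_ _⊕_ 𝟘 ⊖_) where

    open IntegerModule isAbelianGroup
    open Packings isAbelianGroup
    open Towers isAbelianGroup
    open Subgroup

    -- The subgroup generated by L and v. It is decidable because pv ∈ L leaves only the multiples
    -- rv with r < p to be tried.
    adjoin : ∀ L v p .{{_ : ℕ.NonZero p}} → mem L ((+ p) • v) → Subgroup
    adjoin L v p pv∈L = record
      { mem = λ x → ∃ λ (i : ℤ) → x ≡ i • v mod L
      ; dec = dec′
      ; 𝟘∈ = + 0 , ⊕∈ L (𝟘∈ L) (⊖∈ L (𝟘∈ L))
      ; ⊕∈ = λ {x} {y} (i , a) (j , b) → i ℤ.+ j , subst (mem L)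
          (trans (linear (v₀ :- v₁ :+ (v₂ :- v₃)) (v₀ :+ v₂ :- (v₁ :+ v₃)) (x ∷ i • v ∷ y ∷ j • v ∷ []) refl)
            (cong (λ z → (x ⊕ y) ⊕ (⊖ z)) (sym (•-distrib-+ i j v))))
          (⊕∈ L a b)
      ; ⊖∈ = λ {x} (i , a) → ℤ.- i , subst (mem L)
          (trans (linear (:- (v₀ :- v₁)) (:- v₀ :- (:- v₁)) (x ∷ i • v ∷ []) refl) (cong (λ z → (⊖ x) ⊕ (⊖ z)) (sym (•-neg i v))))
          (⊖∈ L a)
      }
      where
      dec′ : ∀ x → Dec (∃ λ (i : ℤ) → x ≡ i • v mod L)
      dec′ x with ℕₚ.anyUpTo? (λ r → dec L (x ⊕ (⊖ ((+ r) • v)))) p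
      ... | yes (r , _ , e) = yes (+ r , e)
      ... | no none = no λ (i , e) → none (remainder-mod L p pv∈L i e)

    adjoin-layer : ∀ L v p .{{_ : ℕ.NonZero p}} (pv∈L : mem L ((+ p) • v)) → (∀ i → mem L (i • v) → + p ∣ i) →
                   Layer (adjoin L v p pv∈L) L v p
    adjoin-layer L v p pv∈L ord = record
      { ⊆ = λ {x} m → + 0 , subst (mem L) (linear v₀ (v₀ :- (+ 0) :• v₁) (x ∷ v ∷ []) refl) m
      ; g∈ = + 1 , subst (mem L) (linear :0 (v₀ :- (+ 1) :• v₀) (v ∷ []) refl) (𝟘∈ L)
      ; cyc = record { multiple∈ = pv∈L ; span = λ x m → m }
      ; ord = ord
      }

    -- The first number is the order, the second the height. The height is an index because
    -- `packing` also recurses on towers rebuilt by `swap`, which are lower but not subterms.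
    data Tower : Subgroup → ℕ → ℕ → Set₁ where
      trivial : ∀ {K} → (∀ x → mem K x → x ≡ 𝟘) → Tower K 1 0
      layer   : ∀ {J K g p k h} → Prime p → Layer J K g p → Tower K k h → Tower J (p ℕ.* k) (suc h)

    annihilates : ∀ {J k h} → Tower J k h → ∀ x → mem J x → (+ k) • x ≡ 𝟘
    annihilates (trivial z) x m = trans (•-identity x) (z x m)
    annihilates (layer {J} {K} {g} {p} {k} pp l T) x m with Layer.span l x m
    ... | i , κ∈K = begin
      (+ (p ℕ.* k)) • x
        ≡⟨ cong₂ _•_ (trans (cong +_ (ℕₚ.*-comm p k)) (ℤₚ.pos-* k p))
            (linear v₀ (i :• v₁ :+ (v₀ :- i :• v₁)) (x ∷ g ∷ []) (cong₂ _∷_ (arith₀ i) (cong (_∷ []) (arith₁ i)))) ⟩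
      (+ k ℤ.* + p) • (i • g ⊕ κ)
        ≡⟨ •-distrib-⊕ (+ k ℤ.* + p) (i • g) κ ⟩
      (+ k ℤ.* + p) • (i • g) ⊕ (+ k ℤ.* + p) • κ
        ≡⟨ cong₂ _⊕_
            (trans (sym (•-assoc (+ k ℤ.* + p) i g))
            (trans (cong (_• g) (arith₂ (+ k) (+ p) i)) (trans (•-assoc (i ℤ.* + k) (+ p) g) (•-assoc i (+ k) _))))
                     (trans (cong (_• κ) (ℤₚ.*-comm (+ k) (+ p))) (•-assoc (+ p) (+ k) κ)) ⟩
      i • ((+ k) • ((+ p) • g)) ⊕ (+ p) • ((+ k) • κ)
        ≡⟨ cong₂ (λ a b → i • a ⊕ (+ p) • b) (annihilates T _ (Layer.multiple∈ l)) (annihilates T κ κ∈K) ⟩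
      i • 𝟘 ⊕ (+ p) • 𝟘
        ≡⟨ linear {0} (i :• :0 :+ (+ p) :• :0) :0 [] refl ⟩
      𝟘 ∎
      where
      open ≡-Reasoning
      κ = x ⊕ (⊖ (i • g))
      arith₀ : ∀ i → + 1 ≡ i ℤ.* + 0 ℤ.+ (+ 1 ℤ.+ ℤ.- (i ℤ.* + 0))
      arith₀ = IntSolver.solve-∀
      arith₁ : ∀ i → + 0 ≡ i ℤ.* + 1 ℤ.+ (+ 0 ℤ.+ ℤ.- (i ℤ.* + 1))
      arith₁ = IntSolver.solve-∀
      arith₂ : ∀ k p i → k ℤ.* p ℤ.* i ≡ i ℤ.* k ℤ.* p
      arith₂ = IntSolver.solve-∀

    elements : ∀ {J k h} → Tower J k h → List C
    elements (trivial _) = 𝟘 ∷ []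
    elements (layer {g = g} {p} _ _ T) = cartesianProductWith (λ r κ → κ ⊕ (+ r) • g) (upTo p) (elements T)

    length-elements : ∀ {J k h} (T : Tower J k h) → length (elements T) ≡ k
    length-elements (trivial _) = refl
    length-elements (layer {p = p} _ _ T) =
      trans (length-cartesianProductWith _ (upTo p) (elements T)) (cong₂ ℕ._*_ (length-upTo p) (length-elements T))

    ∈-elements : ∀ {J k h} (T : Tower J k h) x → mem J x → x ∈ elements T
    ∈-elements (trivial z) x m = here (z x m)
    ∈-elements (layer {g = g} {p} pp l T) x m =
      let instance p≢0 = prime⇒nonZero pp
          r , r<p , κ∈K = Layer.remainder l x m
          e = linear v₀ (v₀ :- v₁ :+ v₁) (x ∷ (+ r) • g ∷ []) refl
      in subst (_∈ _) (sym e) (∈-cartesianProductWith⁺ (λ r κ → κ ⊕ (+ r) • g) (∈-applyUpTo⁺ _ r<p) (∈-elements T _ κ∈K))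

    finite : ∀ {J k h} → Tower J k h → ¬ (2 ℕᵈ.∣ k) → Finite J k
    finite {J} {k} T odd with odd-half odd
    ... | h , k≡ = record
      { elements = elements T
      ; count = length-elements T
      ; complete = ∈-elements T
      -- k = 2h + 1 annihilates x, hence x = -hx - hx.
      ; halve = λ x m → (ℤ.- + h) • x , •∈ J (ℤ.- + h) m ,
          (begin
            x ≡⟨ linear v₀ (v₀ :- :0) (x ∷ []) refl ⟩
            x ⊕ (⊖ 𝟘) ≡⟨ cong (λ z → x ⊕ (⊖ z)) (sym (trans (cong (λ k → (+ k) • x) (sym k≡)) (annihilates T x m))) ⟩
            x ⊕ (⊖ ((+ suc (h ℕ.+ h)) • x)) ≡⟨ cong (λ i → x ⊕ (⊖ (i • x)))
                (trans (ℤₚ.pos-+ 1 (h ℕ.+ h)) (cong (λ z → + 1 ℤ.+ z) (ℤₚ.pos-+ h h))) ⟩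
            x ⊕ (⊖ ((+ 1 ℤ.+ (+ h ℤ.+ + h)) • x)) ≡⟨ linear (v₀ :- (+ 1 ℤ.+ (+ h ℤ.+ + h)) :• v₀)
                ((ℤ.- + h) :• v₀ :+ (ℤ.- + h) :• v₀) (x ∷ []) (cong (_∷ []) (arith (+ h))) ⟩
            (ℤ.- + h) • x ⊕ (ℤ.- + h) • x ∎)
      }
      where
      open ≡-Reasoning
      arith : ∀ h → + 1 ℤ.+ ℤ.- ((+ 1 ℤ.+ (h ℤ.+ h)) ℤ.* + 1) ≡ ℤ.- h ℤ.* + 1 ℤ.+ ℤ.- h ℤ.* + 1
      arith = IntSolver.solve-∀

    data Residue₆ : ℕ → Set where
      even : ∀ {p} → 2 ℕᵈ.∣ p → Residue₆ p
      1+6_ : ∀ τ → Residue₆ (1 ℕ.+ 6 ℕ.* τ)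
      3∣   : ∀ {p} → 3 ℕᵈ.∣ p → Residue₆ p
      5+6_ : ∀ τ → Residue₆ (5 ℕ.+ 6 ℕ.* τ)

    residue₆ : ∀ p → Residue₆ p
    residue₆ p with p divMod 6
    ... | result q zero refl = even (ℕᵈ.∣n⇒∣m*n q {n = 6} (ℕᵈ.divides 3 refl))
    ... | result q (suc zero) refl = subst (λ n → Residue₆ (1 ℕ.+ n)) (ℕₚ.*-comm 6 q) (1+6 q)
    ... | result q (suc (suc zero)) refl =
        even (ℕᵈ.∣m∣n⇒∣m+n {m = 2} {n = q ℕ.* 6} (ℕᵈ.divides 1 refl) (ℕᵈ.∣n⇒∣m*n q {n = 6} (ℕᵈ.divides 3 refl)))
    ... | result q (suc (suc (suc zero))) refl =
        3∣ (ℕᵈ.∣m∣n⇒∣m+n {m = 3} {n = q ℕ.* 6} (ℕᵈ.divides 1 refl) (ℕᵈ.∣n⇒∣m*n q {n = 6} (ℕᵈ.divides 2 refl)))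
    ... | result q (suc (suc (suc (suc zero)))) refl =
        even (ℕᵈ.∣m∣n⇒∣m+n {m = 4} {n = q ℕ.* 6} (ℕᵈ.divides 2 refl) (ℕᵈ.∣n⇒∣m*n q {n = 6} (ℕᵈ.divides 3 refl)))
    ... | result q (suc (suc (suc (suc (suc zero))))) refl = subst (λ n → Residue₆ (5 ℕ.+ n)) (ℕₚ.*-comm 6 q) (5+6 q)

    prime∣3 : ∀ {p} → Prime p → 3 ℕᵈ.∣ p → p ≡ 3
    prime∣3 pp 3∣p with prime⇒irreducible pp 3∣p
    ... | inj₂ e = sym e

    cyclic-quotient : ∀ {J K g m} τ → m ≡ 1 ℕ.+ 6 ℕ.* τ → Cyclic J K g m → QuotientPacking J K m
    cyclic-quotient τ refl c = FromDesign.quotient-packing c (PerfectDesign.design D) (PerfectDesign.perfect D)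
      where D = cyclicDesign₁ τ

    -- In the cyclic quotient J/L of order pp′ the multiple v = p′u has order p, so the subgroup K
    -- generated by L and v has index p′ in J: the order of the two indices can be chosen.
    swap : ∀ {J L u p p′ k h} → Prime p → Prime p′ → Layer J L u (p ℕ.* p′) → Tower L k h →
           ∃ λ K → Cyclic J K u p′ × Tower K (p ℕ.* k) (suc h)
    swap {J} {L} {u} {p} {p′} pp pp′ l T =
      adjoin L v p pv∈L ,
      record
        { multiple∈ = Layer.g∈ below
        ; span = λ x m → let i , e = Layer.span l x m in i , Layer.⊆ below e } ,
      layer pp below T
      where
      instance
        p≢0 = prime⇒nonZero pp
        p′≢0 = prime⇒nonZero pp′
      v = (+ p′) • u
      pv∈L : mem L ((+ p) • v)
      pv∈L = subst (mem L) (trans (cong (_• u) (ℤₚ.pos-* p p′)) (•-assoc (+ p) (+ p′) u)) (Layer.multiple∈ l)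
      below : Layer (adjoin L v p pv∈L) L v p
      below = adjoin-layer L v p pv∈L λ i m →
        ℤ.*-cancelʳ-∣ (+ p′) (subst (_∣ i ℤ.* + p′) (ℤₚ.pos-* p p′) (Layer.ord l (i ℤ.* + p′) (subst (mem L) (sym (•-assoc i (+ p′) u)) m)))

    module _ (τ : ℕ) where
      private
        p = 5 ℕ.+ 6 ℕ.* τ
        pos-p : + p ≡ + 5 ℤ.+ + 6 ℤ.* + τ
        pos-p = trans (ℤₚ.pos-+ 5 (6 ℕ.* τ)) (cong (λ z → + 5 ℤ.+ z) (ℤₚ.pos-* 6 τ))

      -- Explicit Bézout coefficients for p = 5 + 6τ: p - (2 + 3τ)·2 = 1 here, and (2 + 2τ)·3 - p =
      -- 1 in `3-cancel`.
      2-cancel : ∀ a → + p ∣ + 2 ℤ.* a → + p ∣ a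
      2-cancel a d = subst (+ p ∣_) (trans (cong (λ p → p ℤ.* a ℤ.- (+ 2 ℤ.+ + 3 ℤ.* + τ) ℤ.* (+ 2 ℤ.* a)) pos-p) (arith (+ τ) a))
        (ℤ.∣m∣n⇒∣m-n (ℤ.∣m⇒∣m*n a (divides (+ 1) (sym (ℤₚ.*-identityˡ (+ p))))) (ℤ.∣n⇒∣m*n (+ 2 ℤ.+ + 3 ℤ.* + τ) d))
        where
        arith : ∀ τ a → (+ 5 ℤ.+ + 6 ℤ.* τ) ℤ.* a ℤ.- (+ 2 ℤ.+ + 3 ℤ.* τ) ℤ.* (+ 2 ℤ.* a) ≡ a
        arith = IntSolver.solve-∀

      3-cancel : ∀ a → + p ∣ + 3 ℤ.* a → + p ∣ a
      3-cancel a d = subst (+ p ∣_) (trans (cong (λ p → (+ 2 ℤ.+ + 2 ℤ.* + τ) ℤ.* (+ 3 ℤ.* a) ℤ.- p ℤ.* a) pos-p) (arith (+ τ) a))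
        (ℤ.∣m∣n⇒∣m-n (ℤ.∣n⇒∣m*n (+ 2 ℤ.+ + 2 ℤ.* + τ) d) (ℤ.∣m⇒∣m*n a (divides (+ 1) (sym (ℤₚ.*-identityˡ (+ p))))))
        where
        arith : ∀ τ a → (+ 2 ℤ.+ + 2 ℤ.* τ) ℤ.* (+ 3 ℤ.* a) ℤ.- (+ 5 ℤ.+ + 6 ℤ.* τ) ℤ.* a ≡ a
        arith = IntSolver.solve-∀

    Packs : ℕ → Set₁
    Packs h = ∀ {J k} → Tower J k h → ¬ (2 ℕᵈ.∣ k) → Packing J k

    -- Layers of orders p = 5 and p′ = 1 or 3 mod 6 with cyclic quotient are swapped, so that p′ comes on top.
    cyclic-two-layers : ∀ {J L u k} τ {p′ h} → Packs (suc h) → Packs h → Prime (5 ℕ.+ 6 ℕ.* τ) → Prime p′ →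
                 Layer J L u ((5 ℕ.+ 6 ℕ.* τ) ℕ.* p′) → Tower L k h →
                 ¬ (2 ℕᵈ.∣ (5 ℕ.+ 6 ℕ.* τ) ℕ.* (p′ ℕ.* k)) → Packing J ((5 ℕ.+ 6 ℕ.* τ) ℕ.* (p′ ℕ.* k))
    cyclic-two-layers {k = k} τ {p′} rec₁ rec₀ pp pp′ l T odd with residue₆ p′
    ... | even 2∣p′ = ⊥-elim (odd (ℕᵈ.∣n⇒∣m*n (5 ℕ.+ 6 ℕ.* τ) (ℕᵈ.∣m⇒∣m*n k 2∣p′)))
    ... | 5+6 τ′ = subst (Packing _) (ℕₚ.*-assoc (5 ℕ.+ 6 ℕ.* τ) p′ k)
      (extend-packing (cyclic-quotient (4 ℕ.+ 5 ℕ.* τ ℕ.+ 5 ℕ.* τ′ ℕ.+ 6 ℕ.* τ ℕ.* τ′) (arith τ τ′) (Layer.cyc l))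
          (finite T odd′) (rec₀ T odd′))
      where
      odd′ = λ d → odd (ℕᵈ.∣n⇒∣m*n (5 ℕ.+ 6 ℕ.* τ) (ℕᵈ.∣n⇒∣m*n p′ d))
      arith : ∀ τ τ′ → (5 ℕ.+ 6 ℕ.* τ) ℕ.* (5 ℕ.+ 6 ℕ.* τ′) ≡ 1 ℕ.+ 6 ℕ.* (4 ℕ.+ 5 ℕ.* τ ℕ.+ 5 ℕ.* τ′ ℕ.+ 6 ℕ.* τ ℕ.* τ′)
      arith = NatSolver.solve-∀
    ... | 1+6 τ′ with swap pp pp′ l T
    ...   | K , c , T′ =
        subst (Packing _) (arith p′ (5 ℕ.+ 6 ℕ.* τ) k)
        (extend-packing (cyclic-quotient τ′ refl c) (finite T′ odd′) (rec₁ T′ odd′))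
      where
      arith : ∀ a b c → a ℕ.* (b ℕ.* c) ≡ b ℕ.* (a ℕ.* c)
      arith = NatSolver.solve-∀
      odd′ = λ d → odd (subst (2 ℕᵈ.∣_) (arith p′ (5 ℕ.+ 6 ℕ.* τ) k) (ℕᵈ.∣n⇒∣m*n p′ d))
    cyclic-two-layers {k = k} τ {p′} rec₁ rec₀ pp pp′ l T odd | 3∣ 3∣p′ with prime∣3 pp′ 3∣p′
    ... | refl with swap pp pp′ l T
    ...   | K , c , T′ = subst (Packing _) (arith 3 (5 ℕ.+ 6 ℕ.* τ) k) (triple-packing c (finite T′ odd′) (rec₁ T′ odd′))
      where
      arith : ∀ a b c → a ℕ.* (b ℕ.* c) ≡ b ℕ.* (a ℕ.* c)
      arith = NatSolver.solve-∀
      odd′ = λ d → odd (subst (2 ℕᵈ.∣_) (arith 3 (5 ℕ.+ 6 ℕ.* τ) k) (ℕᵈ.∣n⇒∣m*n 3 d))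

    two-layers : ∀ {J K L g g′ k} τ {p′ h} → Packs (suc h) → Packs h → Prime (5 ℕ.+ 6 ℕ.* τ) → Prime p′ →
                 Layer J K g (5 ℕ.+ 6 ℕ.* τ) → Layer K L g′ p′ → Tower L k h →
                 ¬ (2 ℕᵈ.∣ (5 ℕ.+ 6 ℕ.* τ) ℕ.* (p′ ℕ.* k)) → Packing J ((5 ℕ.+ 6 ℕ.* τ) ℕ.* (p′ ℕ.* k))
    two-layers {k = k} τ {p′} rec₁ rec₀ pp pp′ l l′ T odd with TwoLayers.elementary-or-cyclic pp pp′ l l′
    ... | inj₁ (refl , pg∈L) = subst (Packing _) (ℕₚ.*-assoc p′ p′ k)
      (extend-packing (hexagonal (2-cancel τ) (3-cancel τ) l l′ pg∈L) (finite T odd′) (rec₀ T odd′))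
      where odd′ = λ d → odd (ℕᵈ.∣n⇒∣m*n p′ (ℕᵈ.∣n⇒∣m*n p′ d))
    ... | inj₂ (u , l″) = cyclic-two-layers τ rec₁ rec₀ pp pp′ l″ T odd

    -- The bound on the pairs survives every step: lifting keeps the pairs of the smaller subgroup,
    -- index 3 absorbs them into a half-system and leaves one new pair, and index 5 mod 6
    -- contributes its two pairs only when nothing but the trivial subgroup lies below.
    packing : ∀ h → Packs h
    packing zero (trivial z) odd = record
      { triples = [] ; pairs = [] ; few = z≤n ; size = s≤s z≤n ; covers = λ x m → inj₁ (z x m) }
    packing (suc h) (layer {p = p} {k} pp l T) odd with residue₆ p
    ... | even 2∣p = ⊥-elim (odd (ℕᵈ.∣m⇒∣m*n k 2∣p))
    ... | 1+6 τ = extend-packing (cyclic-quotient τ refl (Layer.cyc l)) (finite T odd′) (packing h T odd′)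
      where odd′ = λ d → odd (ℕᵈ.∣n⇒∣m*n p d)
    ... | 3∣ 3∣p with prime∣3 pp 3∣p
    ...   | refl = triple-packing (Layer.cyc l) (finite T odd′) (packing h T odd′)
      where odd′ = λ d → odd (ℕᵈ.∣n⇒∣m*n 3 d)
    packing (suc zero) (layer pp l (trivial z)) odd | 5+6 τ =
      subst (Packing _) (sym (ℕₚ.*-identityʳ _)) (FromDesign.packing (Layer.cyc l) (cyclicDesign₅ τ) z)
    packing (suc (suc h)) (layer pp l (layer pp′ l′ T)) odd | 5+6 τ = two-layers τ (packing (suc h)) (packing h) pp pp′ l l′ T odd

-- Towers exhausting a finite abelian group

module FiniteGroups where
  open IntegerModules
  open ZeroSumPackings
  open FiniteLists
  open SubgroupLayers
  open PackingsOfOddTowers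
  open import Data.Nat as ℕ using (ℕ; zero; suc; z≤n; s≤s)
  import Data.Nat.Properties as ℕₚ
  import Data.Nat.Divisibility as ℕᵈ
  open import Data.Nat.Primality using (Prime; prime⇒nonZero; prime⇒nonTrivial)
  open import Data.Nat.Primality.Factorisation using (factorise)
  open import Data.Integer as ℤ using (ℤ; +_)
  import Data.Integer.Properties as ℤₚ
  import Data.Integer.DivMod as ℤ
  open import Data.Integer.Divisibility.Signed as ℤ using (_∣_; divides)
  import Data.Integer.Tactic.RingSolver as IntSolver
  open import Data.Fin as Fin using (Fin; zero; suc; toℕ; remQuot)
  import Data.Fin.Properties as Finₚ
  open import Data.Vec using ([]; _∷_)
  open import Data.List using ([]; _∷_)
  open import Data.List.Relation.Unary.All using ([]; _∷_)
  open import Data.Product using (∃; ∃₂; _×_; _,_; proj₁; proj₂)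
  open import Data.Sum using (inj₁; inj₂)
  open import Data.Empty using (⊥-elim)
  open import Relation.Binary.PropositionalEquality
  open import Relation.Nullary using (¬_; yes; no)
  open import Relation.Unary using (Decidable)
  open import Algebra.Structures using (IsAbelianGroup)

  least : ∀ {P : ℕ → Set} → Decidable P → ∀ n → P n → ∃ λ m → P m × (∀ i → i ℕ.< m → ¬ P i)
  least P? zero pz = 0 , pz , λ _ ()
  least P? (suc n) pn with P? 0
  ... | yes p0 = 0 , p0 , λ _ ()
  ... | no ¬p0 with least (λ i → P? (suc i)) n pn
  ...   | m , pm , below = suc m , pm , λ { zero _ → ¬p0 ; (suc i) (s≤s l) → below i l }

  ∣-difference≥⇒≡ : ∀ {m a b} → a ℕ.≤ b → b ℕ.< m → + m ∣ + b ℤ.- + a → a ≡ b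
  ∣-difference≥⇒≡ {m} {a} {b} a≤b b<m d with b ℕ.∸ a in eq | ℤ.∣⇒∣ᵤ (subst (+ m ∣_) (trans (ℤₚ.m-n≡m⊖n b a) (ℤₚ.⊖-≥ a≤b)) d)
  ... | zero  | _  = ℕₚ.≤-antisym a≤b (ℕₚ.m∸n≡0⇒m≤n eq)
  ... | suc k | m∣ = ⊥-elim (ℕₚ.<⇒≱ b<m (ℕₚ.≤-trans (ℕᵈ.∣⇒≤ m∣) (subst (ℕ._≤ b) eq (ℕₚ.m∸n≤m b a))))

  ∣-difference⇒≡ : ∀ {m r r′} → r ℕ.< m → r′ ℕ.< m → + m ∣ + r ℤ.- + r′ → r ≡ r′
  ∣-difference⇒≡ {m} {r} {r′} r<m r′<m d with ℕₚ.≤-total r′ r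
  ... | inj₁ r′≤r = sym (∣-difference≥⇒≡ r′≤r r<m d)
  ... | inj₂ r≤r′ = ∣-difference≥⇒≡ r≤r′ r′<m (subst (+ m ∣_) (arith (+ r) (+ r′)) (ℤ.∣m⇒∣-m d))
    where
    arith : ∀ r r′ → ℤ.- (r ℤ.- r′) ≡ r′ ℤ.- r
    arith = IntSolver.solve-∀

  prime-factor : ∀ m → m ≢ 0 → m ≢ 1 → ∃ λ p → Prime p × p ℕᵈ.∣ m
  prime-factor zero m≢0 _ = ⊥-elim (m≢0 refl)
  prime-factor (suc m) _ m≢1 with factorise (suc m)
  ... | record { factors = [] ; isFactorisation = e } = ⊥-elim (m≢1 e)
  ... | record { factors = p ∷ ps ; isFactorisation = e ; factorsPrime = pp ∷ _ } = p , pp , subst (p ℕᵈ.∣_) (sym e) (ℕᵈ.m∣m*n _)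

  module FiniteGroup {s : ℕ} {_⊕_ : Fin s → Fin s → Fin s} {𝟘 : Fin s} {⊖_ : Fin s → Fin s}
                     (isAbelianGroup : IsAbelianGroup _≡_ _⊕_ 𝟘 ⊖_) where

    open IntegerModule isAbelianGroup
    open Packings isAbelianGroup
    open Towers isAbelianGroup
    open OddTowers isAbelianGroup
    open Subgroup

    enumerate : ∀ {J k h} → Tower J k h → Fin k → Fin s
    enumerate (trivial _) _ = 𝟘
    enumerate (layer {g = g} {p} {k} _ _ T) i = let r , j = remQuot {p} k i in enumerate T j ⊕ (+ toℕ r) • g

    enumerate-∈ : ∀ {J k h} (T : Tower J k h) i → mem J (enumerate T i)
    enumerate-∈ {J} (trivial _) _ = 𝟘∈ J
    enumerate-∈ {J} (layer {p = p} {k} _ l T) i =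
      ⊕∈ J (Layer.⊆ l (enumerate-∈ T _)) (•∈ J (+ toℕ (proj₁ (remQuot {p} k i))) (Layer.g∈ l))

    -- `enumerate` uses mixed-radix digits along the layers. For equal elements the top digits
    -- differ by an i with ig ∈ K, hence by a multiple of p, and both are below p; then the lower
    -- parts agree. The consequence k ≤ s bounds the growth of towers.
    enumerate-injective : ∀ {J k h} (T : Tower J k h) {i j} → enumerate T i ≡ enumerate T j → i ≡ j
    enumerate-injective (trivial _) {zero} {zero} _ = refl
    enumerate-injective (layer {J} {K} {g} {p} {k} _ l T) {i} {j} e = begin
      i ≡⟨ Finₚ.combine-remQuot {p} k i ⟨
      Fin.combine r a ≡⟨ cong₂ Fin.combine r≡r′ (enumerate-injective T a≡a′) ⟩
      Fin.combine r′ a′ ≡⟨ Finₚ.combine-remQuot {p} k j ⟩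
      j ∎
      where
      open ≡-Reasoning
      r = proj₁ (remQuot {p} k i)
      a = proj₂ (remQuot {p} k i)
      r′ = proj₁ (remQuot {p} k j)
      a′ = proj₂ (remQuot {p} k j)
      difference : enumerate T a′ ⊕ (⊖ enumerate T a) ≡ ((+ toℕ r) ℤ.- (+ toℕ r′)) • g
      difference = begin
        enumerate T a′ ⊕ (⊖ enumerate T a)
          ≡⟨ linear (v₀ :- v₁) (v₀ :+ v₂ :- v₁ :- v₂) (enumerate T a′ ∷ enumerate T a ∷ (+ toℕ r′) • g ∷ []) refl ⟩
        ((enumerate T a′ ⊕ (+ toℕ r′) • g) ⊕ (⊖ enumerate T a)) ⊕ (⊖ ((+ toℕ r′) • g))
          ≡⟨ cong (λ z → (z ⊕ (⊖ enumerate T a)) ⊕ (⊖ ((+ toℕ r′) • g))) (sym e) ⟩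
        ((enumerate T a ⊕ (+ toℕ r) • g) ⊕ (⊖ enumerate T a)) ⊕ (⊖ ((+ toℕ r′) • g))
          ≡⟨ linear (v₀ :+ v₁ :- v₀ :- v₂) (v₁ :- v₂) (enumerate T a ∷ (+ toℕ r) • g ∷ (+ toℕ r′) • g ∷ []) refl ⟩
        (+ toℕ r) • g ⊕ (⊖ ((+ toℕ r′) • g))
          ≡⟨ cong ((+ toℕ r) • g ⊕_) (sym (•-neg (+ toℕ r′) g)) ⟩
        (+ toℕ r) • g ⊕ (ℤ.- (+ toℕ r′)) • g
          ≡⟨ •-distrib-+ (+ toℕ r) (ℤ.- (+ toℕ r′)) g ⟨
        ((+ toℕ r) ℤ.- (+ toℕ r′)) • g ∎
      r≡r′ : r ≡ r′
      r≡r′ = Finₚ.toℕ-injective (∣-difference⇒≡ (Finₚ.toℕ<n r) (Finₚ.toℕ<n r′)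
        (Layer.ord l _ (subst (mem K) difference (⊕∈ K (enumerate-∈ T a′) (⊖∈ K (enumerate-∈ T a))))))
      a≡a′ : enumerate T a ≡ enumerate T a′
      a≡a′ = begin
        enumerate T a ≡⟨ linear v₀ (v₀ :+ v₁ :- v₁) (enumerate T a ∷ (+ toℕ r) • g ∷ []) refl ⟩
        (enumerate T a ⊕ (+ toℕ r) • g) ⊕ (⊖ ((+ toℕ r) • g)) ≡⟨ cong₂ (λ y q → y ⊕ (⊖ ((+ toℕ q) • g))) e r≡r′ ⟩
        (enumerate T a′ ⊕ (+ toℕ r′) • g) ⊕ (⊖ ((+ toℕ r′) • g)) ≡⟨ linear (v₀ :+ v₁ :- v₁) v₀ (enumerate T a′ ∷ (+ toℕ r′) • g ∷ []) refl ⟩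
        enumerate T a′ ∎

    order≤ : ∀ {J k h} → Tower J k h → k ℕ.≤ s
    order≤ T = Finₚ.injective⇒≤ (enumerate-injective T)

    multiple-in : ∀ K x → ∃ λ m → mem K ((+ suc m) • x)
    multiple-in K x with Finₚ.pigeonhole (ℕₚ.n<1+n s) (λ i → (+ toℕ i) • x)
    ... | i , j , i<j , e = toℕ j ℕ.∸ suc (toℕ i) , subst (mem K) (sym zero-multiple) (𝟘∈ K)
      where
      open ≡-Reasoning
      i+1+ : toℕ i ℕ.+ suc (toℕ j ℕ.∸ suc (toℕ i)) ≡ toℕ j
      i+1+ = trans (ℕₚ.+-suc (toℕ i) _) (ℕₚ.m+[n∸m]≡n i<j)
      d = toℕ j ℕ.∸ suc (toℕ i)
      zero-multiple : (+ suc d) • x ≡ 𝟘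
      zero-multiple = begin
        (+ suc d) • x ≡⟨ linear v₁ (v₀ :+ v₁ :- v₀) ((+ toℕ i) • x ∷ (+ suc d) • x ∷ []) refl ⟩
        ((+ toℕ i) • x ⊕ (+ suc d) • x) ⊕ (⊖ ((+ toℕ i) • x))
          ≡⟨ cong (_⊕ (⊖ ((+ toℕ i) • x))) (trans (sym (•-distrib-+ (+ toℕ i) (+ suc d) x)) (trans (cong (λ n → (+ n) • x) i+1+) (sym e))) ⟩
        (+ toℕ i) • x ⊕ (⊖ ((+ toℕ i) • x)) ≡⟨ linear (v₀ :- v₀) :0 ((+ toℕ i) • x ∷ []) refl ⟩
        𝟘 ∎

    -- Cauchy's argument in J/K: if x has order o = dp modulo K with p prime, then dx has order p.
    -- Here o is found as the least positive number with ox ∈ K, and minimality makes it divide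
    -- every i with ix ∈ K.
    extend : ∀ {K k h} → Tower K k h → ∀ x → ¬ mem K x → ∃ λ J → ∃ λ p → Prime p × Tower J (p ℕ.* k) (suc h)
    extend {K} {k} T x x∉K with multiple-in K x
    ... | n , nx∈K with least (λ m → dec K ((+ suc m) • x)) n nx∈K
    ...   | o′ , ox∈K , below with prime-factor (suc o′) (λ ()) o≢1
      where
      o≢1 : suc o′ ≢ 1
      o≢1 refl = x∉K (subst (mem K) (•-identity x) ox∈K)
    ...     | p , pp , ℕᵈ.divides zero ()
    ...     | p , pp , ℕᵈ.divides (suc d) o≡dp = adjoin K g p pg∈K , p , pp , layer pp (adjoin-layer K g p pg∈K ord) T
      where
      instance p≢0 = prime⇒nonZero pp
      g = (+ suc d) • x
      o = suc o′
      pg∈K : mem K ((+ p) • g)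
      pg∈K = subst (mem K)
          (trans (cong (_• x) (trans (cong +_ (trans o≡dp (ℕₚ.*-comm (suc d) p))) (ℤₚ.pos-* p (suc d))))
          (•-assoc (+ p) (+ suc d) x)) ox∈K
      o∣ : ∀ i → mem K (i • x) → + o ∣ i
      o∣ i ix∈K with i ℤ.%ℕ o in eq | ℤ.n%ℕd<d i o | ℤ.a≡a%ℕn+[a/ℕn]*n i o
      ... | zero | _ | i≡ = divides (i ℤ./ℕ o) (trans i≡ (ℤₚ.+-identityˡ _))
      ... | suc r | s≤s r<o | i≡ = ⊥-elim (below r r<o (subst (mem K) r≡ (⊕∈ K ix∈K (⊖∈ K (•∈ K q ox∈K)))))
        where
        open ≡-Reasoning
        q = i ℤ./ℕ o
        arith : ∀ r t → r ℤ.+ t ℤ.+ ℤ.- t ≡ r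
        arith = IntSolver.solve-∀
        r≡ : i • x ⊕ (⊖ (q • ((+ o) • x))) ≡ (+ suc r) • x
        r≡ = begin
          i • x ⊕ (⊖ (q • ((+ o) • x))) ≡⟨ cong (λ z → i • x ⊕ (⊖ z)) (sym (•-assoc q (+ o) x)) ⟩
          i • x ⊕ (⊖ ((q ℤ.* + o) • x)) ≡⟨ cong (i • x ⊕_) (sym (•-neg (q ℤ.* + o) x)) ⟩
          i • x ⊕ (ℤ.- (q ℤ.* + o)) • x ≡⟨ •-distrib-+ i _ x ⟨
          (i ℤ.+ ℤ.- (q ℤ.* + o)) • x ≡⟨ cong (_• x) (trans (cong (ℤ._+ ℤ.- (q ℤ.* + o)) i≡) (arith (+ suc r) (q ℤ.* + o))) ⟩
          (+ suc r) • x ∎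
      ord : ∀ i → mem K (i • g) → + p ∣ i
      ord i m = ℤ.*-cancelʳ-∣ (+ suc d) (subst (_∣ i ℤ.* + suc d) (trans (cong +_ (trans o≡dp (ℕₚ.*-comm (suc d) p))) (ℤₚ.pos-* p (suc d)))
        (o∣ (i ℤ.* + suc d) (subst (mem K) (sym (•-assoc i (+ suc d) x)) m)))

    order>0 : ∀ {J k h} → Tower J k h → 0 ℕ.< k
    order>0 (trivial _)    = s≤s z≤n
    order>0 (layer pp _ T) = ℕₚ.*-mono-≤ (ℕ.>-nonZero⁻¹ _ {{prime⇒nonZero pp}}) (order>0 T)

    order-grows : ∀ {J k h p} → Prime p → Tower J k h → k ℕ.< p ℕ.* k
    order-grows {k = k} {p = p} pp T = subst (k ℕ.<_) (ℕₚ.*-comm k p)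
      (ℕₚ.m<m*n k p {{ℕ.>-nonZero (order>0 T)}} (ℕ.nonTrivial⇒n>1 p {{prime⇒nonTrivial pp}}))

    -- Each extension raises the order k, and k never exceeds s, so the invariant s ≤ k + fuel
    -- forces the tower to be everything by the time the fuel is spent.
    grow : ∀ fuel {K k h} → Tower K k h → s ℕ.≤ k ℕ.+ fuel → ∃ λ J → ∃₂ λ k h → Tower J k h × (∀ x → mem J x)
    grow fuel {K} {k} T bound with Finₚ.all? (dec K)
    ... | yes all = K , _ , _ , T , all
    ... | no ¬all with Finₚ.¬∀⟶∃¬ s (mem K) (dec K) ¬all
    ...   | x , x∉K with extend T x x∉K
    grow zero {K} {k} T bound | no ¬all | x , x∉K | J , p , pp , T′ =
      ⊥-elim (ℕₚ.<⇒≱ (ℕₚ.≤-trans (order-grows pp T) (order≤ T′)) (subst (s ℕ.≤_) (ℕₚ.+-identityʳ k) bound))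
    grow (suc fuel) {K} {k} T bound | no ¬all | x , x∉K | J , p , pp , T′ =
      grow fuel T′ (ℕₚ.≤-trans bound (ℕₚ.≤-trans (ℕₚ.≤-reflexive (ℕₚ.+-suc k fuel)) (ℕₚ.+-monoˡ-≤ fuel (order-grows pp T))))

    trivial-subgroup : Subgroup
    trivial-subgroup = record
      { mem = _≡ 𝟘
      ; dec = Fin._≟ 𝟘
      ; 𝟘∈ = refl
      ; ⊕∈ = λ { refl refl → linear {0} (:0 :+ :0) :0 [] refl }
      ; ⊖∈ = λ { refl → linear {0} (:- :0) :0 [] refl }
      }

    abstract
      -- The final tower has order exactly s: its elements are distinct members of `Fin s`, and they
      -- cover it.
      whole-packing : ¬ (2 ℕᵈ.∣ s) → ∃ λ J → Packing J s × (∀ x → mem J x)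
      whole-packing odd with grow s (trivial {trivial-subgroup} (λ _ e → e)) (ℕₚ.n≤1+n s)
      ... | J , k , h , T ,
          all with ℕₚ.≤-antisym (order≤ T)
          (subst (s ℕ.≤_) (length-elements T) (covers⇒≤length (elements T) (λ i → ∈-elements T i (all i))))
      ...   | refl = J , packing h T odd , all

-- Distributing zero-sum triples and pairs over blocks

module ZeroSumAssignments where
  open IntegerModules
  open ZeroSumPackings
  open import Data.Nat as ℕ using (ℕ; zero; suc; z≤n; s≤s)
  import Data.Nat.Properties as ℕₚ
  import Data.Nat.Tactic.RingSolver as NatSolver
  open import Data.Fin using (zero; suc)
  open import Data.Vec using ([]; _∷_)
  open import Data.List using (List; []; _∷_; _++_; map; length; concat)
  open import Data.List.Properties using (length-++; map-++)
  open import Data.List.Relation.Unary.All as All using (All; []; _∷_)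
  open import Data.List.Relation.Unary.Any using (here; there)
  open import Data.List.Membership.Propositional using (_∈_)
  open import Data.List.Membership.Propositional.Properties using (∈-++⁺ˡ; ∈-++⁺ʳ)
  open import Data.Product using (∃; ∃₂; _×_; _,_; proj₁; proj₂)
  open import Data.Sum using (_⊎_; inj₁; inj₂; [_,_])
  open import Relation.Binary.PropositionalEquality hiding ([_])
  open import Algebra.Structures using (IsAbelianGroup)

  module Assignment {X C : Set} {_⊕_ : C → C → C} {𝟘 : C} {⊖_ : C → C}
                    (isAbelianGroup : IsAbelianGroup _≡_ _⊕_ 𝟘 ⊖_) where

    open IntegerModule isAbelianGroup
    open Packings isAbelianGroup

    pair-values : List C → List C
    pair-values []       = []
    pair-values (p ∷ ps) = p ∷ ⊖ p ∷ pair-values ps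

    triple-values : List (C × C) → List C
    triple-values []             = []
    triple-values ((a , b) ∷ ts) = a ∷ b ∷ ⊖ (a ⊕ b) ∷ triple-values ts

    length-pair-values : ∀ ps → length (pair-values ps) ≡ 2 ℕ.* length ps
    length-pair-values []       = refl
    length-pair-values (p ∷ ps) = trans (cong (2 ℕ.+_) (length-pair-values ps)) (sym (ℕₚ.*-suc 2 (length ps)))

    ±∈pair-values : ∀ {x p} ps → p ∈ ps → ± x p → x ∈ pair-values ps
    ±∈pair-values (p ∷ ps) (here refl) (inj₁ refl) = here refl
    ±∈pair-values (p ∷ ps) (here refl) (inj₂ refl) = there (here refl)
    ±∈pair-values (p ∷ ps) (there i)   s           = there (there (±∈pair-values ps i s))

    sum-values : List (X × C) → C
    sum-values []             = 𝟘
    sum-values ((_ , a) ∷ zs) = a ⊕ sum-values zs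

    data Paired : List X → ℕ → Set where
      []      : Paired [] 0
      two : ∀ x y {ks h} → Paired ks h → Paired (x ∷ y ∷ ks) (suc h)

    -- The two numbers are the zero-sum triples and the zero-sum pairs that the block consumes; a
    -- block of odd size takes exactly one triple.
    data Shape : List X → ℕ → ℕ → Set where
      even-size : ∀ {ks h} → Paired ks h → Shape ks 0 h
      odd-size  : ∀ x y z {ks h} → Paired ks h → Shape (x ∷ y ∷ z ∷ ks) 1 h

    paired-or-odd : ∀ ks → (∃ λ h → Paired ks h) ⊎ (∃ λ z → ∃₂ λ ks′ h → ks ≡ z ∷ ks′ × Paired ks′ h)
    paired-or-odd [] = inj₁ (0 , [])
    paired-or-odd (x ∷ []) = inj₂ (x , [] , 0 , refl , [])
    paired-or-odd (x ∷ y ∷ ks) with paired-or-odd ks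
    ... | inj₁ (h , p) = inj₁ (suc h , two x y p)
    ... | inj₂ (z , ks′ , h , refl , p) = inj₂ (x , y ∷ z ∷ ks′ , suc h , refl , two y z p)

    shape : ∀ ks → 2 ℕ.≤ length ks → ∃₂ λ o h → Shape ks o h
    shape (x ∷ y ∷ ks) _ with paired-or-odd ks
    ... | inj₁ (h , p) = 0 , suc h , even-size (two x y p)
    ... | inj₂ (z , ks′ , h , refl , p) = 1 , h , odd-size x y z p
    shape (x ∷ []) (s≤s ())

    data Shapes : List (List X) → ℕ → ℕ → Set where
      []  : Shapes [] 0 0
      _∷_ : ∀ {ks bs o h o′ h′} → Shape ks o h → Shapes bs o′ h′ → Shapes (ks ∷ bs) (o ℕ.+ o′) (h ℕ.+ h′)

    shapes : ∀ bs → All (λ ks → 2 ℕ.≤ length ks) bs → ∃₂ λ o h → Shapes bs o h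
    shapes [] [] = 0 , 0 , []
    shapes (ks ∷ bs) (b ∷ rest) = let o , h , s = shape ks b ; o′ , h′ , s′ = shapes bs rest in o ℕ.+ o′ , h ℕ.+ h′ , s ∷ s′

    length-paired : ∀ {ks h} → Paired ks h → length ks ≡ 2 ℕ.* h
    length-paired [] = refl
    length-paired {h = suc h} (two x y p) = trans (cong (2 ℕ.+_) (length-paired p)) (sym (ℕₚ.*-suc 2 h))

    length-shape : ∀ {ks o h} → Shape ks o h → length ks ≡ 3 ℕ.* o ℕ.+ 2 ℕ.* h
    length-shape (even-size p) = length-paired p
    length-shape (odd-size x y z p) = cong (3 ℕ.+_) (length-paired p)

    length-shapes : ∀ {bs o h} → Shapes bs o h → length (concat bs) ≡ 3 ℕ.* o ℕ.+ 2 ℕ.* h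
    length-shapes [] = refl
    length-shapes {ks ∷ bs} (_∷_ {o = o} {h} {o′} {h′} s ss) =
      trans (length-++ ks) (trans (cong₂ ℕ._+_ (length-shape s) (length-shapes ss)) (arith o h o′ h′))
      where
      arith : ∀ o h o′ h′ → 3 ℕ.* o ℕ.+ 2 ℕ.* h ℕ.+ (3 ℕ.* o′ ℕ.+ 2 ℕ.* h′) ≡ 3 ℕ.* (o ℕ.+ o′) ℕ.+ 2 ℕ.* (h ℕ.+ h′)
      arith = NatSolver.solve-∀

    -- Pairs are taken from a common stock, of which `rest` is handed on to the next block; `covers`
    -- says that no value is lost on the way.
    record Filled (ks : List X) (trs : List (C × C)) (ps : List C) (h : ℕ) : Set where
      field
        filling  : List (X × C)
        keys     : map proj₁ filling ≡ ks
        zero-sum : sum-values filling ≡ 𝟘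
        rest     : List C
        length-rest : length rest ≡ h
        covers   : ∀ x → x ∈ triple-values trs ⊎ x ∈ pair-values ps → x ∈ map proj₂ filling ⊎ x ∈ pair-values rest

    fill-pairs : ∀ {ks h h′} → Paired ks h → ∀ ps → length ps ≡ h ℕ.+ h′ → Filled ks [] ps h′
    fill-pairs [] ps e = record
      { filling = [] ; keys = refl ; zero-sum = refl ; rest = ps ; length-rest = e ; covers = λ { x (inj₂ i) → inj₂ i } }
    fill-pairs (two x y paired) (p ∷ ps) e = record
      { filling = (x , p) ∷ (y , ⊖ p) ∷ F.filling
      ; keys = cong (λ ks → x ∷ y ∷ ks) F.keys
      ; zero-sum = trans (cong (λ z → p ⊕ ((⊖ p) ⊕ z)) F.zero-sum) (linear (v₀ :+ (:- v₀ :+ :0)) :0 (p ∷ []) refl)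
      ; rest = F.rest
      ; length-rest = F.length-rest
      ; covers = λ
        { _ (inj₂ (here refl)) → inj₁ (here refl)
        ; _ (inj₂ (there (here refl))) → inj₁ (there (here refl))
        ; z (inj₂ (there (there i))) → [ (λ j → inj₁ (there (there j))) , inj₂ ] (F.covers z (inj₂ i)) }
      }
      where module F = Filled (fill-pairs paired ps (ℕₚ.suc-injective e))

    fill-odd : ∀ x y z {ks h h′} → Paired ks h → ∀ a b ps → length ps ≡ h ℕ.+ h′ → Filled (x ∷ y ∷ z ∷ ks) ((a , b) ∷ []) ps h′
    fill-odd x y z paired a b ps e = record
      { filling = (x , a) ∷ (y , b) ∷ (z , ⊖ (a ⊕ b)) ∷ F.filling
      ; keys = cong (λ ks → x ∷ y ∷ z ∷ ks) F.keys
      ; zero-sum =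
          trans (cong (λ s → a ⊕ (b ⊕ ((⊖ (a ⊕ b)) ⊕ s))) F.zero-sum)
          (linear (v₀ :+ (v₁ :+ (:- (v₀ :+ v₁) :+ :0))) :0 (a ∷ b ∷ []) refl)
      ; rest = F.rest
      ; length-rest = F.length-rest
      ; covers = λ
        { _ (inj₁ (here refl)) → inj₁ (here refl)
        ; _ (inj₁ (there (here refl))) → inj₁ (there (here refl))
        ; _ (inj₁ (there (there (here refl)))) → inj₁ (there (there (here refl)))
        ; w (inj₂ i) → [ (λ j → inj₁ (there (there (there j)))) , inj₂ ] (F.covers w (inj₂ i)) }
      }
      where module F = Filled (fill-pairs paired ps e)

    record Assigned (P : List (X × C) → Set) (bs : List (List X)) (trs : List (C × C)) (ps : List C) : Set where
      field
        assignment : List (X × C)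
        keys       : map proj₁ assignment ≡ concat bs
        property   : P assignment
        covers     : ∀ x → x ∈ triple-values trs ⊎ x ∈ pair-values ps → x ∈ map proj₂ assignment

    module _ {P : List (X × C) → Set} (P-[] : P []) (P-++ : ∀ {zs zs′} → P zs → P zs′ → P (zs ++ zs′)) where

      -- P stands for attainability of the weights by a labelling; it is left abstract so that the
      -- distribution of values involves no graph.
      Admits : List X → Set
      Admits ks = ∀ zs → map proj₁ zs ≡ ks → sum-values zs ≡ 𝟘 → P zs

      assign : ∀ {bs o h} → Shapes bs o h → All Admits bs → ∀ trs ps → length trs ≡ o → length ps ≡ h → Assigned P bs trs ps
      assign [] [] [] [] _ _ = record { assignment = [] ; keys = refl ; property = P-[] ; covers = λ { _ (inj₁ ()) ; _ (inj₂ ()) } }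
      assign {ks ∷ bs} (even-size paired ∷ ss) (admits ∷ rest) trs ps e e′ = record
        { assignment = F.filling ++ R.assignment
        ; keys = trans (map-++ proj₁ F.filling R.assignment) (cong₂ _++_ F.keys R.keys)
        ; property = P-++ (admits F.filling F.keys F.zero-sum) R.property
        ; covers = λ x m → subst (x ∈_) (sym (map-++ proj₂ F.filling R.assignment)) (covers x m)
        }
        where
        module F = Filled (fill-pairs paired ps e′)
        module R = Assigned (assign ss rest trs F.rest e F.length-rest)
        covers : ∀ x → x ∈ triple-values trs ⊎ x ∈ pair-values ps → x ∈ map proj₂ F.filling ++ map proj₂ R.assignment
        covers x (inj₁ i) = ∈-++⁺ʳ _ (R.covers x (inj₁ i))
        covers x (inj₂ i) = [ ∈-++⁺ˡ , (λ j → ∈-++⁺ʳ _ (R.covers x (inj₂ j))) ] (F.covers x (inj₂ i))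
      assign {ks ∷ bs} (odd-size x y z paired ∷ ss) (admits ∷ rest) ((a , b) ∷ trs) ps e e′ = record
        { assignment = F.filling ++ R.assignment
        ; keys = trans (map-++ proj₁ F.filling R.assignment) (cong₂ _++_ F.keys R.keys)
        ; property = P-++ (admits F.filling F.keys F.zero-sum) R.property
        ; covers = λ w m → subst (w ∈_) (sym (map-++ proj₂ F.filling R.assignment)) (covers w m)
        }
        where
        module F = Filled (fill-odd x y z paired a b ps e′)
        module R = Assigned (assign ss rest trs F.rest (ℕₚ.suc-injective e) F.length-rest)
        covers : ∀ w → w ∈ triple-values ((a , b) ∷ trs) ⊎ w ∈ pair-values ps → w ∈ map proj₂ F.filling ++ map proj₂ R.assignment
        covers w (inj₁ (here i)) = [ ∈-++⁺ˡ , (λ j → ∈-++⁺ʳ _ (R.covers w (inj₂ j))) ] (F.covers w (inj₁ (here i)))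
        covers w (inj₁ (there (here i))) = [ ∈-++⁺ˡ , (λ j → ∈-++⁺ʳ _ (R.covers w (inj₂ j))) ] (F.covers w (inj₁ (there (here i))))
        covers w (inj₁ (there (there (here i)))) = [ ∈-++⁺ˡ ,
            (λ j → ∈-++⁺ʳ _ (R.covers w (inj₂ j))) ] (F.covers w (inj₁ (there (there (here i)))))
        covers w (inj₁ (there (there (there i)))) = ∈-++⁺ʳ (map proj₂ F.filling) (R.covers w (inj₁ i))
        covers w (inj₂ i) = [ ∈-++⁺ˡ , (λ j → ∈-++⁺ʳ _ (R.covers w (inj₂ j))) ] (F.covers w (inj₂ i))

    -- j of the triples are kept, each together with its negative; all others dissolve into three pairs.
    record Supply (ts : List (C × C)) (ps : List C) (j : ℕ) : Set where
      field
        triples        : List (C × C)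
        pairs          : List C
        length-triples : length triples ≡ j ℕ.+ j
        length-pairs   : length pairs ℕ.+ 3 ℕ.* j ≡ 3 ℕ.* length ts ℕ.+ length ps
        covers-triples : ∀ {a b x} → (a , b) ∈ ts → Hit a b x → x ∈ triple-values triples ⊎ x ∈ pair-values pairs
        covers-pairs   : ∀ {p x} → p ∈ ps → ± x p → x ∈ pair-values pairs

    supply : ∀ ts ps j → j ℕ.≤ length ts → Supply ts ps j
    supply [] ps zero _ = record
      { triples = [] ; pairs = ps ; length-triples = refl ; length-pairs = ℕₚ.+-identityʳ _
      ; covers-triples = λ () ; covers-pairs = ±∈pair-values ps }
    supply ((a , b) ∷ ts) ps zero _ = record
      { triples = S.triples
      ; pairs = a ∷ b ∷ a ⊕ b ∷ S.pairs
      ; length-triples = S.length-triples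
      ; length-pairs = trans (cong (3 ℕ.+_) S.length-pairs) (cong (ℕ._+ length ps) (sym (ℕₚ.*-suc 3 (length ts))))
      ; covers-triples = covers
      ; covers-pairs = λ i s → there (there (there (there (there (there (S.covers-pairs i s))))))
      }
      where
      module S = Supply (supply ts ps zero z≤n)
      covers : ∀ {c d x} → (c , d) ∈ (a , b) ∷ ts → Hit c d x → x ∈ triple-values S.triples ⊎ x ∈ pair-values (a ∷ b ∷ a ⊕ b ∷ S.pairs)
      covers (here refl) (hit₁ s) = inj₂ (±∈pair-values (a ∷ b ∷ a ⊕ b ∷ S.pairs) (here refl) s)
      covers (here refl) (hit₂ s) = inj₂ (±∈pair-values (a ∷ b ∷ a ⊕ b ∷ S.pairs) (there (here refl)) s)
      covers (here refl) (hit₃ s) = inj₂ (±∈pair-values (a ∷ b ∷ a ⊕ b ∷ S.pairs) (there (there (here refl))) s)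
      covers (there i) h = [ inj₁ , (λ k → inj₂ (there (there (there (there (there (there k))))))) ] (S.covers-triples i h)
    supply ((a , b) ∷ ts) ps (suc j) (s≤s j≤) = record
      { triples = (a , b) ∷ (⊖ a , ⊖ b) ∷ S.triples
      ; pairs = S.pairs
      ; length-triples = trans (cong (2 ℕ.+_) S.length-triples) (cong suc (sym (ℕₚ.+-suc j j)))
      ; length-pairs =
          trans (arith (length S.pairs) j)
          (trans (cong (3 ℕ.+_) S.length-pairs) (cong (ℕ._+ length ps) (sym (ℕₚ.*-suc 3 (length ts)))))
      ; covers-triples = covers
      ; covers-pairs = S.covers-pairs
      }
      where
      module S = Supply (supply ts ps j j≤)
      arith : ∀ l j → l ℕ.+ 3 ℕ.* suc j ≡ 3 ℕ.+ (l ℕ.+ 3 ℕ.* j)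
      arith = NatSolver.solve-∀
      covers : ∀ {c d x} → (c , d) ∈ (a , b) ∷ ts → Hit c d x →
               x ∈ triple-values ((a , b) ∷ (⊖ a , ⊖ b) ∷ S.triples) ⊎ x ∈ pair-values S.pairs
      covers (here refl) (hit₁ (inj₁ refl)) = inj₁ (here refl)
      covers (here refl) (hit₁ (inj₂ refl)) = inj₁ (there (there (there (here refl))))
      covers (here refl) (hit₂ (inj₁ refl)) = inj₁ (there (here refl))
      covers (here refl) (hit₂ (inj₂ refl)) = inj₁ (there (there (there (there (here refl)))))
      covers (here refl) (hit₃ (inj₁ refl)) =
          inj₁ (there (there (there (there (there (here (linear (v₀ :+ v₁) (:- (:- v₀ :- v₁)) (a ∷ b ∷ []) refl)))))))
      covers (here refl) (hit₃ (inj₂ refl)) = inj₁ (there (there (here refl)))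
      covers (there i) h = [ (λ k → inj₁ (there (there (there (there (there (there k))))))) , inj₂ ] (S.covers-triples i h)

-- Weights realised by labellings, and linked blocks

module AchievableWeights where
  open import Defs hiding (sym)
  open import Data.Nat as ℕ using (ℕ; zero; suc; z≤n; s≤s)
  import Data.Nat.Properties as ℕₚ
  open import Data.Bool using (true; false; if_then_else_)
  import Data.Bool.Properties as Boolₚ
  open import Data.Fin as Fin using (Fin; zero; suc)
  import Data.Fin.Properties as Finₚ
  open import Data.List using (List; []; _∷_; _++_; map; length; concat)
  open import Data.List.Relation.Unary.All as All using (All; []; _∷_)
  import Data.List.Relation.Unary.All.Properties as All
  open import Data.List.Relation.Unary.AllPairs using ([]; _∷_)
  open import Data.List.Relation.Unary.Any using (here; there)
  open import Data.List.Relation.Unary.Unique.Propositional using (Unique)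
  open import Data.List.Membership.Propositional using (_∈_; _∉_)
  open import Data.List.Membership.Propositional.Properties using (∈-map⁺; ∈-++⁻)
  import Data.List.Membership.DecPropositional as DecMembership
  open import Data.List.Relation.Binary.Permutation.Propositional using (_↭_; ↭-refl; ↭-sym; ↭-trans; ↭⇒↭ₛ)
  open import Data.List.Relation.Binary.Permutation.Propositional.Properties using (shift; ++⁺ˡ; ∈-resp-↭)
  import Data.List.Relation.Binary.Permutation.Setoid.Properties as Permutation
  open import Data.Product using (Σ; ∃; ∃₂; _×_; _,_; proj₁)
  open import Data.Sum using (_⊎_; inj₁; inj₂)
  open import Data.Empty using (⊥-elim)
  open import Relation.Binary.PropositionalEquality as ≡ using (_≡_; _≢_)
  open import Relation.Nullary using (yes; no; does)
  open import Relation.Nullary.Decidable using (_×-dec_; ¬?; decidable-stable)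
  open import Algebra.Bundles using (AbelianGroup)
  open import Level using (0ℓ)
  import Algebra.Properties.AbelianGroup as AbelianGroupProperties
  import Algebra.Properties.CommutativeSemigroup as CommutativeSemigroupProperties
  import Relation.Binary.Reasoning.Setoid as SetoidReasoning

  -- If every path v - c - u returned to v, then each vertex of the component would be v or a
  -- neighbour of v, and the neighbours would be adjacent to v only: a star with centre v.
  second-neighbour : ∀ {n} (G : Graph n) → NoStarComponent G → ∀ v →
                     ∃₂ λ c u → adj G v c ≡ true × adj G c u ≡ true × u ≢ v
  second-neighbour G noStar v
    with Finₚ.any? (λ c → Finₚ.any? (λ u → (adj G v c Boolₚ.≟ true) ×-dec (adj G c u Boolₚ.≟ true) ×-dec ¬? (u Fin.≟ v)))
  ... | yes (c , u , r) = c , u , r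
  ... | no none = ⊥-elim (noStar v (v , here , centre , leaves))
    where
    returns : ∀ {c u} → adj G v c ≡ true → adj G c u ≡ true → u ≡ v
    returns {c} {u} a b = decidable-stable (u Fin.≟ v) λ u≢v → none (c , u , a , b , u≢v)
    close : ∀ {x} → Reach G v x → x ≡ v ⊎ adj G v x ≡ true
    close here = inj₁ ≡.refl
    close (step r a) with close r
    ... | inj₁ ≡.refl = inj₂ a
    ... | inj₂ b = inj₁ (returns b a)
    centre : ∀ x → Reach G v x → x ≢ v → adj G v x ≡ true
    centre x r x≢v with close r
    ... | inj₁ x≡v = ⊥-elim (x≢v x≡v)
    ... | inj₂ a = a
    leaves : ∀ x y → Reach G v x → Reach G v y → x ≢ v → y ≢ v → adj G x y ≡ false
    leaves x y r r′ x≢v y≢v = Boolₚ.¬-not λ a → y≢v (returns (centre x r x≢v) a)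

  module GroupSums (A : AbelianGroup 0ℓ 0ℓ) where
    open AbelianGroup A
    open CommutativeSemigroupProperties commutativeSemigroup using (interchange)

    gsum-cong : ∀ m {f g : Fin m → Carrier} → (∀ i → f i ≈ g i) → gsum A m f ≈ gsum A m g
    gsum-cong zero    e = refl
    gsum-cong (suc m) e = ∙-cong (e zero) (gsum-cong m (λ i → e (suc i)))

    gsum-ε : ∀ m → gsum A m (λ _ → ε) ≈ ε
    gsum-ε zero    = refl
    gsum-ε (suc m) = trans (identityˡ _) (gsum-ε m)

    gsum-∙ : ∀ m (f g : Fin m → Carrier) → gsum A m (λ i → f i ∙ g i) ≈ gsum A m f ∙ gsum A m g
    gsum-∙ zero    f g = sym (identityˡ ε)
    gsum-∙ (suc m) f g = trans (∙-congˡ (gsum-∙ m _ _)) (interchange _ _ _ _)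

  module Achievable {n : ℕ} (G : Graph n) (A : AbelianGroup 0ℓ 0ℓ) where
    open AbelianGroup A
    open AbelianGroupProperties A using (ε⁻¹≈ε; ⁻¹-∙-comm)
    open CommutativeSemigroupProperties commutativeSemigroup using (interchange)
    open SetoidReasoning setoid
    open GroupSums A

    δ : ∀ {m} → Fin m → Carrier → Fin m → Carrier
    δ i a v = if does (v Fin.≟ i) then a else ε

    gsum-δ : ∀ {m} (i : Fin m) a → gsum A m (δ i a) ≈ a
    gsum-δ {suc m} zero    a = trans (∙-congˡ (gsum-ε m)) (identityʳ a)
    gsum-δ {suc m} (suc i) a = trans (identityˡ _) (gsum-δ i a)

    δ-cong : ∀ {m} (i : Fin m) {a b} → a ≈ b → ∀ v → δ i a v ≈ δ i b v
    δ-cong i e v with does (v Fin.≟ i)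
    ... | true  = e
    ... | false = refl

    δ-∙ : ∀ {m} (i : Fin m) a b v → δ i a v ∙ δ i b v ≈ δ i (a ∙ b) v
    δ-∙ i a b v with does (v Fin.≟ i)
    ... | true  = refl
    ... | false = identityˡ ε

    δ-ε : ∀ {m} (i : Fin m) v → δ i ε v ≈ ε
    δ-ε i v with does (v Fin.≟ i)
    ... | true  = refl
    ... | false = refl

    δ-inverse : ∀ {m} (i : Fin m) {a b} → a ∙ b ≈ ε → ∀ v → δ i a v ∙ δ i b v ≈ ε
    δ-inverse i {a} {b} e v = trans (δ-∙ i a b v) (trans (δ-cong i e v) (δ-ε i v))

    δ-same : ∀ {m} (i : Fin m) a → δ i a i ≈ a
    δ-same i a with i Fin.≟ i
    ... | yes _ = refl
    ... | no i≢i = ⊥-elim (i≢i ≡.refl)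

    δ-other : ∀ {m} {i v : Fin m} → v ≢ i → ∀ a → δ i a v ≈ ε
    δ-other {i = i} {v} v≢i a with v Fin.≟ i
    ... | yes v≡i = ⊥-elim (v≢i v≡i)
    ... | no _ = refl

    Ach : (Fin n → Carrier) → Set
    Ach f = Σ (Labeling G A) λ L → ∀ v → wdeg G A L v ≈ f v

    ach-resp : ∀ {f g} → (∀ v → f v ≈ g v) → Ach f → Ach g
    ach-resp e (L , p) = L , λ v → trans (p v) (e v)

    ach-ε : Ach (λ _ → ε)
    ach-ε = record { lab = λ _ _ → ε ; lsym = λ _ _ → refl } ,
            λ v → trans (gsum-cong n (λ u → reflexive (Boolₚ.if-eta (adj G v u)))) (gsum-ε n)

    ach-∙ : ∀ {f g} → Ach f → Ach g → Ach (λ v → f v ∙ g v)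
    ach-∙ {f} {g} (L , p) (M , q) =
      record { lab = λ i j → lab L i j ∙ lab M i j ; lsym = λ i j → ∙-cong (lsym L i j) (lsym M i j) } ,
      λ v → trans (trans (gsum-cong n (distrib v)) (gsum-∙ n _ _)) (∙-cong (p v) (q v))
      where
      distrib : ∀ v u →
          (if adj G v u then lab L v u ∙ lab M v u else ε) ≈ (if adj G v u then lab L v u else ε) ∙
          (if adj G v u then lab M v u else ε)
      distrib v u with adj G v u
      ... | true  = refl
      ... | false = sym (identityˡ ε)

    -- The label is the sum of its two orientations (x, y) and (y, x). This makes it symmetric, and
    -- each orientation contributes the weight at one end.
    ach-edge : ∀ x y a → adj G x y ≡ true → Ach (λ v → δ x a v ∙ δ y a v)
    ach-edge x y a x~y =
      record { lab = λ i j → arc i x j y ∙ arc i y j x ; lsym = λ i j → trans (comm _ _) (∙-cong (arc-swap i y j x) (arc-swap i x j y)) } ,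
      λ v → trans (gsum-cong n (on-edge v)) (trans (gsum-∙ n _ _) (∙-cong (gsum-arc v x y) (gsum-arc v y x)))
      where
      arc : Fin n → Fin n → Fin n → Fin n → Carrier
      arc i x j y = if does (i Fin.≟ x) then δ y a j else ε
      arc-swap : ∀ i x j y → arc i x j y ≈ arc j y i x
      arc-swap i x j y with does (i Fin.≟ x) | does (j Fin.≟ y)
      ... | true  | true  = refl
      ... | true  | false = refl
      ... | false | true  = refl
      ... | false | false = refl
      gsum-arc : ∀ v x y → gsum A n (λ u → arc v x u y) ≈ δ x a v
      gsum-arc v x y with does (v Fin.≟ x)
      ... | true  = gsum-δ y a
      ... | false = gsum-ε n
      off-edge : ∀ v u x y → adj G v u ≡ false → adj G x y ≡ true → arc v x u y ≈ ε
      off-edge v u x y f t with v Fin.≟ x | u Fin.≟ y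
      ... | yes ≡.refl | yes ≡.refl with () ← ≡.trans (≡.sym f) t
      ... | yes _ | no _  = refl
      ... | no _  | _     = refl
      on-edge : ∀ v u → (if adj G v u then arc v x u y ∙ arc v y u x else ε) ≈ arc v x u y ∙ arc v y u x
      on-edge v u with adj G v u in e
      ... | true  = refl
      ... | false = sym (trans (∙-cong (off-edge v u x y e x~y) (off-edge v u y x e (≡.trans (Graph.sym G y x) x~y))) (identityˡ ε))

    -- An amount a can be placed at x at the expense of y, whatever a is. Telescoping makes this
    -- transitive, so a block may be described by links to a single root.
    Link : Fin n → Fin n → Set
    Link x y = ∀ a → Ach (λ v → δ x a v ∙ δ y (a ⁻¹) v)

    link-refl : ∀ x → Link x x
    link-refl x a = ach-resp (λ v → sym (δ-inverse x (inverseʳ a) v)) ach-ε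

    telescope : ∀ {a b c d} → b ∙ c ≈ ε → (a ∙ b) ∙ (c ∙ d) ≈ a ∙ d
    telescope {a} {b} {c} {d} e = begin
      (a ∙ b) ∙ (c ∙ d) ≈⟨ assoc a b _ ⟩
      a ∙ (b ∙ (c ∙ d)) ≈⟨ ∙-congˡ (assoc b c d) ⟨
      a ∙ ((b ∙ c) ∙ d) ≈⟨ ∙-congˡ (trans (∙-congʳ e) (identityˡ d)) ⟩
      a ∙ d ∎

    link-trans : ∀ {x y z} → Link x y → Link y z → Link x z
    link-trans {x} {y} {z} l m a = ach-resp (λ v → telescope (δ-inverse y (inverseˡ a) v)) (ach-∙ (l a) (m a))

    link-common : ∀ {x c y} → adj G x c ≡ true → adj G c y ≡ true → Link x y
    link-common {x} {c} {y} x~c c~y a =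
      ach-resp (λ v → telescope (δ-inverse c (inverseʳ a) v)) (ach-∙ (ach-edge x c a x~c) (ach-edge c y (a ⁻¹) c~y))

    total : List (Fin n × Carrier) → Fin n → Carrier
    total []             v = ε
    total ((u , a) ∷ zs) v = δ u a v ∙ total zs v

    value-sum : List (Fin n × Carrier) → Carrier
    value-sum []             = ε
    value-sum ((_ , a) ∷ zs) = a ∙ value-sum zs

    -- Each link to r deposits the inverse of the value placed, so the root collects the inverse of
    -- the whole sum; for zero-sum values this deposit vanishes.
    ach-linked : ∀ r zs → All (λ z → Link (proj₁ z) r) zs → Ach (λ v → total zs v ∙ δ r (value-sum zs ⁻¹) v)
    ach-linked r [] [] = ach-resp (λ v → sym (trans (identityˡ _) (trans (δ-cong r ε⁻¹≈ε v) (δ-ε r v)))) ach-ε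
    ach-linked r ((u , a) ∷ zs) (l ∷ ls) =
      ach-resp (λ v → trans (interchange _ _ _ _) (∙-congˡ (trans (δ-∙ r _ _ v) (δ-cong r (⁻¹-∙-comm a _) v))))
          (ach-∙ (l a) (ach-linked r zs ls))

    ach-zero-sum : ∀ r zs → All (λ z → Link (proj₁ z) r) zs → value-sum zs ≈ ε → Ach (total zs)
    ach-zero-sum r zs ls e = ach-resp
      (λ v → trans (∙-congˡ (trans (δ-cong r (trans (⁻¹-cong e) ε⁻¹≈ε) v) (δ-ε r v))) (identityʳ _)) (ach-linked r zs ls)

    total-++ : ∀ zs zs′ v → total zs v ∙ total zs′ v ≈ total (zs ++ zs′) v
    total-++ []       zs′ v = identityˡ _
    total-++ (z ∷ zs) zs′ v = trans (assoc _ _ _) (∙-congˡ (total-++ zs zs′ v))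

    total-absent : ∀ {i} zs → i ∉ map proj₁ zs → total zs i ≈ ε
    total-absent [] _ = refl
    total-absent ((u , a) ∷ zs) i∉ =
      trans (∙-cong (δ-other (λ e → i∉ (here e)) a) (total-absent zs (λ m → i∉ (there m)))) (identityˡ ε)

    total-unique : ∀ {i a} zs → Unique (map proj₁ zs) → (i , a) ∈ zs → total zs i ≈ a
    total-unique {i} {a} (_ ∷ zs) (fresh ∷ _) (here ≡.refl) =
      trans (∙-cong (δ-same i a) (total-absent zs (λ m → All.lookup fresh m ≡.refl))) (identityʳ a)
    total-unique {i} {a} ((u , b) ∷ zs) (fresh ∷ unique) (there m) =
      trans (∙-cong (δ-other (λ i≡u → All.lookup fresh (∈-map⁺ proj₁ m) (≡.sym i≡u)) b) (total-unique zs unique m)) (identityˡ a)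

    -- The root r is any vertex, inside or outside `ks`, so that a block stays linked when one of
    -- its vertices is removed.
    Linked : List (Fin n) → Set
    Linked ks = 2 ℕ.≤ length ks × ∃ λ r → All (λ x → Link x r) ks

    insert : ∀ {u v} bs → Link v u → u ∈ concat bs → All Linked bs → ∃ λ bs′ → v ∷ concat bs ↭ concat bs′ × All Linked bs′
    insert {u} {v} (ks ∷ bs) l m ((big , r , ls) ∷ rest) with ∈-++⁻ ks m
    ... | inj₁ m′ = (v ∷ ks) ∷ bs , ↭-refl , (ℕₚ.m≤n⇒m≤1+n big , r , link-trans l (All.lookup ls m′) ∷ ls) ∷ rest
    ... | inj₂ m′ with insert bs l m′ rest
    ...   | bs′ , p , rest′ = ks ∷ bs′ , ↭-trans (↭-sym (shift v ks (concat bs))) (++⁺ˡ ks p) , (big , r , ls) ∷ rest′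

    Unique-resp-↭ : ∀ {xs ys : List (Fin n)} → xs ↭ ys → Unique xs → Unique ys
    Unique-resp-↭ p = Permutation.Unique-resp-↭ (≡.setoid (Fin n)) (↭⇒↭ₛ p)

    open DecMembership {A = Fin n} Fin._≟_ using (_∈?_)

    -- Vertices are inserted one by one. A new v is linked to some u ≠ v through a common neighbour:
    -- it joins the block of u if there is one, and otherwise v and u open a new block. So no block
    -- ever has fewer than two members.
    linked-blocks : NoStarComponent G → ∀ vs → ∃ λ bs → Unique (concat bs) × All Linked bs × (∀ {v} → v ∈ vs → v ∈ concat bs)
    linked-blocks noStar [] = [] , [] , [] , λ ()
    linked-blocks noStar (v ∷ vs) with linked-blocks noStar vs
    ... | bs , unique , linked , covers with v ∈? concat bs
    ...   | yes v∈ = bs , unique , linked , λ { (here ≡.refl) → v∈ ; (there m) → covers m }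
    ...   | no v∉ with second-neighbour G noStar v
    ...     | c , u , v~c , c~u , u≢v with u ∈? concat bs
    ...       | yes u∈ with insert bs (link-common v~c c~u) u∈ linked
    ...         | bs′ , p , linked′ = bs′ , Unique-resp-↭ p (All.¬Any⇒All¬ _ v∉ ∷ unique) , linked′ ,
                  λ { (here ≡.refl) → ∈-resp-↭ p (here ≡.refl) ; (there m) → ∈-resp-↭ p (there (covers m)) }
    linked-blocks noStar (v ∷ vs) | bs , unique , linked , covers | no v∉ | c , u , v~c , c~u , u≢v | no u∉ =
      (v ∷ u ∷ []) ∷ bs , ((λ e → u≢v (≡.sym e)) ∷ All.¬Any⇒All¬ _ v∉) ∷ All.¬Any⇒All¬ _ u∉ ∷ unique ,
      (s≤s (s≤s z≤n) , u , link-common v~c c~u ∷ link-refl u ∷ []) ∷ linked ,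
      λ { (here ≡.refl) → here ≡.refl ; (there m) → there (there (covers m)) }

-- Irregular labellings over groups of odd order n or n + 1

module UpperBound where
  open import Defs hiding (sym)
  open ZeroSumPackings
  open FiniteLists
  open PackingsOfOddTowers using (even-or-odd)
  open FiniteGroups
  open ZeroSumAssignments
  open AchievableWeights
  open import Data.Nat as ℕ using (ℕ; suc; z≤n; s≤s)
  import Data.Nat.Properties as ℕₚ
  import Data.Nat.Divisibility as ℕᵈ
  import Data.Nat.Tactic.RingSolver as NatSolver
  open import Data.Fin as Fin using (Fin; suc)
  open import Data.List using (List; []; _∷_; _++_; map; length; concat; allFin)
  open import Data.List.Properties using (length-++; length-map; map-++; map-∘)
  open import Data.List.Relation.Unary.All as All using (All; []; _∷_)
  import Data.List.Relation.Unary.All.Properties as All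
  open import Data.List.Relation.Unary.AllPairs as AllPairs using ([]; _∷_)
  open import Data.List.Relation.Unary.Any using (here; there)
  open import Data.List.Relation.Unary.Unique.Propositional using (Unique)
  open import Data.List.Membership.Propositional using (_∈_)
  open import Data.List.Membership.Propositional.Properties using (∈-map⁺; ∈-map⁻; ∈-allFin)
  open import Data.List.Relation.Binary.Permutation.Propositional using (_↭_; ↭-refl; ↭-sym; ↭-trans)
  open import Data.List.Relation.Binary.Permutation.Propositional.Properties using (shift; ++⁺ˡ; ∈-resp-↭; ↭-length)
  open import Data.Product using (Σ; ∃; ∃₂; _×_; _,_; proj₁; proj₂)
  open import Data.Sum using (_⊎_; inj₁; inj₂)
  open import Data.Empty using (⊥; ⊥-elim)
  open import Relation.Binary.PropositionalEquality as ≡ using (_≡_; subst; cong; cong₂)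
  open import Relation.Nullary using (¬_; yes; no)
  open import Algebra.Bundles using (AbelianGroup)
  open import Algebra.Structures using (IsAbelianGroup)
  open import Level using (0ℓ)

  unique-values : ∀ {X C : Set} {i j : X} {a : C} (zs : List (X × C)) → Unique (map proj₂ zs) → (i , a) ∈ zs → (j , a) ∈ zs → i ≡ j
  unique-values (_ ∷ zs) (fresh ∷ u) (here ≡.refl) (here ≡.refl) = ≡.refl
  unique-values (_ ∷ zs) (fresh ∷ u) (here ≡.refl) (there m) = ⊥-elim (All.lookup fresh (∈-map⁺ proj₂ m) ≡.refl)
  unique-values (_ ∷ zs) (fresh ∷ u) (there m) (here ≡.refl) = ⊥-elim (All.lookup fresh (∈-map⁺ proj₂ m) ≡.refl)
  unique-values (_ ∷ zs) (fresh ∷ u) (there m) (there m′) = unique-values zs u m m′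

  -- With 2j + 1 odd blocks, s would be even.
  demand-odd : ∀ j h → suc (3 ℕ.* suc (j ℕ.+ j) ℕ.+ 2 ℕ.* h) ≡ (3 ℕ.* j ℕ.+ 2 ℕ.+ h) ℕ.* 2
  demand-odd = NatSolver.solve-∀

  demand-even : ∀ j h → 2 ℕ.* (h ℕ.+ 3 ℕ.* j) ≡ 3 ℕ.* (j ℕ.+ j) ℕ.+ 2 ℕ.* h
  demand-even = NatSolver.solve-∀

  supply-count : ∀ τ π → 1 ℕ.+ 2 ℕ.* (3 ℕ.* τ ℕ.+ π) ≡ 1 ℕ.+ 6 ℕ.* τ ℕ.+ 2 ℕ.* π
  supply-count = NatSolver.solve-∀

  suc-triple : ∀ τ → suc (3 ℕ.* τ ℕ.+ 2) ≡ 3 ℕ.* suc τ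
  suc-triple = NatSolver.solve-∀

  balance : ∀ j h τ π → suc (3 ℕ.* (j ℕ.+ j) ℕ.+ 2 ℕ.* h) ≡ 1 ℕ.+ 2 ℕ.* (3 ℕ.* τ ℕ.+ π) → h ℕ.+ 3 ℕ.* j ≡ 3 ℕ.* τ ℕ.+ π
  balance j h τ π e = ℕₚ.*-cancelˡ-≡ _ _ 2 (≡.trans (demand-even j h) (ℕₚ.suc-injective e))

  -- The bound on the pairs is used here: 3j ≤ 3τ + π < 3(τ + 1).
  kept≤ : ∀ j h τ π → h ℕ.+ 3 ℕ.* j ≡ 3 ℕ.* τ ℕ.+ π → π ℕ.≤ 2 → j ℕ.≤ τ
  kept≤ j h τ π count π≤2 = ℕₚ.≮⇒≥ λ τ<j → ℕₚ.<⇒≱ (ℕₚ.≤-trans (ℕₚ.≤-reflexive (suc-triple τ)) (ℕₚ.*-monoʳ-≤ 3 τ<j))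
    (ℕₚ.≤-trans (ℕₚ.m≤n+m (3 ℕ.* j) h) (ℕₚ.≤-trans (ℕₚ.≤-reflexive count) (ℕₚ.+-monoʳ-≤ (3 ℕ.* τ) π≤2)))

  -- The group structure is carried over to `Fin s`, where equality is propositional and decidable
  -- and the pigeonhole principle applies.
  module OnFin (A : AbelianGroup 0ℓ 0ℓ) (s : ℕ) (order : HasOrder A s) where
    open AbelianGroup A

    decode : Fin s → Carrier
    decode = proj₁ order

    code : Carrier → Fin s
    code x = proj₁ (proj₁ (proj₂ order) x)

    decode-code : ∀ x → decode (code x) ≈ x
    decode-code x = proj₂ (proj₁ (proj₂ order) x)

    decode-injective : ∀ {i j} → decode i ≈ decode j → i ≡ j
    decode-injective = proj₂ (proj₂ order) _ _

    _⊕_ : Fin s → Fin s → Fin s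
    i ⊕ j = code (decode i ∙ decode j)

    𝟘 : Fin s
    𝟘 = code ε

    ⊖_ : Fin s → Fin s
    ⊖ i = code (decode i ⁻¹)

    decode-⊕ : ∀ i j → decode (i ⊕ j) ≈ decode i ∙ decode j
    decode-⊕ i j = decode-code _

    isAbelianGroup′ : IsAbelianGroup _≡_ _⊕_ 𝟘 ⊖_
    isAbelianGroup′ = record
      { isGroup = record
        { isMonoid = record
          { isSemigroup = record
            { isMagma = record { isEquivalence = ≡.isEquivalence ; ∙-cong = cong₂ _⊕_ }
            ; assoc = λ i j k → decode-injective (trans (decode-⊕ _ k) (trans (∙-congʳ (decode-⊕ i j))
                (trans (assoc _ _ _) (sym (trans (decode-⊕ i _) (∙-congˡ (decode-⊕ j k)))))))
            }
          ; identity = (λ i → decode-injective (trans (decode-⊕ 𝟘 i) (trans (∙-congʳ (decode-code ε)) (identityˡ _)))) ,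
                       (λ i → decode-injective (trans (decode-⊕ i 𝟘) (trans (∙-congˡ (decode-code ε)) (identityʳ _))))
          }
        ; inverse = (λ i →
            decode-injective
            (trans (decode-⊕ _ i) (trans (∙-congʳ (decode-code _)) (trans (inverseˡ _) (sym (decode-code ε)))))) ,
                    (λ i → decode-injective
                        (trans (decode-⊕ i _) (trans (∙-congˡ (decode-code _)) (trans (inverseʳ _) (sym (decode-code ε))))))
        ; ⁻¹-cong = cong ⊖_
        }
      ; comm = λ i j → decode-injective (trans (decode-⊕ i j) (trans (comm _ _) (sym (decode-⊕ j i))))
      }

  module Upper {n : ℕ} (G : Graph n) (noStar : NoStarComponent G) (A : AbelianGroup 0ℓ 0ℓ) (s : ℕ) (order : HasOrder A s)
               (odd : ¬ (2 ℕᵈ.∣ s)) where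
    open AbelianGroup A using (Carrier; _≈_; _∙_; ε; refl; sym; trans; ∙-cong; ∙-congˡ; ∙-congʳ; identityˡ)
    open OnFin A s order
    open Achievable G A
    open Packings isAbelianGroup′ using (Packing; module Packing; Subgroup)
    open Assignment {X = Fin n} isAbelianGroup′
    open FiniteGroup isAbelianGroup′ using (whole-packing)

    decoded : List (Fin n × Fin s) → List (Fin n × Carrier)
    decoded = map (λ z → proj₁ z , decode (proj₂ z))

    Attained : List (Fin n × Fin s) → Set
    Attained zs = Ach (total (decoded zs))

    decode-sum : ∀ zs → value-sum (decoded zs) ≈ decode (sum-values zs)
    decode-sum []             = sym (decode-code ε)
    decode-sum ((_ , a) ∷ zs) = sym (trans (decode-⊕ a _) (∙-congˡ (sym (decode-sum zs))))

    attained-++ : ∀ {zs zs′} → Attained zs → Attained zs′ → Attained (zs ++ zs′)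
    attained-++ {zs} {zs′} a b = ach-resp (λ v → trans (total-++ (decoded zs) (decoded zs′) v)
      (AbelianGroup.reflexive A (cong (λ l → total l v) (≡.sym (map-++ _ zs zs′))))) (ach-∙ a b)

    linked-admits : ∀ {ks} → Linked ks → Admits {P = Attained} ach-ε (λ {zs} → attained-++ {zs}) ks
    linked-admits (_ , r , links) zs ≡.refl e =
      ach-zero-sum r (decoded zs) (All.map⁺ (All.map⁻ links))
          (trans (decode-sum zs) (trans (AbelianGroup.reflexive A (cong decode e)) (decode-code ε)))

    irregular : ∀ zs → Attained zs → Unique (map proj₁ zs) → (∀ i → i ∈ map proj₁ zs) → Unique (map proj₂ zs) →
                Σ (Labeling G A) λ f → Irregular G A f
    irregular zs (L , weights) unique-keys covers unique = L , λ i j e →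
      let a , i∈ , wi = weight i
          b , j∈ , wj = weight j
          a≡b = decode-injective (trans (sym wi) (trans e wj))
      in unique-values zs unique (subst (λ c → (i , c) ∈ zs) a≡b i∈) j∈
      where
      unique-keys′ : Unique (map proj₁ (decoded zs))
      unique-keys′ = subst Unique (map-∘ zs) unique-keys
      weight : ∀ i → ∃ λ a → (i , a) ∈ zs × wdeg G A L i ≈ decode a
      weight i with ∈-map⁻ proj₁ (covers i)
      ... | (_ , a) , m , ≡.refl = a , m , trans (weights i) (total-unique (decoded zs) unique-keys′ (∈-map⁺ _ m))

    module _ {J} (P : Packing J s) (all : ∀ x → Subgroup.mem J x) where
      private
        module P = Packing P
        τ = length P.triples
        π = length P.pairs

      -- One inequality is `size`. For the other, all triples are dissolved into pairs (j = 0), and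
      -- zero together with these pairs covers the s elements.
      packing-size : s ≡ 1 ℕ.+ 2 ℕ.* (3 ℕ.* τ ℕ.+ π)
      packing-size = ℕₚ.≤-antisym
        (ℕₚ.≤-trans (covers⇒≤length (𝟘 ∷ pair-values S.pairs) all-values)
          (ℕₚ.≤-reflexive
              (cong suc (≡.trans (length-pair-values S.pairs)
              (cong (2 ℕ.*_) (≡.trans (≡.sym (ℕₚ.+-identityʳ _)) S.length-pairs))))))
        (ℕₚ.≤-trans (ℕₚ.≤-reflexive (supply-count τ π)) P.size)
        where
        module S = Supply (supply P.triples P.pairs 0 z≤n)
        no-triples : ∀ {x} ts → length ts ≡ 0 → x ∈ triple-values ts → ⊥
        no-triples [] _ ()
        all-values : ∀ x → x ∈ 𝟘 ∷ pair-values S.pairs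
        all-values x with P.covers x (all x)
        ... | inj₁ e = here e
        ... | inj₂ (inj₂ (p , i , e)) = there (S.covers-pairs i e)
        ... | inj₂ (inj₁ (a , b , i , e)) with S.covers-triples i e
        ...   | inj₁ m = ⊥-elim (no-triples S.triples S.length-triples m)
        ...   | inj₂ m = there m

      assign-supply : ∀ {bs j h} → Shapes bs (j ℕ.+ j) h → All Linked bs → Supply P.triples P.pairs j →
        h ℕ.+ 3 ℕ.* j ≡ 3 ℕ.* τ ℕ.+ π → ∃ λ zs → map proj₁ zs ≡ concat bs × Attained zs × (∀ x → x ∈ 𝟘 ∷ map proj₂ zs)
      assign-supply {bs} {j} {h} S linked supplied count = R.assignment , R.keys , R.property , covers
        where
        module S = Supply supplied
        assigned : Assigned Attained bs S.triples S.pairs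
        assigned = assign {P = Attained} ach-ε (λ {zs} → attained-++ {zs}) S
          (All.map linked-admits linked) S.triples S.pairs S.length-triples
          (ℕₚ.+-cancelʳ-≡ (3 ℕ.* j) (length S.pairs) h (≡.trans S.length-pairs (≡.sym count)))
        module R = Assigned assigned
        covers : ∀ x → x ∈ 𝟘 ∷ map proj₂ R.assignment
        covers x with P.covers x (all x)
        ... | inj₁ e = here e
        ... | inj₂ (inj₁ (a , b , i , e)) = there (R.covers x (S.covers-triples i e))
        ... | inj₂ (inj₂ (p , i , e)) = there (R.covers x (inj₂ (S.covers-pairs i e)))

    -- As s is odd, an even number 2j of blocks has odd size. They consume j triples together with
    -- the j negatives, and the count of what remains is exactly the number of pairs required.
    zero-sum-assignment : ∀ bs → All Linked bs → s ≡ suc (length (concat bs)) →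
      ∃ λ zs → map proj₁ zs ≡ concat bs × Attained zs × (∀ x → x ∈ 𝟘 ∷ map proj₂ zs)
    zero-sum-assignment bs linked s≡ = go (shapes bs (All.map proj₁ linked)) (whole-packing odd)
      where
      Result = ∃ λ zs → map proj₁ zs ≡ concat bs × Attained zs × (∀ x → x ∈ 𝟘 ∷ map proj₂ zs)
      balanced : ∀ {J o h} (P : Packing J s) → (∀ x → Subgroup.mem J x) → Shapes bs o h →
                 (∃ λ j → o ≡ j ℕ.+ j ⊎ o ≡ suc (j ℕ.+ j)) → Result
      balanced {h = h} P all S (j , inj₂ ≡.refl) = ⊥-elim (odd (ℕᵈ.divides (3 ℕ.* j ℕ.+ 2 ℕ.+ h)
        (≡.trans s≡ (≡.trans (cong suc (length-shapes S)) (demand-odd j h)))))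
      balanced {h = h} P all S (j , inj₁ ≡.refl) =
          assign-supply P all S linked (supply P.triples P.pairs j (kept≤ j h _ (length P.pairs) count P.few)) count
        where
        module P = Packing P
        count = balance j h (length P.triples) (length P.pairs)
            (≡.trans (≡.sym (≡.trans s≡ (cong suc (length-shapes S)))) (packing-size P all))
      go : (∃₂ λ o h → Shapes bs o h) → (∃ λ J → Packing J s × (∀ x → Subgroup.mem J x)) → Result
      go (o , h , S) (J , P , all) = balanced P all S (even-or-odd o)

    -- For s = n one vertex has to receive the weight 0. Since n is odd, some block has odd size,
    -- hence at least three vertices, and can give one up while keeping two.
    drop-vertex : ∀ bs → All Linked bs → ¬ (2 ℕᵈ.∣ length (concat bs)) →
                  ∃₂ λ v bs′ → v ∷ concat bs′ ↭ concat bs × All Linked bs′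
    drop-vertex [] [] odd = ⊥-elim (odd (ℕᵈ.divides 0 ≡.refl))
    drop-vertex (ks ∷ bs) (linked ∷ rest) odd with 2 ℕᵈ.∣? length ks
    drop-vertex (ks ∷ bs) (linked ∷ rest) odd | yes 2∣ks
      with drop-vertex bs rest (λ d → odd (subst (2 ℕᵈ.∣_) (≡.sym (length-++ ks)) (ℕᵈ.∣m∣n⇒∣m+n 2∣ks d)))
    ... | v , bs′ , p , rest′ = v , ks ∷ bs′ , ↭-trans (↭-sym (shift v ks (concat bs′))) (++⁺ˡ ks p) , linked ∷ rest′
    drop-vertex ((x ∷ []) ∷ bs) ((s≤s () , _) ∷ _) odd | no _
    drop-vertex ((x ∷ y ∷ []) ∷ bs) _ odd | no 2∤ = ⊥-elim (2∤ (ℕᵈ.divides 1 ≡.refl))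
    drop-vertex ((x ∷ y ∷ z ∷ ks) ∷ bs) ((_ , r , _ ∷ links) ∷ rest) odd | no 2∤ =
      x , (y ∷ z ∷ ks) ∷ bs , ↭-refl , (s≤s (s≤s z≤n) , r , links) ∷ rest
    drop-vertex ([] ∷ bs) ((() , _) ∷ _) odd | no _

    length-blocks : ∀ {xs : List (Fin n)} → Unique xs → (∀ i → i ∈ xs) → length xs ≡ n
    length-blocks {xs} unique covers = ℕₚ.≤-antisym (unique⇒length≤ unique) (covers⇒≤length xs covers)

    values-unique : ∀ (zs : List (Fin n × Fin s)) {ks} → map proj₁ zs ≡ ks →
        (∀ x → x ∈ 𝟘 ∷ map proj₂ zs) → s ≡ suc (length ks) → Unique (𝟘 ∷ map proj₂ zs)
    values-unique zs ≡.refl covers s≡ = covers⇒unique (𝟘 ∷ map proj₂ zs) covers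
      (ℕₚ.≤-reflexive (≡.trans (cong suc (≡.trans (length-map proj₂ zs) (≡.sym (length-map proj₁ zs)))) (≡.sym s≡)))

    Blocks : List (List (Fin n)) → Set
    Blocks bs = Unique (concat bs) × All Linked bs × (∀ i → i ∈ concat bs)

    label-without-𝟘 : ∀ bs → Blocks bs → s ≡ suc n → Σ (Labeling G A) λ f → Irregular G A f
    label-without-𝟘 bs (unique , linked , covers) s≡1+n = go (zero-sum-assignment bs linked s≡)
      where
      s≡ : s ≡ suc (length (concat bs))
      s≡ = ≡.trans s≡1+n (cong suc (≡.sym (length-blocks unique covers)))
      go : (∃ λ zs → map proj₁ zs ≡ concat bs × Attained zs × (∀ x → x ∈ 𝟘 ∷ map proj₂ zs)) → Σ (Labeling G A) λ f → Irregular G A f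
      go (zs , keys , attained , values) = irregular zs attained (subst Unique (≡.sym keys) unique)
        (λ i → subst (i ∈_) (≡.sym keys) (covers i)) (AllPairs.tail (values-unique zs keys values s≡))

    label-with-𝟘 : ∀ bs → Blocks bs → s ≡ n → Σ (Labeling G A) λ f → Irregular G A f
    label-with-𝟘 bs (unique , linked , covers) s≡n =
      drop (drop-vertex bs linked (subst (λ l → ¬ (2 ℕᵈ.∣ l)) (≡.trans s≡n (≡.sym (length-blocks unique covers))) odd))
      where
      drop : (∃₂ λ v bs′ → v ∷ concat bs′ ↭ concat bs × All Linked bs′) → Σ (Labeling G A) λ f → Irregular G A f
      drop (v , bs′ , p , linked′) = go (zero-sum-assignment bs′ linked′ s≡)
        where
        s≡ : s ≡ suc (length (concat bs′))
        s≡ = ≡.trans s≡n (≡.sym (≡.trans (↭-length p) (length-blocks unique covers)))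
        go : (∃ λ zs → map proj₁ zs ≡ concat bs′ × Attained zs × (∀ x → x ∈ 𝟘 ∷ map proj₂ zs)) → Σ (Labeling G A) λ f → Irregular G A f
        go (zs , keys , attained , values) = irregular ((v , 𝟘) ∷ zs)
          (ach-resp (λ w → sym (trans (∙-congʳ (trans (δ-cong v (decode-code ε) w) (δ-ε v w))) (identityˡ _))) attained)
          (subst (λ ks → Unique (v ∷ ks)) (≡.sym keys) (Unique-resp-↭ (↭-sym p) unique))
          (λ i → subst (λ ks → i ∈ v ∷ ks) (≡.sym keys) (∈-resp-↭ (↭-sym p) (covers i)))
          (values-unique zs keys values s≡)

    upper : s ≡ n ⊎ s ≡ suc n → Σ (Labeling G A) λ f → Irregular G A f
    upper s≡ = go (linked-blocks noStar (allFin n)) s≡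
      where
      go : (∃ λ bs → Unique (concat bs) × All Linked bs × (∀ {v} → v ∈ allFin n → v ∈ concat bs)) →
           s ≡ n ⊎ s ≡ suc n → Σ (Labeling G A) λ f → Irregular G A f
      go (bs , unique , linked , covers) (inj₁ s≡n)   = label-with-𝟘 bs (unique , linked , λ i → covers (∈-allFin i)) s≡n
      go (bs , unique , linked , covers) (inj₂ s≡1+n) = label-without-𝟘 bs (unique , linked , λ i → covers (∈-allFin i)) s≡1+n

-- Lower bounds from cyclic groups and parity

module LowerBound where
  open import Defs hiding (sym)
  open FiniteLists
  open FiniteGroups using (∣-difference⇒≡)
  open AchievableWeights
  open UpperBound
  open import Data.Nat as ℕ using (ℕ; zero; suc; z≤n; s≤s; _%_)
  import Data.Nat.Properties as ℕₚ
  import Data.Nat.Divisibility as ℕᵈ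
  import Data.Nat.DivMod as ℕ
  open import Data.Integer as ℤ using (ℤ; +_)
  import Data.Integer.Properties as ℤₚ
  import Data.Integer.DivMod as ℤ
  open import Data.Integer.Divisibility.Signed as ℤ using (_∣_; divides)
  import Data.Integer.Tactic.RingSolver as IntSolver
  open import Data.Bool using (true; false; if_then_else_)
  open import Data.Fin as Fin using (Fin; zero; suc; toℕ; fromℕ<)
  import Data.Fin.Properties as Finₚ
  open import Data.Fin.Permutation using (Permutation; permutation; _⟨$⟩ʳ_)
  open import Data.List using (List; _∷_; map; length; allFin)
  open import Data.List.Properties using (length-map; length-tabulate)
  import Data.List.Relation.Unary.All.Properties as All
  open import Data.List.Relation.Unary.AllPairs using (_∷_)
  open import Data.List.Relation.Unary.Unique.Propositional.Properties using (map⁺; allFin⁺)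
  open import Data.List.Membership.Propositional.Properties using (∈-map⁻)
  import Data.List.Membership.DecPropositional as DecMembership
  open import Data.Product using (Σ; ∃; _,_; proj₁; proj₂)
  open import Data.Sum using (_⊎_; inj₁; inj₂)
  open import Data.Empty using (⊥-elim)
  open import Relation.Binary.PropositionalEquality as ≡ using (_≡_; _≢_; subst; cong; cong₂)
  open import Relation.Nullary using (¬_; yes; no)
  open import Algebra.Bundles using (AbelianGroup)
  import Algebra.Properties.CommutativeMonoid.Sum as Sum
  import Algebra.Properties.CommutativeSemigroup as CommutativeSemigroupProperties
  open import Level using (0ℓ)

  infix 4 _≡_[_]
  record _≡_[_] (x y : ℤ) (t : ℕ) : Set where
    constructor mod
    field difference : + t ∣ x ℤ.- y

  ℤ/ : ℕ → AbelianGroup 0ℓ 0ℓ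
  ℤ/ t = record
    { Carrier = ℤ ; _≈_ = λ x y → x ≡ y [ t ] ; _∙_ = ℤ._+_ ; ε = + 0 ; _⁻¹ = ℤ.-_
    ; isAbelianGroup = record
      { isGroup = record
        { isMonoid = record
          { isSemigroup = record
            { isMagma = record
              { isEquivalence = record
                { refl = λ {x} → reflexive {x} ≡.refl
                ; sym = λ {x} {y} (mod d) → mod (subst (+ t ∣_) (neg x y) (ℤ.∣m⇒∣-m d))
                ; trans = λ {x} {y} {z} (mod d) (mod e) → mod (subst (+ t ∣_) (add x y z) (ℤ.∣m∣n⇒∣m+n d e)) }
              ; ∙-cong = λ {x} {y} {u} {v} (mod d) (mod e) → mod (subst (+ t ∣_) (add₂ x y u v) (ℤ.∣m∣n⇒∣m+n d e)) }
            ; assoc = λ x y z → reflexive (ℤₚ.+-assoc x y z) }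
          ; identity = (λ x → reflexive (ℤₚ.+-identityˡ x)) , (λ x → reflexive (ℤₚ.+-identityʳ x)) }
        ; inverse = (λ x → reflexive (ℤₚ.+-inverseˡ x)) , (λ x → reflexive (ℤₚ.+-inverseʳ x))
        ; ⁻¹-cong = λ {x} {y} (mod d) → mod (subst (+ t ∣_) (neg₂ x y) (ℤ.∣m⇒∣-m d)) }
      ; comm = λ x y → reflexive (ℤₚ.+-comm x y) } }
    where
    reflexive : ∀ {x y} → x ≡ y → x ≡ y [ t ]
    reflexive {x} ≡.refl = mod (divides (+ 0) (ℤₚ.+-inverseʳ x))
    neg : ∀ x y → ℤ.- (x ℤ.- y) ≡ y ℤ.- x
    neg = IntSolver.solve-∀
    neg₂ : ∀ x y → ℤ.- (x ℤ.- y) ≡ ℤ.- x ℤ.- (ℤ.- y)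
    neg₂ = IntSolver.solve-∀
    add : ∀ x y z → (x ℤ.- y) ℤ.+ (y ℤ.- z) ≡ x ℤ.- z
    add = IntSolver.solve-∀
    add₂ : ∀ x y u v → (x ℤ.- y) ℤ.+ (u ℤ.- v) ≡ (x ℤ.+ u) ℤ.- (y ℤ.+ v)
    add₂ = IntSolver.solve-∀

  ℤ/-order : ∀ t .{{_ : ℕ.NonZero t}} → HasOrder (ℤ/ t) t
  ℤ/-order t = (λ i → + toℕ i) ,
    (λ x → fromℕ< (ℤ.n%ℕd<d x t) , mod (divides (ℤ.- (x ℤ./ℕ t)) (residue x))) ,
    (λ i j (mod d) → Finₚ.toℕ-injective (∣-difference⇒≡ (Finₚ.toℕ<n i) (Finₚ.toℕ<n j) d))
    where
    arith : ∀ r q t → r ℤ.- (r ℤ.+ q ℤ.* t) ≡ ℤ.- q ℤ.* t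
    arith = IntSolver.solve-∀
    residue : ∀ x → + toℕ (fromℕ< (ℤ.n%ℕd<d x t)) ℤ.- x ≡ ℤ.- (x ℤ./ℕ t) ℤ.* + t
    residue x = ≡.trans (cong₂ (λ r y → + r ℤ.- y) (Finₚ.toℕ-fromℕ< (ℤ.n%ℕd<d x t)) (ℤ.a≡a%ℕn+[a/ℕn]*n x t))
      (arith (+ (x ℤ.%ℕ t)) (x ℤ./ℕ t) (+ t))

  module _ {n} (G : Graph n) (A : AbelianGroup 0ℓ 0ℓ) {t} (order : HasOrder A t)
           (f : Labeling G A) (irregular : Irregular G A f) where
    open AbelianGroup A
    open OnFin A t order

    weight-code : Fin n → Fin t
    weight-code i = code (wdeg G A f i)

    weight-code-injective : ∀ {i j} → weight-code i ≡ weight-code j → i ≡ j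
    weight-code-injective {i} {j} e =
      irregular i j (trans (sym (decode-code _)) (trans (reflexive (cong decode e)) (decode-code _)))

    irregular⇒≤ : n ℕ.≤ t
    irregular⇒≤ = Finₚ.injective⇒≤ weight-code-injective

  injective⇒permutation : ∀ {n} (f : Fin n → Fin n) → (∀ {i j} → f i ≡ f j → i ≡ j) →
                          Σ (Permutation n n) λ π → ∀ i → π ⟨$⟩ʳ i ≡ f i
  injective⇒permutation {n} f injective =
    permutation f (λ j → proj₁ (preimage j)) (λ j → ≡.sym (proj₂ (preimage j)))
        (λ i → injective (≡.sym (proj₂ (preimage (f i))))) , λ _ → ≡.refl
    where
    open DecMembership {A = Fin n} Fin._≟_ using (_∈?_)
    images : List (Fin n)
    images = map f (allFin n)
    length-images : length images ≡ n
    length-images = ≡.trans (length-map f (allFin n)) (length-tabulate _)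
    preimage : ∀ j → ∃ λ i → j ≡ f i
    preimage j with j ∈? images
    ... | yes m = let i , _ , e = ∈-map⁻ f m in i , e
    ... | no ∉ = ⊥-elim (ℕₚ.<⇒≱ (ℕₚ.n<1+n n) (subst (λ l → suc l ℕ.≤ n) length-images
                   (unique⇒length≤ (All.¬Any⇒All¬ _ ∉ ∷ map⁺ injective (allFin⁺ n)))))

  module _ (A : AbelianGroup 0ℓ 0ℓ) where
    open AbelianGroup A
    open Sum commutativeMonoid using (sum; sum-permute)
    open CommutativeSemigroupProperties commutativeSemigroup using (interchange)
    open GroupSums A

    gsum≡sum : ∀ m (f : Fin m → Carrier) → gsum A m f ≡ sum f
    gsum≡sum zero    f = ≡.refl
    gsum≡sum (suc m) f = cong (f zero ∙_) (gsum≡sum m (λ i → f (suc i)))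

    gsum-permute : ∀ {n} (f : Fin n → Carrier) (π : Permutation n n) → gsum A n f ≈ gsum A n (λ i → f (π ⟨$⟩ʳ i))
    gsum-permute {n} f π = trans (reflexive (gsum≡sum n f)) (trans (sum-permute f π) (reflexive (≡.sym (gsum≡sum n _))))

    -- The handshaking argument in an abelian group: y is the sum of the entries above the diagonal,
    -- collected row by row.
    gsum-symmetric : ∀ m (M : Fin m → Fin m → Carrier) → (∀ i j → M i j ≈ M j i) → (∀ i → M i i ≈ ε) →
                     ∃ λ y → gsum A m (λ v → gsum A m (M v)) ≈ y ∙ y
    gsum-symmetric zero    M symmetric zeros = ε , sym (identityˡ ε)
    gsum-symmetric (suc m) M symmetric zeros with gsum-symmetric m (λ i j → M (suc i) (suc j))
        (λ i j → symmetric (suc i) (suc j)) (λ i → zeros (suc i))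
    ... | y , e = row ∙ y ,
        trans (∙-cong (trans (∙-congʳ (zeros zero)) (identityˡ row))
        (trans (gsum-∙ m (λ v → M (suc v) zero) (λ v → gsum A m (λ u → M (suc v) (suc u))))
                    (∙-cong (gsum-cong m (λ i → symmetric (suc i) zero)) e)))
                    (trans (sym (assoc row row (y ∙ y))) (interchange row row y y))
      where
      row = gsum A m (λ u → M zero (suc u))

  -- n distinct weights in a group of order n are all its elements, so both sides differ by a
  -- permutation of the summands.
  gsum-weights : ∀ {n} (G : Graph n) (A : AbelianGroup 0ℓ 0ℓ) (order : HasOrder A n) (f : Labeling G A) → Irregular G A f →
                 AbelianGroup._≈_ A (gsum A n (wdeg G A f)) (gsum A n (proj₁ order))
  gsum-weights {n} G A order f irregular =
      trans (gsum-cong n λ i → trans (sym (decode-code (wdeg G A f i))) (reflexive (cong decode (≡.sym (proj₂ π i)))))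
      (sym (gsum-permute A decode (proj₁ π)))
    where
    open AbelianGroup A
    open OnFin A n order
    open GroupSums A using (gsum-cong)
    π = injective⇒permutation (weight-code G A order f irregular) (weight-code-injective G A order f irregular)

  -- Four consecutive integers from k on have the even sum 4k + 6; they are stripped off until two
  -- consecutive integers remain, whose sum is odd. The start k is general to allow for this
  -- induction.
  gsum-range-odd : ∀ t q (f : Fin (2 ℕ.+ q ℕ.* 4) → ℤ) k → (∀ i → f i ≡ k ℤ.+ + toℕ i) →
                   ∃ λ z → gsum (ℤ/ t) (2 ℕ.+ q ℕ.* 4) f ≡ + 1 ℤ.+ + 2 ℤ.* z
  gsum-range-odd t zero f k e = k , ≡.trans (cong₂ (λ a b → a ℤ.+ (b ℤ.+ + 0)) (e zero) (e (suc zero))) (arith k)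
    where
    arith : ∀ k → k ℤ.+ + 0 ℤ.+ (k ℤ.+ + 1 ℤ.+ + 0) ≡ + 1 ℤ.+ + 2 ℤ.* k
    arith = IntSolver.solve-∀
  gsum-range-odd t (suc q) f k e with gsum-range-odd t q (λ i → f (suc (suc (suc (suc i))))) (k ℤ.+ + 4)
    (λ i → ≡.trans (e _) (≡.trans (cong (λ z → k ℤ.+ z) (ℤₚ.pos-+ 4 (toℕ i))) (≡.sym (ℤₚ.+-assoc k (+ 4) (+ toℕ i)))))
  ... | z , e′ = + 2 ℤ.* k ℤ.+ + 3 ℤ.+ z ,
    ≡.trans (cong₂ (λ a b → a ℤ.+ (b ℤ.+ _)) (e zero) (e (suc zero)))
      (≡.trans (cong₂ (λ c d → (k ℤ.+ + 0) ℤ.+ ((k ℤ.+ + 1) ℤ.+ (c ℤ.+ (d ℤ.+ _)))) (e (suc (suc zero))) (e (suc (suc (suc zero)))))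
        (≡.trans (cong (λ r → (k ℤ.+ + 0) ℤ.+ ((k ℤ.+ + 1) ℤ.+ ((k ℤ.+ + 2) ℤ.+ ((k ℤ.+ + 3) ℤ.+ r)))) e′) (arith k z)))
    where
    arith : ∀ k z →
        (k ℤ.+ + 0) ℤ.+ ((k ℤ.+ + 1) ℤ.+ ((k ℤ.+ + 2) ℤ.+ ((k ℤ.+ + 3) ℤ.+ (+ 1 ℤ.+ + 2 ℤ.* z)))) ≡
        + 1 ℤ.+ + 2 ℤ.* (+ 2 ℤ.* k ℤ.+ + 3 ℤ.+ z)
    arith = IntSolver.solve-∀

  weights-even : ∀ {n} (G : Graph n) (A : AbelianGroup 0ℓ 0ℓ) (f : Labeling G A) →
                 ∃ λ y → AbelianGroup._≈_ A (gsum A n (wdeg G A f)) (AbelianGroup._∙_ A y y)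
  weights-even {n} G A f = gsum-symmetric A n (λ v u → if adj G v u then lab f v u else ε) symmetric zeros
    where
    open AbelianGroup A
    symmetric : ∀ i j → (if adj G i j then lab f i j else ε) ≈ (if adj G j i then lab f j i else ε)
    symmetric i j rewrite Graph.sym G i j with adj G j i
    ... | true  = lsym f i j
    ... | false = refl
    zeros : ∀ i → (if adj G i i then lab f i i else ε) ≈ ε
    zeros i rewrite irrefl G i = refl

  gsum-ℤ/-odd : ∀ n q → n ≡ 2 ℕ.+ q ℕ.* 4 → ∃ λ z → gsum (ℤ/ n) n (λ i → + toℕ i) ≡ + 1 ℤ.+ + 2 ℤ.* z
  gsum-ℤ/-odd n q ≡.refl = gsum-range-odd n q (λ i → + toℕ i) (+ 0) (λ i → ≡.sym (ℤₚ.+-identityˡ _))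

  -- Parity is well defined modulo an even n: otherwise 2 would divide 1.
  odd≢even-mod : ∀ n → 2 ℕᵈ.∣ n → ∀ z y → ¬ (+ 1 ℤ.+ + 2 ℤ.* z ≡ y ℤ.+ y [ n ])
  odd≢even-mod n 2∣n z y (mod d) = ℕᵈ.>⇒∤ (s≤s (s≤s z≤n)) (ℤ.∣⇒∣ᵤ {+ 2} {+ 1}
    (subst (+ 2 ∣_) (arith z y) (ℤ.∣m∣n⇒∣m+n (ℤ.∣-trans (ℤ.∣ᵤ⇒∣ 2∣n) d) (divides (y ℤ.- z) (ℤₚ.*-comm (+ 2) (y ℤ.- z))))))
    where
    arith : ∀ z y → (+ 1 ℤ.+ + 2 ℤ.* z ℤ.- (y ℤ.+ y)) ℤ.+ + 2 ℤ.* (y ℤ.- z) ≡ + 1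
    arith = IntSolver.solve-∀

  -- The weights of an irregular ℤ/n-labelling would exhaust ℤ/n, whose elements sum to an odd number, while the sum of
  -- all weights counts every edge twice.
  not-good-2mod4 : ∀ n q → n ≡ 2 ℕ.+ q ℕ.* 4 → .{{_ : ℕ.NonZero n}} → (G : Graph n) → ¬ GoodOrder G n
  not-good-2mod4 n q n≡ G good =
    let f , irregular = good (ℤ/ n) (ℤ/-order n)
        z , odd = gsum-ℤ/-odd n q n≡
        y , even = weights-even G (ℤ/ n) f
    in odd≢even-mod n 2∣n z y (trans (reflexive (≡.sym odd)) (trans (sym (gsum-weights G (ℤ/ n) (ℤ/-order n) f irregular)) even))
    where
    open AbelianGroup (ℤ/ n) using (trans; sym; reflexive)
    2∣n : 2 ℕᵈ.∣ n
    2∣n = subst (2 ℕᵈ.∣_) (≡.sym n≡) (ℕᵈ.∣m∣n⇒∣m+n (ℕᵈ.divides 1 ≡.refl) (ℕᵈ.∣n⇒∣m*n q (ℕᵈ.divides 2 ≡.refl)))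

  -- For every t ≥ 1 the group ℤ/t makes `GoodOrder` non-vacuous, and its t elements must
  -- accommodate n distinct weights.
  good⇒≤ : ∀ {n} (G : Graph n) t → 1 ℕ.≤ t → GoodOrder G t → n ℕ.≤ t
  good⇒≤ G (suc t) _ good = let f , irregular = good (ℤ/ (suc t)) (ℤ/-order (suc t))
      in irregular⇒≤ G (ℤ/ (suc t)) (ℤ/-order (suc t)) f irregular

  good-odd : ∀ {n} (G : Graph n) → NoStarComponent G → ∀ s → ¬ (2 ℕᵈ.∣ s) → s ≡ n ⊎ s ≡ suc n → GoodOrder G s
  good-odd G noStar s odd s≡ A order = Upper.upper G noStar A s order odd s≡

  2∤1+even : ∀ {n} → 2 ℕᵈ.∣ n → ¬ (2 ℕᵈ.∣ suc n)
  2∤1+even {n} 2∣n 2∣1+n = ℕᵈ.>⇒∤ (s≤s (s≤s z≤n)) (ℕᵈ.∣m+n∣m⇒∣n (subst (2 ℕᵈ.∣_) (ℕₚ.+-comm 1 n) 2∣1+n) 2∣n)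

  even-mod-4 : ∀ n r → n % 4 ≡ r → 2 ℕᵈ.∣ r → 2 ℕᵈ.∣ n
  even-mod-4 n r e 2∣r = subst (2 ℕᵈ.∣_) (≡.sym (≡.trans (ℕ.m≡m%n+[m/n]*n n 4) (cong (ℕ._+ n ℕ./ 4 ℕ.* 4) e)))
    (ℕᵈ.∣m∣n⇒∣m+n 2∣r (ℕᵈ.∣n⇒∣m*n (n ℕ./ 4) (ℕᵈ.divides 2 ≡.refl)))

  strength-odd : ∀ {n} (G : Graph n) → NoStarComponent G → n % 2 ≡ 1 → SgEq G n
  strength-odd {n} G noStar n%2≡1 =
    ℕₚ.n≢0⇒n>0 n≢0 , good-odd G noStar n odd (inj₁ ≡.refl) , λ t 1≤t t<n good → ℕₚ.<⇒≱ t<n (good⇒≤ G t 1≤t good)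
    where
    odd : ¬ (2 ℕᵈ.∣ n)
    odd 2∣n = ℕₚ.0≢1+n (≡.trans (≡.sym (ℕᵈ.n∣m⇒m%n≡0 n 2 2∣n)) n%2≡1)
    n≢0 : n ≢ 0
    n≢0 n≡0 = ℕₚ.0≢1+n (≡.trans (cong (_% 2) (≡.sym n≡0)) n%2≡1)

  strength-2mod4 : ∀ {n} (G : Graph n) → NoStarComponent G → n % 4 ≡ 2 → SgEq G (suc n)
  strength-2mod4 {n} G noStar n%4≡2 =
    s≤s z≤n ,
    good-odd G noStar (suc n) (2∤1+even (even-mod-4 n 2 n%4≡2 (ℕᵈ.divides 1 ≡.refl))) (inj₂ ≡.refl) ,
    smaller
    where
    n≡2+4q : n ≡ 2 ℕ.+ n ℕ./ 4 ℕ.* 4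
    n≡2+4q = ≡.trans (ℕ.m≡m%n+[m/n]*n n 4) (cong (ℕ._+ n ℕ./ 4 ℕ.* 4) n%4≡2)
    not-n : ¬ GoodOrder G n
    not-n = not-good-2mod4 n (n ℕ./ 4) n≡2+4q {{subst ℕ.NonZero (≡.sym n≡2+4q) _}} G
    smaller : ∀ t → 1 ℕ.≤ t → t ℕ.< suc n → ¬ GoodOrder G t
    smaller t 1≤t (s≤s t≤n) good = not-n (subst (GoodOrder G) (ℕₚ.≤-antisym t≤n (good⇒≤ G t 1≤t good)) good)

  strength-0mod4 : ∀ {n} (G : Graph n) → NoStarComponent G → n % 4 ≡ 0 → SgLe G (suc n)
  strength-0mod4 {n} G noStar n%4≡0 =
    suc n , s≤s z≤n , ℕₚ.≤-refl ,
    good-odd G noStar (suc n) (2∤1+even (even-mod-4 n 0 n%4≡0 (ℕᵈ.divides 0 ≡.refl))) (inj₂ ≡.refl)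

open import Defs
open import Data.Nat using (ℕ; suc; _%_)
open import Data.Product using (_×_)
open import Relation.Binary.PropositionalEquality using (_≡_)
open import Data.Product using (_,_)
open LowerBound using (strength-odd; strength-2mod4; strength-0mod4)

theorem2p3 : (n : ℕ) (G : Graph n) → NoStarComponent G →
    ((n % 2 ≡ 1 → SgEq G n) × (n % 4 ≡ 2 → SgEq G (suc n)) × (n % 4 ≡ 0 → SgLe G (suc n)))
theorem2p3 n G noStar = strength-odd G noStar , strength-2mod4 G noStar , strength-0mod4 G noStar
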